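{- Let $r, s, u_0, u_1$ be integers with $r^2+4s \neq 0$, and let $u_n = r u_{n-1} + s u_{n-2}$ for $n \geq 2$. Let $\alpha,\beta$ be the roots of $x^2 - rx - s$ and put $a = \frac{u_0\beta - u_1}{\beta-\alpha}$, $b = \frac{u_1 - u_0\alpha}{\beta - \alpha}$, so that $u_n = a\alpha^n + b\beta^n$ for all $n\ge 0$. Suppose the sequence is non-degenerate, i.e. $ab\alpha\beta \neq 0$ and $\alpha/\beta$ is not a root of unity. Let $\epsilon > 0$. Then there exists an effectively computable positive number $C$, depending on $\epsilon, a, b, \alpha, \beta$, such that for every integer $N > C$, $$\omega\Big(\prod_{\substack{n=1\\ u_n \neq 0}}^N u_n\Big) > \big(1 - 1/\sqrt{2} - \epsilon\big) N.$$
   Context: For a nonzero integer $m$, $\omega(m)$ denotes the number of distinct prime factors of $m$. -}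

module Defs where

open import Data.Nat as ℕ using (ℕ; zero; suc)
open import Data.Nat.Divisibility using (_∣?_)
open import Data.Nat.Primality using (prime?)
open import Data.Integer as ℤ using (ℤ; +_)
open import Data.Rational as ℚ using (ℚ; _/_)
open import Data.List using (List; filter; length; upTo)
open import Data.Product using (_×_)
open import Data.Sum using (_⊎_)
open import Relation.Nullary.Decidable using (_×-dec_; yes; no)

useq : ℤ → ℤ → ℤ → ℤ → ℕ → ℤ
useq r s u0 u1 zero = u0
useq r s u0 u1 (suc zero) = u1
useq r s u0 u1 (suc (suc n)) =
  r ℤ.* useq r s u0 u1 (suc n) ℤ.+ s ℤ.* useq r s u0 u1 n

-- Lucas sequence U_n = (α^n - β^n)/(α - β) attached to x^2 - r x - s.
-- Since α ≠ β (r^2+4s ≠ 0), α^k = β^k  iff  U_k = 0.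
lucasU : ℤ → ℤ → ℕ → ℤ
lucasU r s = useq r s (+ 0) (+ 1)

-- ω(m): number of distinct primes dividing the nonzero integer m
-- (primes dividing |m| are all ≤ |m|).
ω : ℤ → ℕ
ω m = length (filter (λ p → prime? p ×-dec (p ∣? ℤ.∣ m ∣)) (upTo (suc ℤ.∣ m ∣)))

prodNZ : (ℕ → ℤ) → ℕ → ℤ
prodNZ u zero = + 1
prodNZ u (suc N) with u (suc N) ℤ.≟ + 0
... | yes _ = prodNZ u N
... | no _ = u (suc N) ℤ.* prodNZ u N

-- Encodes  (w : ℕ) > (1 - 1/√2 - ε) * N  exactly, without reals:
-- with x = (1-ε)N - w, the inequality is x < N/√2, i.e. x < 0 or 2x² < N².
ExceedsBound : ℚ → ℕ → ℕ → Set
ExceedsBound ε N w =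
  let x = (ℚ.1ℚ ℚ.- ε) ℚ.* (+ N / 1) ℚ.- (+ w / 1)
      n = + N / 1
  in (x ℚ.< ℚ.0ℚ) ⊎ ((+ 2 / 1) ℚ.* x ℚ.* x ℚ.< n ℚ.* n)

{-# OPTIONS --safe #-}
-- With d = gcd (r², s), R = r² / d and S = s / d are coprime, and u n is, up to a factor d or r, a power
-- of √d times v n, where v is the Lehmer-type sequence v (n + 2) = c v (n + 1) + S v n with c alternating
-- between 1 and R.  Let L be its fundamental solution (the Lehmer numbers).  If p ^ j divides v n and
-- v (n + k), then, up to a fixed factor, p ^ j divides L k.  In a window (h, h + l], remove for every prime p
-- dividing a term one index where the p-adic valuation of v is maximal; because the numbers
-- L 1 ⋯ L (i + j) / (L 1 ⋯ L i · L 1 ⋯ L j) are integers, the product of the remaining terms divides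
-- κ ^ l · L 1 ⋯ L l, which has size about |α| ^ (l² / 2).
-- No linear forms in logarithms are needed for the lower bound: v (n + k) = L k v (n + 1) + G k v n with
-- L k ≠ 0 shows that among any K consecutive terms all but one have the maximal order |α| ^ n.
-- With t primes the remaining product is therefore at least about |α| ^ (((N - t)² - h²) / 2) for N = h + l, so
-- (N - t)² ≤ h² + l² + o(N²), and h = l = N / 2 gives t ≥ (1 - 1/√2 - ε) N.
module Submission where

open import Defs

-- Coprimality of `R` and `S` is the point of the rescaling: a prime dividing `S` then divides no
-- `L (k + 1)` and divides late terms of `v` only to an order bounded through `Δ`, so that all
-- primes obey the bound for common divisors. The rescaled polynomial is x² - √R x - S, and the
-- alternating coefficient keeps its sequences in ℤ. Sizes are handled through squares and an
-- integral sequence `E` in place of powers of |α|²: for complex roots |α|² = |S|, while for real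
-- roots the powers of 2α² = R + 2S + √(R(R + 4S)) are replaced by their rational parts. Complex
-- roots with |S| = 1 would give no growth at all; non-degeneracy excludes them. The number ε enters
-- as 1/e with `e` its denominator, since ε ≥ 1/e. Taking `K = e`, the terms of too small order cost
-- about l/e ≤ N/(2e) indices, which leaves half of the slack N/e for errors of lower order.

module Naturals where

  open import Data.Nat
  open import Data.Nat.Properties
  open import Data.Nat.Divisibility
  open import Data.Nat.Primality using (Prime; prime?; euclidsLemma; prime⇒nonZero; prime⇒nonTrivial; prime⇒irreducible)
  open import Data.Nat.Primality.Factorisation using (factorise)
  open import Data.Nat.Coprimality using (Coprime; coprime-divisor)
  open import Data.Nat.ListAction using (product)
  open import Data.Nat.Tactic.RingSolver using (solve-∀)
  open import Data.Bool using (Bool; T; true; false; if_then_else_; not; _∧_)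
  open import Data.Empty using (⊥-elim)
  open import Data.List using (List; []; _∷_; length; map)
  open import Data.List.Properties using (length-map)
  open import Data.List.Relation.Unary.All using (All; []; _∷_)
  open import Data.List.Membership.Propositional using (_∈_)
  open import Data.List.Membership.Propositional.Properties using (∈-map⁺)
  open import Data.List.Membership.DecPropositional _≟_ using (_∈?_)
  open import Data.Product using (∃; _×_; _,_; proj₁; proj₂)
  open import Data.Sum using (_⊎_; inj₁; inj₂)
  open import Relation.Binary.Definitions using (tri<; tri≈; tri>)
  open import Relation.Binary.PropositionalEquality
  open import Relation.Nullary using (¬_; Dec; yes; no)
  open import Relation.Nullary.Decidable using (does; dec-true; dec-false)

  private variable p : ℕ

  -- Valuations at a prime, expressed by divisibility by its powers.

  ∏ : ℕ → ℕ → (ℕ → ℕ) → ℕ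
  ∏ a zero f = 1
  ∏ a (suc l) f = f a * ∏ (suc a) l f

  infix 4 _≼[_]_
  -- This is v_p(a) ≤ v_p(b). Quantifying over all powers gives 0 the valuation ∞, so vanishing
  -- terms of a sequence need no special case.
  _≼[_]_ : ℕ → ℕ → ℕ → Set
  a ≼[ p ] b = ∀ j → p ^ j ∣ a → p ^ j ∣ b

  prime-power-nonZero : Prime p → ∀ j → NonZero (p ^ j)
  prime-power-nonZero {p} pr j = m^n≢0 p j
    where instance _ = prime⇒nonZero pr

  prime∤1 : Prime p → ¬ p ∣ 1
  prime∤1 pr h with ∣1⇒≡1 h
  ... | refl with () ← prime⇒nonTrivial pr

  prime∤power : Prime p → ∀ {m} → ¬ p ∣ m → ∀ n → ¬ p ∣ m ^ n
  prime∤power pr p∤m zero h = prime∤1 pr h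
  prime∤power pr {m} p∤m (suc n) h with euclidsLemma m (m ^ n) pr h
  ... | inj₁ x = p∤m x
  ... | inj₂ x = prime∤power pr p∤m n x

  -- Additivity of the valuation: once `p ^ j` is split, Euclid's lemma puts the next factor `p`
  -- into one of the two cofactors.
  split-power : Prime p → ∀ a b j → p ^ j ∣ a * b →
    ∃ λ i → ∃ λ k → i + k ≡ j × p ^ i ∣ a × p ^ k ∣ b
  split-power pr a b zero _ = 0 , 0 , refl , 1∣ a , 1∣ b
  split-power {p} pr a b (suc j) h
    with split-power pr a b j (∣-trans (n∣m*n p) h)
  ... | i , k , refl , divides a₁ refl , divides b₁ refl
    with euclidsLemma a₁ b₁ pr
           (*-cancelʳ-∣ (p ^ (i + k)) {{prime-power-nonZero pr (i + k)}}
             (subst (p * p ^ (i + k) ∣_) rearrange h))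
    where
    rearrange : a₁ * p ^ i * (b₁ * p ^ k) ≡ a₁ * b₁ * p ^ (i + k)
    rearrange = trans (lemma a₁ (p ^ i) b₁ (p ^ k))
                      (cong (a₁ * b₁ *_) (sym (^-distribˡ-+-* p i k)))
      where lemma : ∀ w x y z → w * x * (y * z) ≡ w * y * (x * z)
            lemma = solve-∀
  ... | inj₁ p∣a₁ = suc i , k , refl , *-monoˡ-∣ (p ^ i) p∣a₁ , n∣m*n b₁
  ... | inj₂ p∣b₁ = i , suc k , +-suc i k , n∣m*n a₁ , *-monoˡ-∣ (p ^ k) p∣b₁

  *-≼ : Prime p → ∀ {a a′ b b′} → a ≼[ p ] a′ → b ≼[ p ] b′ → a * b ≼[ p ] a′ * b′
  *-≼ {p} pr {a} {a′} {b} {b′} f g j h with split-power pr a b j h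
  ... | i , k , refl , x , y =
    subst (_∣ a′ * b′) (sym (^-distribˡ-+-* p i k)) (*-pres-∣ (f i x) (g k y))

  ∤⇒≼ : ∀ {a} → ¬ (p ∣ a) → ∀ b → a ≼[ p ] b
  ∤⇒≼ p∤a b zero _ = 1∣ b
  ∤⇒≼ p∤a b (suc j) h = ⊥-elim (p∤a (∣-trans (m∣m*n _) h))

  InRange : ℕ → ℕ → ℕ → Set
  InRange a l n = a ≤ n × n < a + l

  head-inRange : ∀ a l → InRange a (suc l) a
  head-inRange a l = ≤-refl , m<m+n a z<s

  tail-inRange : ∀ {a l n} → InRange (suc a) l n → InRange a (suc l) n
  tail-inRange {a} {l} {n} (h , k) = <⇒≤ h , subst (n <_) (sym (+-suc a l)) k

  ∏-≼ : Prime p → ∀ {f g} a l → (∀ n → InRange a l n → f n ≼[ p ] g n) → ∏ a l f ≼[ p ] ∏ a l g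
  ∏-≼ pr a zero H j h = h
  ∏-≼ pr a (suc l) H = *-≼ pr (H a (head-inRange a l)) (∏-≼ pr (suc a) l λ n i → H n (tail-inRange i))

  pow-cancelˡ : Prime p → ∀ {a} j → p ^ suc j ∣ p * a → p ^ j ∣ a
  pow-cancelˡ {p} pr j h = *-cancelˡ-∣ p {{prime⇒nonZero pr}} h

  -- Divide both numbers by `p` until `p` misses one of them. A zero on the left is above
  -- everything; otherwise `a` shrinks at each division, which the fuel records.
  ≼-total : Prime p → ∀ a b → a ≼[ p ] b ⊎ b ≼[ p ] a
  ≼-total {p} pr a b = go a a b ≤-refl
    where
    go : ∀ fuel a b → a ≤ fuel → a ≼[ p ] b ⊎ b ≼[ p ] a
    go _ zero b _ = inj₂ λ j _ → _ ∣0
    go (suc fuel) a@(suc _) b a≤ with p ∣? a | p ∣? b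
    ... | no p∤a | _ = inj₁ (∤⇒≼ p∤a b)
    ... | yes _ | no p∤b = inj₂ (∤⇒≼ p∤b a)
    ... | yes p∣a@(divides a′ eqa) | yes (divides b′ refl)
      with go fuel a′ b′ (≤-pred (≤-trans (quotient-< p∣a {{prime⇒nonTrivial pr}}) a≤))
    ... | inj₁ h = inj₁ (subst (_≼[ p ] b′ * p) (sym eqa) (*-≼ pr {a = a′} {b = p} h (λ _ x → x)))
    ... | inj₂ h = inj₂ (subst (b′ * p ≼[ p ]_) (sym eqa) (*-≼ pr {a = b′} {b = p} h (λ _ x → x)))

  maximal-index : Prime p → (f : ℕ → ℕ) → ∀ a l →
    ∃ λ c → InRange a (suc l) c × (∀ n → InRange a (suc l) n → f n ≼[ p ] f c)
  maximal-index pr f a zero = a , head-inRange a 0 , λ n (h , k) →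
    subst (λ m → f n ≼[ _ ] f m) (≤-antisym (≤-pred (subst (n <_) (+-comm a 1) k)) h) λ _ x → x
  maximal-index pr f a (suc l) with maximal-index pr f (suc a) l
  ... | c , c∈ , H with ≼-total pr (f a) (f c)
  ... | inj₁ fa≼fc = c , tail-inRange c∈ , λ n (h , k) → case-split n h k
    where
    case-split : ∀ n → a ≤ n → n < a + suc (suc l) → f n ≼[ _ ] f c
    case-split n h k with m≤n⇒m<n∨m≡n h
    ... | inj₁ a<n = H n (a<n , subst (n <_) (+-suc a (suc l)) k)
    ... | inj₂ refl = fa≼fc
  ... | inj₂ fc≼fa = a , head-inRange a (suc l) , λ n (h , k) → case-split n h k
    where
    case-split : ∀ n → a ≤ n → n < a + suc (suc l) → f n ≼[ _ ] f a
    case-split n h k with m≤n⇒m<n∨m≡n h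
    ... | inj₁ a<n = λ j x → fc≼fa j (H n (a<n , subst (n <_) (+-suc a (suc l)) k) j x)
    ... | inj₂ refl = λ _ x → x

  coprime-power : Prime p → ∀ {a} j → ¬ (p ∣ a) → Coprime (p ^ j) a
  coprime-power {p} pr {a} j p∤a {i} (i∣pʲ , i∣a) = go j i∣pʲ
    where
    go : ∀ j → i ∣ p ^ j → i ≡ 1
    go zero h = ∣1⇒≡1 h
    go (suc j) h = go j (coprime-divisor i⊥p h)
      where
      i⊥p : Coprime i p
      i⊥p {k} (k∣i , k∣p) with prime⇒irreducible pr k∣p
      ... | inj₁ k≡1 = k≡1
      ... | inj₂ refl = ⊥-elim (p∤a (∣-trans k∣i i∣a))

  power-cancel-∤ : Prime p → ∀ {a b} j → ¬ (p ∣ a) → p ^ j ∣ a * b → p ^ j ∣ b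
  power-cancel-∤ pr j p∤a = coprime-divisor (coprime-power pr j p∤a)

  prime∣prime⇒≡ : ∀ {p q} → Prime p → Prime q → p ∣ q → p ≡ q
  prime∣prime⇒≡ pp pq p∣q with prime⇒irreducible pq p∣q
  ... | inj₁ refl = ⊥-elim (prime∤1 pp ∣-refl)
  ... | inj₂ eq = eq

  -- The prime factors of `x` are cancelled from `y` one at a time. Cancelling `p` lowers both
  -- valuations at `p` by one and changes no valuation at another prime.
  local-global-∣ : ∀ x y → .{{NonZero x}} → (∀ p → Prime p → x ≼[ p ] y) → x ∣ y
  local-global-∣ x y H with factorise x
  ... | record { factors = ps ; isFactorisation = refl ; factorsPrime = ps-prime } = go ps y ps-prime H
    where
    go : ∀ ps y → All Prime ps → (∀ p → Prime p → product ps ≼[ p ] y) → product ps ∣ y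
    go [] y _ _ = 1∣ y
    go (p ∷ ps) y (pp ∷ pps) H
      with H p pp 1 (subst (_∣ p * product ps) (sym (*-identityʳ p)) (m∣m*n (product ps)))
    ... | p∣y with subst (_∣ y) (*-identityʳ p) p∣y
    ... | divides y′ refl = subst (_∣ y′ * p) (*-comm (product ps) p) (*-monoˡ-∣ p (go ps y′ pps H′))
      where
      H′ : ∀ q → Prime q → product ps ≼[ q ] y′
      H′ q pq j h with q ≟ p
      ... | yes refl = pow-cancelˡ pq j (subst (p ^ suc j ∣_) (*-comm y′ p) (H p pp (suc j) (*-monoʳ-∣ p h)))
      ... | no q≢p = power-cancel-∤ pq j (λ q∣p → q≢p (prime∣prime⇒≡ pq pp q∣p))
                       (subst (q ^ j ∣_) (*-comm y′ p) (H q pq j (∣n⇒∣m*n p h)))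

  ∏-split : ∀ a i j f → ∏ a (i + j) f ≡ ∏ a i f * ∏ (a + i) j f
  ∏-split a zero j f = sym (trans (+-identityʳ _) (cong (λ b → ∏ b j f) (+-identityʳ a)))
  ∏-split a (suc i) j f = trans (cong (f a *_) (∏-split (suc a) i j f))
    (trans (sym (*-assoc (f a) _ _)) (cong (λ b → f a * ∏ (suc a) i f * ∏ b j f) (sym (+-suc a i))))

  ∏-* : ∀ a l f g → ∏ a l (λ n → f n * g n) ≡ ∏ a l f * ∏ a l g
  ∏-* a zero f g = refl
  ∏-* a (suc l) f g = trans (cong (f a * g a *_) (∏-* (suc a) l f g)) (lemma (f a) (g a) _ _)
    where lemma : ∀ x y z t → x * y * (z * t) ≡ x * z * (y * t)
          lemma = solve-∀

  ∏-const : ∀ a l k → ∏ a l (λ _ → k) ≡ k ^ l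
  ∏-const a zero k = refl
  ∏-const a (suc l) k = cong (k *_) (∏-const (suc a) l k)

  ∏-nonZero : ∀ a l f → (∀ n → InRange a l n → NonZero (f n)) → NonZero (∏ a l f)
  ∏-nonZero a zero f H = _
  ∏-nonZero a (suc l) f H = m*n≢0 (f a) (∏ (suc a) l f)
    {{H a (head-inRange a l)}} {{∏-nonZero (suc a) l f λ n i → H n (tail-inRange i)}}

  -- Generalised factorials and binomial coefficients.

  module Factorial (L : ℕ → ℕ) where

    fact : ℕ → ℕ
    fact zero = 1
    fact (suc n) = L (suc n) * fact n

    -- The value 1 at distance 0 lets the removed index contribute nothing to a product of
    -- distances.
    L* : ℕ → ℕ
    L* zero = 1
    L* (suc k) = L (suc k)

    -- Pascal's rule: `add` stands for an identity that writes `L (i + j)` as a combination of `L i`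
    -- and `L j`, and is applied with `z` the factorial of the total index minus one.
    fact-*-∣ : (∀ e i j z → e ∣ L i * z → e ∣ L j * z → e ∣ L (i + j) * z) →
      ∀ i j → fact i * fact j ∣ fact (i + j)
    fact-*-∣ add zero j = ∣-reflexive (+-identityʳ (fact j))
    fact-*-∣ add (suc i) zero = ∣-reflexive (trans (*-identityʳ _) (cong (λ k → L (suc k) * fact k) (sym (+-identityʳ i))))
    fact-*-∣ add (suc i) (suc j) = add _ (suc i) (suc j) _
      (subst (_∣ L (suc i) * fact (i + suc j)) (sym (*-assoc (L (suc i)) _ _)) (*-monoʳ-∣ (L (suc i)) (fact-*-∣ add i (suc j))))
      (subst₂ _∣_ (lemma (L (suc j)) (fact (suc i)) (fact j)) (cong (λ k → L (suc j) * fact k) (sym (+-suc i j)))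
        (*-monoʳ-∣ (L (suc j)) (fact-*-∣ add (suc i) j)))
      where lemma : ∀ x y z → x * (y * z) ≡ y * (x * z)
            lemma = solve-∀

    L*-right : ∀ c k → L* ∣ c + suc k - c ∣ ≡ L (suc k)
    L*-right c k = cong L* (trans (∣-∣-comm (c + suc k) c) (∣m-m+n∣≡n c (suc k)))

    ∏-left : ∀ a i → ∏ a i (λ n → L* ∣ n - (a + i) ∣) ≡ fact i
    ∏-left a zero = refl
    ∏-left a (suc i) = cong₂ _*_ (cong L* (∣m-m+n∣≡n a (suc i)))
      (trans (cong (λ c → ∏ (suc a) i (λ n → L* ∣ n - c ∣)) (+-suc a i)) (∏-left (suc a) i))

    ∏-right : ∀ c j → ∏ (suc c) j (λ n → L* ∣ n - c ∣) ≡ fact j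
    ∏-right c zero = refl
    ∏-right c (suc j) = begin
      ∏ (suc c) (suc j) δ                    ≡⟨ cong (λ k → ∏ (suc c) k δ) (sym (+-comm j 1)) ⟩
      ∏ (suc c) (j + 1) δ                    ≡⟨ ∏-split (suc c) j 1 δ ⟩
      ∏ (suc c) j δ * (δ (suc c + j) * 1)    ≡⟨ cong₂ _*_ (∏-right c j) (trans (*-identityʳ _)
                                                 (trans (cong δ (sym (+-suc c j))) (L*-right c j))) ⟩
      fact j * L (suc j)                     ≡⟨ *-comm (fact j) _ ⟩
      fact (suc j)                           ∎
      where
      open ≡-Reasoning
      δ = λ n → L* ∣ n - c ∣

    -- With `i` indices before `c` and `j` after it, the distances multiply to `fact i * fact j`;
    -- since `l = i + j + 1`, this divides even the factorial of `l - 1`.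
    ∏-distances-∣ : (∀ i j → fact i * fact j ∣ fact (i + j)) →
      ∀ a l c → InRange a l c → ∏ a l (λ n → L* ∣ n - c ∣) ∣ fact l
    ∏-distances-∣ H a l c (a≤c , c<) with m≤n⇒∃[o]m+o≡n a≤c
    ... | i , refl with m≤n⇒∃[o]m+o≡n (+-cancelˡ-< a i l c<)
    ... | j , refl = subst (_∣ fact (suc i + j)) (sym total) (∣-trans (H i j) (n∣m*n (L (suc (i + j)))))
      where
      open ≡-Reasoning
      c′ = a + i
      δ = λ n → L* ∣ n - c′ ∣
      total : ∏ a (suc i + j) δ ≡ fact i * fact j
      total = begin
        ∏ a (suc i + j) δ              ≡⟨ cong (λ k → ∏ a k δ) (sym (+-suc i j)) ⟩
        ∏ a (i + suc j) δ              ≡⟨ ∏-split a i (suc j) δ ⟩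
        ∏ a i δ * (δ c′ * ∏ (suc c′) j δ) ≡⟨ cong₂ _*_ (∏-left a i) (cong₂ _*_ (cong L* (∣n-n∣≡0 c′)) (∏-right c′ j)) ⟩
        fact i * (1 * fact j)          ≡⟨ cong (fact i *_) (*-identityˡ _) ⟩
        fact i * fact j                ∎

    -- Checked one prime at a time. If `p` has its peak at the removed index `c`, every power of `p`
    -- in a kept `w n` also divides `w c`, hence divides `κ * L ∣n - c∣`, and these distances
    -- multiply to a divisor of `fact l`. A prime of the other kind divides no kept term.
    kept-product-∣ : (∀ i j → fact i * fact j ∣ fact (i + j)) →
      (w : ℕ → ℕ) (keep : ℕ → Bool) (κ a l : ℕ) →
      (∀ n → keep n ≡ true → NonZero (w n)) →
      (∀ p → Prime p → ∀ n m j → InRange a l n → InRange a l m → n ≢ m →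
        p ^ j ∣ w n → p ^ j ∣ w m → p ^ j ∣ κ * L (∣ n - m ∣)) →
      (∀ p → Prime p → (∀ n → InRange a l n → keep n ≡ true → ¬ p ∣ w n) ⊎
        (∃ λ c → InRange a l c × keep c ≡ false × (∀ n → InRange a l n → keep n ≡ true → w n ≼[ p ] w c))) →
      ∏ a l (λ n → if keep n then w n else 1) ∣ κ ^ l * fact l
    kept-product-∣ H w keep κ a l w≢0 common removed =
      local-global-∣ _ _ {{∏-nonZero a l _ (λ n _ → nz n)}} local
      where
      f = λ n → if keep n then w n else 1
      nz : ∀ n → NonZero (f n)
      nz n with keep n in eq
      ... | true = w≢0 n eq
      ... | false = _
      local : ∀ p → Prime p → ∏ a l f ≼[ p ] κ ^ l * fact l
      local p pr j h with removed p pr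
      ... | inj₁ none = ∣-trans (∏-≼ pr a l step j h)
              (subst (_∣ κ ^ l * fact l) (sym (trans (∏-const a l 1) (^-zeroˡ l))) (1∣ _))
        where
        step : ∀ n → InRange a l n → f n ≼[ p ] 1
        step n n∈ with keep n in eq
        ... | true = ∤⇒≼ (none n n∈ eq) 1
        ... | false = λ _ x → x
      ... | inj₂ (c , c∈ , c-removed , max) = ∣-trans (∏-≼ pr a l step j h)
              (subst (_∣ κ ^ l * fact l) (sym (trans (∏-* a l _ _) (cong (_* _) (∏-const a l κ))))
                (*-monoʳ-∣ (κ ^ l) (∏-distances-∣ H a l c c∈)))
        where
        L≡L* : ∀ {n} → n ≢ c → L ∣ n - c ∣ ≡ L* ∣ n - c ∣
        L≡L* {n} n≢c with ∣ n - c ∣ in eq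
        ... | zero = ⊥-elim (n≢c (∣m-n∣≡0⇒m≡n eq))
        ... | suc _ = refl
        step : ∀ n → InRange a l n → f n ≼[ p ] κ * L* (∣ n - c ∣)
        step n n∈ with keep n in eq
        ... | false = λ i x → ∣-trans x (1∣ _)
        ... | true = λ i x → subst (λ y → p ^ i ∣ κ * y) (L≡L* n≢c) (common p pr n c i n∈ c∈ n≢c x (max n n∈ eq i x))
          where
          n≢c : n ≢ c
          n≢c refl with () ← trans (sym eq) c-removed

  -- Sums and counts over index ranges.

  ∑ : ℕ → ℕ → (ℕ → ℕ) → ℕ
  ∑ a zero f = 0
  ∑ a (suc l) f = f a + ∑ (suc a) l f

  count : ℕ → ℕ → (ℕ → Bool) → ℕ
  count a l b = ∑ a l (λ n → if b n then 1 else 0)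

  ∑-mono : ∀ a l {f g} → (∀ n → f n ≤ g n) → ∑ a l f ≤ ∑ a l g
  ∑-mono a zero H = z≤n
  ∑-mono a (suc l) H = +-mono-≤ (H a) (∑-mono (suc a) l H)

  ∑-+ : ∀ a l f g → ∑ a l (λ n → f n + g n) ≡ ∑ a l f + ∑ a l g
  ∑-+ a zero f g = refl
  ∑-+ a (suc l) f g = trans (cong (f a + g a +_) (∑-+ (suc a) l f g)) (lemma (f a) (g a) _ _)
    where lemma : ∀ x y z t → x + y + (z + t) ≡ x + z + (y + t)
          lemma = solve-∀

  ∑-one : ∀ a l → ∑ a l (λ _ → 1) ≡ l
  ∑-one a zero = refl
  ∑-one a (suc l) = cong suc (∑-one (suc a) l)

  ∏-mono : ∀ a l {f g} → (∀ n → f n ≤ g n) → ∏ a l f ≤ ∏ a l g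
  ∏-mono a zero H = ≤-refl
  ∏-mono a (suc l) H = *-mono-≤ (H a) (∏-mono (suc a) l H)

  -- The elements of a set of size m in [a, ∞) sum to at least a + (a + 1) + … + (a + m - 1).
  sum-kept-≥ : ∀ keep a l → let m = count a l keep in
    m * (2 * a) + m * m ≤ m + 2 * ∑ a l (λ n → if keep n then n else 0)
  sum-kept-≥ keep a zero = z≤n
  sum-kept-≥ keep a (suc l) with keep a | sum-kept-≥ keep (suc a) l
  ... | true | ih = subst₂ _≤_ (lemma₁ a m) (lemma₂ a m s) (+-monoʳ-≤ (1 + 2 * a) ih)
    where
    m = count (suc a) l keep
    s = ∑ (suc a) l (λ n → if keep n then n else 0)
    lemma₁ : ∀ a m → 1 + 2 * a + (m * (2 * (1 + a)) + m * m) ≡ (1 + m) * (2 * a) + (1 + m) * (1 + m)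
    lemma₁ = solve-∀
    lemma₂ : ∀ a m s → 1 + 2 * a + (m + 2 * s) ≡ 1 + m + 2 * (a + s)
    lemma₂ = solve-∀
  ... | false | ih = ≤-trans (+-monoˡ-≤ (m * m) (*-monoʳ-≤ m (*-monoʳ-≤ 2 (n≤1+n a)))) ih
    where m = count (suc a) l keep

  count-split : ∀ (b c : ℕ → Bool) a l → l ≤ count a l (λ n → b n ∧ not (c n)) + (count a l (λ n → not (b n)) + count a l c)
  count-split b c a l = begin
    l                                         ≡⟨ sym (∑-one a l) ⟩
    ∑ a l (λ _ → 1)                           ≤⟨ ∑-mono a l (λ n → pointwise (b n) (c n)) ⟩
    ∑ a l (λ n → kept n + (unb n + inc n))    ≡⟨ ∑-+ a l kept (λ n → unb n + inc n) ⟩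
    ∑ a l kept + ∑ a l (λ n → unb n + inc n)  ≡⟨ cong (∑ a l kept +_) (∑-+ a l unb inc) ⟩
    ∑ a l kept + (∑ a l unb + ∑ a l inc)      ∎
    where
    open ≤-Reasoning
    kept = λ n → if b n ∧ not (c n) then 1 else 0
    unb = λ n → if not (b n) then 1 else 0
    inc = λ n → if c n then 1 else 0
    pointwise : ∀ x y → 1 ≤ (if x ∧ not y then 1 else 0) + ((if not x then 1 else 0) + (if y then 1 else 0))
    pointwise true true = ≤-refl
    pointwise true false = ≤-refl
    pointwise false y = s≤s z≤n

  count-none : ∀ b a l → (∀ n → a ≤ n → b n ≡ false) → count a l b ≡ 0
  count-none b a zero H = refl
  count-none b a (suc l) H rewrite H a ≤-refl = count-none b (suc a) l λ n h → H n (<⇒≤ h)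

  count-≡ : ∀ c a l → count a l (λ n → does (n ≟ c)) ≤ 1
  count-≡ c a zero = z≤n
  count-≡ c a (suc l) with a ≡ᵇ c in eq
  ... | false = count-≡ c (suc a) l
  ... | true = ≤-reflexive (cong suc (count-none _ (suc a) l λ n h →
        dec-false (n ≟ c) λ { refl → <-irrefl (≡ᵇ⇒≡ a c (subst T (sym eq) _)) h }))

  count-∈ : ∀ ρ a l → count a l (λ n → does (n ∈? ρ)) ≤ length ρ
  count-∈ [] a l = ≤-reflexive (count-none _ a l λ n _ → refl)
  count-∈ (c ∷ ρ) a l = ≤-trans (∑-mono a l pointwise)
    (≤-trans (≤-reflexive (∑-+ a l _ _)) (+-mono-≤ (count-≡ c a l) (count-∈ ρ a l)))
    where
    pointwise : ∀ n → (if does (n ∈? (c ∷ ρ)) then 1 else 0) ≤ (if does (n ≟ c) then 1 else 0) + (if does (n ∈? ρ) then 1 else 0)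
    pointwise n with does (n ≟ c) | does (n ∈? ρ)
    ... | true | _ = s≤s z≤n
    ... | false | true = ≤-refl
    ... | false | false = ≤-refl

  -- Each element is followed by `K` indices outside `b`, which it can be charged to; the last
  -- summand `K` covers a stretch that sticks out of the range.
  count-sparse : ∀ K b → (∀ n k → 1 ≤ k → k ≤ K → b n ≡ true → b (n + k) ≡ false) →
    ∀ a l → K * count a l b ≤ l + K
  count-sparse K b sparse a l = ≤-trans (m≤m+n _ 0) (go 0 a l z≤n (empty a))
    where
    empty : ∀ a n → a ≤ n → n < a + 0 → b n ≡ false
    empty a n h k = ⊥-elim (<⇒≱ k (subst (_≤ n) (sym (+-identityʳ a)) h))
    -- r is the length of an initial stretch already known to contain no element of b.
    go : ∀ r a l → r ≤ K → (∀ n → a ≤ n → n < a + r → b n ≡ false) → K * count a l b + r ≤ l + K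
    go r a zero r≤K H = subst (λ z → z + r ≤ K) (sym (*-zeroʳ K)) r≤K
    go (suc r) a (suc l) r≤K H rewrite H a ≤-refl (m<m+n a z<s) =
      subst (_≤ suc (l + K)) (sym (+-suc _ r))
        (s≤s (go r (suc a) l (<⇒≤ r≤K) λ n h k → H n (<⇒≤ h) (subst (n <_) (sym (+-suc a r)) k)))
    go zero a (suc l) r≤K H with b a in eq
    ... | false = ≤-trans (go 0 (suc a) l z≤n (empty (suc a))) (n≤1+n _)
    ... | true = subst (_≤ suc (l + K)) (sym (trans (+-identityʳ _) (trans (*-suc K _) (+-comm K _))))
        (≤-trans (go K (suc a) l ≤-refl after) (n≤1+n _))
      where
      after : ∀ n → suc a ≤ n → n < suc a + K → b n ≡ false
      after n h k with m≤n⇒∃[o]m+o≡n h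
      ... | o , refl = subst (λ z → b z ≡ false) (+-suc a o)
            (sparse a (suc o) (s≤s z≤n) (+-cancelˡ-< (suc a) o K k) eq)

  -- Elementary inequalities and the growth axioms.

  sq : ℕ → ℕ
  sq n = n * n

  sq-+-≤ : ∀ x y → sq (x + y) ≤ 2 * (sq x + sq y)
  sq-+-≤ x y with ≤-total x y
  ... | inj₁ x≤y with m≤n⇒∃[o]m+o≡n x≤y
  ... | o , refl = subst (sq (x + (x + o)) ≤_) (lemma x o) (m≤m+n _ (o * o))
    where lemma : ∀ x o → (x + (x + o)) * (x + (x + o)) + o * o ≡ 2 * (x * x + (x + o) * (x + o))
          lemma = solve-∀
  sq-+-≤ x y | inj₂ y≤x with m≤n⇒∃[o]m+o≡n y≤x
  ... | o , refl = subst (sq ((y + o) + y) ≤_) (lemma y o) (m≤m+n _ (o * o))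
    where lemma : ∀ x o → ((x + o) + x) * ((x + o) + x) + o * o ≡ 2 * ((x + o) * (x + o) + x * x)
          lemma = solve-∀

  sq-mono : ∀ {x y} → x ≤ y → sq x ≤ sq y
  sq-mono h = *-mono-≤ h h

  ^-distribʳ-* : ∀ m n k → (m * n) ^ k ≡ m ^ k * n ^ k
  ^-distribʳ-* m n zero = refl
  ^-distribʳ-* m n (suc k) = trans (cong (m * n *_) (^-distribʳ-* m n k)) (lemma m n (m ^ k) (n ^ k))
    where lemma : ∀ w x y z → w * x * (y * z) ≡ w * y * (x * z)
          lemma = solve-∀

  n<2^n : ∀ n → n < 2 ^ n
  n<2^n zero = s≤s z≤n
  n<2^n (suc n) = ≤-trans (+-mono-≤ (m^n>0 2 n) (n<2^n n)) (≤-reflexive (cong (2 ^ n +_) (sym (+-identityʳ (2 ^ n)))))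

  -- Bernoulli's inequality for 1 + 1/g, multiplied by g ^ (k + 1). Its case `k = g` supplies the
  -- doubling in `exponential-gap`.
  bernoulli : ∀ g k → (g + k) * g ^ k ≤ g * suc g ^ k
  bernoulli g zero = ≤-reflexive (lemma g)
    where lemma : ∀ g → (g + 0) * 1 ≡ g * 1
          lemma = solve-∀
  bernoulli g (suc k) = begin
    (g + suc k) * (g * g ^ k)         ≡⟨ lemma₁ g k (g ^ k) ⟩
    g * ((g + k) * g ^ k) + g * g ^ k ≤⟨ +-monoʳ-≤ _ (*-monoˡ-≤ (g ^ k) (m≤m+n g k)) ⟩
    g * ((g + k) * g ^ k) + (g + k) * g ^ k ≡⟨ lemma₂ g ((g + k) * g ^ k) ⟩
    suc g * ((g + k) * g ^ k)         ≤⟨ *-monoʳ-≤ (suc g) (bernoulli g k) ⟩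
    suc g * (g * suc g ^ k)           ≡⟨ lemma₃ (suc g) g (suc g ^ k) ⟩
    g * (suc g * suc g ^ k)           ∎
    where
    open ≤-Reasoning
    lemma₁ : ∀ g k x → (g + (1 + k)) * (g * x) ≡ g * ((g + k) * x) + g * x
    lemma₁ = solve-∀
    lemma₂ : ∀ g x → g * x + x ≡ (1 + g) * x
    lemma₂ = solve-∀
    lemma₃ : ∀ x y z → x * (y * z) ≡ y * (x * z)
    lemma₃ = solve-∀

  -- (1 + 1/g)^(gHl) ≥ 2^(Hl) > H^l.
  exponential-gap : ∀ g H l x → .{{NonZero g}} → 1 ≤ l → suc g ^ x ≤ H ^ l * g ^ x → x < g * H * l
  exponential-gap g H l x 1≤l h with x <? g * H * l
  ... | yes x< = x<
  ... | no x≮ with m≤n⇒∃[o]m+o≡n (≮⇒≥ x≮)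
  ... | y , refl = ⊥-elim (<⇒≱ overflow h)
    where
    open ≤-Reasoning
    two : 2 * g ^ g ≤ suc g ^ g
    two = *-cancelˡ-≤ g (≤-trans (≤-reflexive (lemma g (g ^ g))) (bernoulli g g))
      where lemma : ∀ g x → g * (2 * x) ≡ (g + g) * x
            lemma = solve-∀
    H<2^H : H ^ l < 2 ^ (H * l)
    H<2^H = subst (H ^ l <_) (^-*-assoc 2 H l) (^-monoˡ-< l {{>-nonZero 1≤l}} (n<2^n H))
    overflow : H ^ l * g ^ (g * H * l + y) < suc g ^ (g * H * l + y)
    overflow = begin-strict
      H ^ l * g ^ (g * H * l + y)             ≡⟨ cong (λ z → H ^ l * z) (^-distribˡ-+-* g (g * H * l) y) ⟩
      H ^ l * (g ^ (g * H * l) * g ^ y)       <⟨ *-monoˡ-< _ {{m*n≢0 _ _ {{m^n≢0 g (g * H * l)}} {{m^n≢0 g y}}}} H<2^H ⟩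
      2 ^ (H * l) * (g ^ (g * H * l) * g ^ y) ≡⟨ sym (*-assoc (2 ^ (H * l)) _ _) ⟩
      2 ^ (H * l) * g ^ (g * H * l) * g ^ y   ≡⟨ cong (λ z → 2 ^ (H * l) * z * g ^ y)
                                                  (trans (cong (g ^_) (*-assoc g H l)) (sym (^-*-assoc g g (H * l)))) ⟩
      2 ^ (H * l) * (g ^ g) ^ (H * l) * g ^ y ≡⟨ cong (_* g ^ y) (sym (^-distribʳ-* 2 (g ^ g) (H * l))) ⟩
      (2 * g ^ g) ^ (H * l) * g ^ y           ≤⟨ *-mono-≤ (^-monoˡ-≤ (H * l) two) (^-monoˡ-≤ y (n≤1+n g)) ⟩
      (suc g ^ g) ^ (H * l) * suc g ^ y       ≡⟨ cong (_* suc g ^ y) (trans (^-*-assoc (suc g) g (H * l)) (cong (suc g ^_) (sym (*-assoc g H l)))) ⟩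
      suc g ^ (g * H * l) * suc g ^ y         ≡⟨ sym (^-distribˡ-+-* (suc g) (g * H * l) y) ⟩
      suc g ^ (g * H * l + y)                 ∎

  -- E n stands for (√g |α|)^(2n), where |α| is the larger absolute value of the characteristic roots.
  record Growth (w L : ℕ → ℕ) : Set where
    field
      E : ℕ → ℕ
      g C : ℕ
      g≢0 : NonZero g
      E-zero : E 0 ≡ 1
      E-super : ∀ m n → E m * E n ≤ E (m + n)
      E-sub : ∀ m n → E (m + n) ≤ 2 * (E m * E n)
      E-grow : ∀ n → suc g * E n ≤ E (suc n)
      lower : ∀ n → E n ≤ C * (g ^ n * (sq (w n) + sq (w (suc n))))
      upper : ∀ k → g ^ k * sq (L k) ≤ C * E k

  -- Size of the kept product against the generalised factorial.

  tri : ℕ → ℕ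
  tri zero = 0
  tri (suc n) = suc n + tri n

  2*tri : ∀ n → 2 * tri n ≡ n * suc n
  2*tri zero = refl
  2*tri (suc n) = trans (lemma n (tri n)) (trans (cong (2 * suc n +_) (2*tri n)) (lemma′ n))
    where lemma : ∀ n t → 2 * (1 + n + t) ≡ 2 * (1 + n) + 2 * t
          lemma = solve-∀
          lemma′ : ∀ n → 2 * (1 + n) + n * (1 + n) ≡ (1 + n) * (2 + n)
          lemma′ = solve-∀

  module Size {w L : ℕ → ℕ} (growth : Growth w L) where
    open Growth growth
    open Factorial L
    instance _ = g≢0

    E-positive : ∀ n → 1 ≤ E n
    E-positive zero = ≤-reflexive (sym E-zero)
    E-positive (suc n) = ≤-trans (E-positive n) (≤-trans (m≤n*m (E n) (suc g)) (E-grow n))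

    E-mono-+ : ∀ n k → E n ≤ E (n + k)
    E-mono-+ n k = ≤-trans (m≤m*n (E n) (E k) {{>-nonZero (E-positive k)}}) (E-super n k)

    E-mono : ∀ {m n} → m ≤ n → E m ≤ E n
    E-mono {m} m≤n with m≤n⇒∃[o]m+o≡n m≤n
    ... | k , refl = E-mono-+ m k

    E-grow-+ : ∀ n x → suc g ^ x * E n ≤ E (n + x)
    E-grow-+ n zero = ≤-reflexive (trans (*-identityˡ (E n)) (cong E (sym (+-identityʳ n))))
    E-grow-+ n (suc x) = begin
      suc g * suc g ^ x * E n   ≡⟨ *-assoc (suc g) (suc g ^ x) (E n) ⟩
      suc g * (suc g ^ x * E n) ≤⟨ *-monoʳ-≤ (suc g) (E-grow-+ n x) ⟩
      suc g * E (n + x)         ≤⟨ E-grow (n + x) ⟩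
      E (suc (n + x))           ≡⟨ cong E (sym (+-suc n x)) ⟩
      E (n + suc x)             ∎
      where open ≤-Reasoning

    -- Full order of magnitude: `E n / g ^ n` stands for |α| ^ (2n), so `w n` is then at least a
    -- constant times |α| ^ n.
    Big : ℕ → ℕ → Set
    Big B n = E n ≤ B * (g ^ n * sq (w n))

    big? : ∀ B n → Dec (Big B n)
    big? B n = E n ≤? B * (g ^ n * sq (w n))

    Big⇒nonZero : ∀ B n → Big B n → NonZero (w n)
    Big⇒nonZero B n h with w n
    ... | suc _ = _
    ... | zero = ⊥-elim (<⇒≱ (E-positive n) (subst (E n ≤_) (lemma B (g ^ n)) h))
      where lemma : ∀ x y → x * (y * 0) ≡ 0
            lemma = solve-∀

    -- Substituting `spread` for `w (n + 1)` in `lower` bounds `E n` by the squares of `w n` and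
    -- `w (n + k)`, and the larger of the two then has full order. In `B` the factor `2 * C′` pays
    -- for replacing both squares by the larger one, and `2 * E K` for moving from `E n` to
    -- `E (n + k)`.
    big-dichotomy : ∀ K A → (∀ n k → 1 ≤ k → k ≤ K → w (suc n) ≤ w (n + k) + A * w n) →
      ∃ λ B → ∀ n k → 1 ≤ k → k ≤ K → Big B n ⊎ Big B (n + k)
    big-dichotomy K A spread = B , dichotomy
      where
      open ≤-Reasoning
      C′ = C * (3 + 2 * sq A)
      B = 2 * E K * (2 * C′)
      instance
        EK≢0 : NonZero (2 * E K)
        EK≢0 = m*n≢0 2 (E K) {{_}} {{>-nonZero (E-positive K)}}
      two-term : ∀ n k → 1 ≤ k → k ≤ K → E n ≤ C′ * (g ^ n * (sq (w n) + sq (w (n + k))))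
      two-term n k 1≤k k≤K = begin
        E n                                        ≤⟨ lower n ⟩
        C * (g ^ n * (x + sq (w (suc n))))         ≤⟨ *-monoʳ-≤ C (*-monoʳ-≤ (g ^ n) (+-monoʳ-≤ x
                                                        (≤-trans (sq-mono (spread n k 1≤k k≤K)) (sq-+-≤ (w (n + k)) (A * w n))))) ⟩
        C * (g ^ n * (x + 2 * (y + sq (A * w n)))) ≤⟨ m≤m+n _ _ ⟩
        C * (g ^ n * (x + 2 * (y + sq (A * w n)))) + C * (g ^ n * (2 * x + y + 2 * (A * A) * y))
          ≡⟨ lemma C (g ^ n) (w n) (w (n + k)) A ⟩
        C′ * (g ^ n * (x + y))                     ∎
        where
        x = sq (w n)
        y = sq (w (n + k))
        lemma : ∀ C G v u A → C * (G * (v * v + 2 * (u * u + (A * v) * (A * v)))) + C * (G * (2 * (v * v) + u * u + 2 * (A * A) * (u * u)))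
          ≡ C * (3 + 2 * (A * A)) * (G * (v * v + u * u))
        lemma = solve-∀
      dichotomy : ∀ n k → 1 ≤ k → k ≤ K → Big B n ⊎ Big B (n + k)
      dichotomy n k 1≤k k≤K with ≤-total (w (n + k)) (w n)
      ... | inj₁ h = inj₁ (begin
        E n                                    ≤⟨ two-term n k 1≤k k≤K ⟩
        C′ * (g ^ n * (sq (w n) + sq (w (n + k)))) ≤⟨ *-monoʳ-≤ C′ (*-monoʳ-≤ (g ^ n) (+-monoʳ-≤ (sq (w n)) (sq-mono h))) ⟩
        C′ * (g ^ n * (sq (w n) + sq (w n)))   ≡⟨ lemma C′ (g ^ n) (sq (w n)) ⟩
        2 * C′ * (g ^ n * sq (w n))            ≤⟨ *-monoˡ-≤ (g ^ n * sq (w n)) (m≤n*m (2 * C′) (2 * E K)) ⟩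
        B * (g ^ n * sq (w n))                 ∎)
        where lemma : ∀ x y z → x * (y * (z + z)) ≡ 2 * x * (y * z)
              lemma = solve-∀
      ... | inj₂ h = inj₂ (begin
        E (n + k)                              ≤⟨ E-sub n k ⟩
        2 * (E n * E k)                        ≤⟨ *-monoʳ-≤ 2 (*-mono-≤ (two-term n k 1≤k k≤K) (E-mono k≤K)) ⟩
        2 * (C′ * (g ^ n * (sq (w n) + y)) * E K) ≤⟨ *-monoʳ-≤ 2 (*-monoˡ-≤ (E K) (*-monoʳ-≤ C′ (*-mono-≤ (^-monoʳ-≤ g (m≤m+n n k)) (+-monoˡ-≤ y (sq-mono h))))) ⟩
        2 * (C′ * (g ^ (n + k) * (y + y)) * E K) ≡⟨ lemma C′ (g ^ (n + k)) y (E K) ⟩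
        B * (g ^ (n + k) * y)                  ∎)
        where
        y = sq (w (n + k))
        lemma : ∀ x y z t → 2 * (x * (y * (z + z)) * t) ≡ 2 * t * (2 * x) * (y * z)
        lemma = solve-∀

    -- Multiplying `upper` over all indices up to `l` makes the exponents add up to `tri l`;
    -- `E-super` merges the values of `E`.
    fact-upper : ∀ l → g ^ tri l * sq (fact l) ≤ C ^ l * E (tri l)
    fact-upper zero = ≤-reflexive (sym (trans (*-identityˡ (E 0)) E-zero))
    fact-upper (suc l) = begin
      g ^ (suc l + tri l) * sq (L (suc l) * fact l)          ≡⟨ cong (_* sq (L (suc l) * fact l)) (^-distribˡ-+-* g (suc l) (tri l)) ⟩
      g ^ suc l * g ^ tri l * sq (L (suc l) * fact l)        ≡⟨ lemma (g ^ suc l) (g ^ tri l) (L (suc l)) (fact l) ⟩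
      g ^ suc l * sq (L (suc l)) * (g ^ tri l * sq (fact l)) ≤⟨ *-mono-≤ (upper (suc l)) (fact-upper l) ⟩
      C * E (suc l) * (C ^ l * E (tri l))                    ≡⟨ lemma₂ C (E (suc l)) (C ^ l) (E (tri l)) ⟩
      C * C ^ l * (E (suc l) * E (tri l))                    ≤⟨ *-monoʳ-≤ (C * C ^ l) (E-super (suc l) (tri l)) ⟩
      C * C ^ l * E (suc l + tri l)                          ∎
      where
      open ≤-Reasoning
      lemma : ∀ a b x y → a * b * ((x * y) * (x * y)) ≡ a * (x * x) * (b * (y * y))
      lemma = solve-∀
      lemma₂ : ∀ a b c d → a * b * (c * d) ≡ a * c * (b * d)
      lemma₂ = solve-∀

    module Kept (keep : ℕ → Bool) where

      kept : ℕ → ℕ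
      kept n = if keep n then w n else 1

      keptSum : ℕ → ℕ → ℕ
      keptSum a l = ∑ a l (λ n → if keep n then n else 0)

      -- Here the values of `E` are merged by `E-sub`, whose factor 2 joins the constant. Using
      -- `suc B` makes that constant positive, so that indices not kept can be charged it as well.
      kept-lower : ∀ B → (∀ n → keep n ≡ true → Big B n) → ∀ a l →
        E (keptSum a l) ≤ (2 * suc B) ^ l * (g ^ keptSum a l * sq (∏ a l kept))
      kept-lower B big a zero = ≤-reflexive E-zero
      kept-lower B big a (suc l) with keep a in eq | kept-lower B big (suc a) l
      ... | true | ih = begin
        E (a + s)                                       ≤⟨ E-sub a s ⟩
        2 * (E a * E s)                                 ≤⟨ *-monoʳ-≤ 2 (*-mono-≤ (≤-trans (big a eq) (*-monoˡ-≤ _ (n≤1+n B))) ih) ⟩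
        2 * (suc B * (g ^ a * sq (w a)) * (b * (g ^ s * sq π))) ≡⟨ lemma (suc B) (g ^ a) (w a) b (g ^ s) π ⟩
        2 * suc B * b * (g ^ a * g ^ s * sq (w a * π))  ≡⟨ cong (λ z → 2 * suc B * b * (z * sq (w a * π))) (sym (^-distribˡ-+-* g a s)) ⟩
        2 * suc B * b * (g ^ (a + s) * sq (w a * π))    ∎
        where
        open ≤-Reasoning
        s = keptSum (suc a) l
        b = (2 * suc B) ^ l
        π = ∏ (suc a) l kept
        lemma : ∀ B G v b H π → 2 * (B * (G * (v * v)) * (b * (H * (π * π)))) ≡ 2 * B * b * (G * H * ((v * π) * (v * π)))
        lemma = solve-∀
      ... | false | ih = ≤-trans ih (*-mono-≤ (m≤n*m ((2 * suc B) ^ l) (2 * suc B))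
                            (*-monoʳ-≤ (g ^ keptSum (suc a) l) (sq-mono (≤-reflexive (sym (*-identityˡ (∏ (suc a) l kept)))))))

      -- If the sum of the kept indices is `tri l + x`, then `kept-lower` against `fact-upper`
      -- leaves (1 + 1/g) ^ x ≤ H ^ l, where `H` collects the bases of all the `l`-th powers;
      -- `exponential-gap` makes `x` linear in `l`.
      keptSum-upper : ∀ B κ a l → 1 ≤ l → (∀ n → keep n ≡ true → Big B n) →
        ∏ a l kept ≤ κ ^ l * fact l →
        keptSum a l < tri l + g * (2 * suc B * sq κ * C) * l
      keptSum-upper B κ a l 1≤l big bound with keptSum a l <? tri l
      ... | yes s< = ≤-trans s< (m≤m+n _ _)
      ... | no s≮ with m≤n⇒∃[o]m+o≡n (≮⇒≥ s≮)
      ... | x , eq = subst (_< tri l + g * H * l) eq (+-monoʳ-< (tri l) (exponential-gap g H l x 1≤l main))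
        where
        open ≤-Reasoning
        H = 2 * suc B * sq κ * C
        t = tri l
        instance
          _ = m^n≢0 g t
          _ = >-nonZero (E-positive t)
        H^l : ∀ l → (2 * suc B) ^ l * sq (κ ^ l) * C ^ l ≡ H ^ l
        H^l l = sym (trans (^-distribʳ-* (2 * suc B * sq κ) C l) (cong (_* C ^ l)
                (trans (^-distribʳ-* (2 * suc B) (sq κ) l) (cong ((2 * suc B) ^ l *_) (^-distribʳ-* κ κ l)))))
        main : suc g ^ x ≤ H ^ l * g ^ x
        main = *-cancelʳ-≤ _ _ (E t) (*-cancelˡ-≤ (g ^ t) (begin
          g ^ t * (suc g ^ x * E t) ≤⟨ *-monoʳ-≤ (g ^ t) (E-grow-+ t x) ⟩
          g ^ t * E (t + x)         ≡⟨ cong (λ z → g ^ t * E z) eq ⟩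
          g ^ t * E s               ≤⟨ *-monoʳ-≤ (g ^ t) (kept-lower B big a l) ⟩
          g ^ t * (b * (g ^ s * sq (∏ a l kept)))  ≤⟨ *-monoʳ-≤ (g ^ t) (*-monoʳ-≤ b (*-monoʳ-≤ (g ^ s) (sq-mono bound))) ⟩
          g ^ t * (b * (g ^ s * sq (κ ^ l * fact l))) ≡⟨ lemma₁ (g ^ t) b (g ^ s) (κ ^ l) (fact l) ⟩
          b * sq (κ ^ l) * (g ^ t * sq (fact l)) * g ^ s ≤⟨ *-monoˡ-≤ (g ^ s) (*-monoʳ-≤ (b * sq (κ ^ l)) (fact-upper l)) ⟩
          b * sq (κ ^ l) * (C ^ l * E t) * g ^ s ≡⟨ cong (λ z → b * sq (κ ^ l) * (C ^ l * E t) * g ^ z) (sym eq) ⟩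
          b * sq (κ ^ l) * (C ^ l * E t) * g ^ (t + x) ≡⟨ cong (λ z → b * sq (κ ^ l) * (C ^ l * E t) * z) (^-distribˡ-+-* g t x) ⟩
          b * sq (κ ^ l) * (C ^ l * E t) * (g ^ t * g ^ x) ≡⟨ lemma₂ b (sq (κ ^ l)) (C ^ l) (E t) (g ^ t) (g ^ x) ⟩
          g ^ t * (b * sq (κ ^ l) * C ^ l * g ^ x * E t) ≡⟨ cong (λ z → g ^ t * (z * g ^ x * E t)) (H^l l) ⟩
          g ^ t * (H ^ l * g ^ x * E t) ∎))
          where
          s = keptSum a l
          b = (2 * suc B) ^ l
          lemma₁ : ∀ G b H k f → G * (b * (H * ((k * f) * (k * f)))) ≡ b * (k * k) * (G * (f * f)) * H
          lemma₁ = solve-∀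
          lemma₂ : ∀ b k c e G x → b * k * (c * e) * (G * x) ≡ G * (b * k * c * x * e)
          lemma₂ = solve-∀

  -- The counting argument from abstract data on `w` and `L`.

  record Arithmetic (w L : ℕ → ℕ) : Set where
    field
      growth : Growth w L
      n₀ κ : ℕ
      κ≢0 : NonZero κ
      L≢0 : ∀ k → NonZero (L (suc k))
      L-additive : ∀ e i j z → e ∣ L i * z → e ∣ L j * z → e ∣ L (i + j) * z
      -- The start `n₀` is there for the primes dividing `S`, whose valuations are under control
      -- only at large indices.
      common : ∀ p → Prime p → ∀ n k j → n₀ ≤ n → 1 ≤ k → p ^ j ∣ w n → p ^ j ∣ w (n + k) → p ^ j ∣ κ * L k
      spread : ∀ K → ∃ λ A → ∀ n k → 1 ≤ k → k ≤ K → w (suc n) ≤ w (n + k) + A * w n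

  -- Squaring m + h and using 2h² + 2l² ≤ (h + l)² + 1 turns the bound of kept-count into this one.
  half-window : ∀ c m h l → l ≤ h → h ≤ suc l →
    m * (2 * suc h) + m * m ≤ m + (l * suc l + 2 * (c * l)) →
    2 * sq (m + h) ≤ sq (h + l) + (1 + 2 * (1 + 2 * c) * l)
  half-window c m h l l≤h h≤1+l hyp = begin
    2 * sq (m + h)                               ≤⟨ m≤m+n _ (2 * m) ⟩
    2 * sq (m + h) + 2 * m                       ≡⟨ lemma₁ m h ⟩
    2 * (m * (2 * suc h) + m * m ∸ m) + 2 * sq h ≤⟨ +-monoˡ-≤ (2 * sq h) (*-monoʳ-≤ 2 (≤-trans (∸-monoˡ-≤ m hyp) (≤-reflexive (m+n∸m≡n m _)))) ⟩
    2 * (l * suc l + 2 * (c * l)) + 2 * sq h     ≡⟨ lemma₂ c h l ⟩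
    2 * sq h + 2 * sq l + 2 * (1 + 2 * c) * l    ≤⟨ +-monoˡ-≤ _ (balanced h l l≤h h≤1+l) ⟩
    sq (h + l) + 1 + 2 * (1 + 2 * c) * l         ≡⟨ +-assoc (sq (h + l)) 1 _ ⟩
    sq (h + l) + (1 + 2 * (1 + 2 * c) * l)       ∎
    where
    open ≤-Reasoning
    lemma₀ : ∀ m h → m * (2 * (1 + h)) + m * m ≡ m + (m * (2 * h) + m * m + m)
    lemma₀ = solve-∀
    lemma₁′ : ∀ m h → 2 * ((m + h) * (m + h)) + 2 * m ≡ 2 * (m * (2 * h) + m * m + m) + 2 * (h * h)
    lemma₁′ = solve-∀
    lemma₁ : ∀ m h → 2 * sq (m + h) + 2 * m ≡ 2 * (m * (2 * suc h) + m * m ∸ m) + 2 * sq h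
    lemma₁ m h = trans (lemma₁′ m h) (cong (λ z → 2 * z + 2 * sq h) (sym (trans (cong (_∸ m) (lemma₀ m h)) (m+n∸m≡n m _))))
    lemma₂ : ∀ c h l → 2 * (l * (1 + l) + 2 * (c * l)) + 2 * (h * h) ≡ 2 * (h * h) + 2 * (l * l) + 2 * (1 + 2 * c) * l
    lemma₂ = solve-∀
    balanced : ∀ h l → l ≤ h → h ≤ suc l → 2 * sq h + 2 * sq l ≤ sq (h + l) + 1
    balanced h l l≤h h≤1+l with m≤n⇒m<n∨m≡n l≤h
    ... | inj₂ refl = ≤-trans (≤-reflexive (eq h)) (m≤m+n _ 1)
      where eq : ∀ h → 2 * (h * h) + 2 * (h * h) ≡ (h + h) * (h + h)
            eq = solve-∀
    ... | inj₁ l<h with ≤-antisym h≤1+l l<h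
    ... | refl = ≤-reflexive (eq l)
      where eq : ∀ l → 2 * ((1 + l) * (1 + l)) + 2 * (l * l) ≡ (1 + l + l) * (1 + l + l) + 1
            eq = solve-∀

  -- The first summand keeps `e * (1 + t)` below N/4; the second keeps the linear error of the
  -- squared bound, scaled by 16e², below N².
  threshold : ℕ → ℕ → ℕ → ℕ
  threshold e c t = 4 * (e * (1 + t)) + 32 * (e * e) * (1 + c)

  final-inequality : ∀ e c t N y ω l → 1 ≤ e → threshold e c t < N → 2 * l ≤ N →
    e * N ≤ e * y + ((l + e) + e * (ω + t)) →
    2 * sq y ≤ sq N + (1 + 2 * (1 + 2 * c) * l) →
    2 * sq (e * N ∸ (N + e * ω)) < sq (e * N)
  final-inequality e c t N y ω l 1≤e large 2l≤N H₁ H₂ with e * N ≤? N + e * ω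
  ... | yes h rewrite m≤n⇒m∸n≡0 h = *-mono-< pos pos
    where pos : 0 < e * N
          pos = *-mono-≤ 1≤e (≤-trans (s≤s z≤n) large)
  ... | no h with m≤n⇒∃[o]m+o≡n (<⇒≤ (≰⇒> h))
  ... | z , eq = subst (λ x → 2 * sq x < sq (e * N)) (sym (trans (cong (_∸ (N + e * ω)) (sym eq)) (m+n∸m≡n (N + e * ω) z)))
                   (*-cancelˡ-< 16 (2 * sq z) (sq (e * N)) (+-cancelʳ-< (2 * sq N) _ _ main))
    where
    open ≤-Reasoning
    step₁ : N + z ≤ e * y + (l + e * (1 + t))
    step₁ = +-cancelʳ-≤ (e * ω) _ _ (begin
      N + z + e * ω                      ≡⟨ lemma₁ N z (e * ω) ⟩
      N + e * ω + z                      ≡⟨ eq ⟩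
      e * N                              ≤⟨ H₁ ⟩
      e * y + ((l + e) + e * (ω + t))    ≡⟨ lemma₂ e y l ω t ⟩
      e * y + (l + e * (1 + t)) + e * ω  ∎)
      where
      lemma₁ : ∀ a b c → a + b + c ≡ a + c + b
      lemma₁ = solve-∀
      lemma₂ : ∀ e y l w t → e * y + ((l + e) + e * (w + t)) ≡ e * y + (l + e * (1 + t)) + e * w
      lemma₂ = solve-∀
    step₂ : 4 * z + N ≤ 4 * (e * y)
    step₂ = +-cancelˡ-≤ (3 * N) _ _ (begin
      3 * N + (4 * z + N)                         ≡⟨ lemma₁ N z ⟩
      4 * (N + z)                                 ≤⟨ *-monoʳ-≤ 4 step₁ ⟩
      4 * (e * y + (l + e * (1 + t)))             ≡⟨ lemma₂ (e * y) l (e * (1 + t)) ⟩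
      2 * (2 * l) + 4 * (e * (1 + t)) + 4 * (e * y) ≤⟨ +-monoˡ-≤ (4 * (e * y)) (+-mono-≤ (*-monoʳ-≤ 2 2l≤N) (≤-trans (m≤m+n _ _) (<⇒≤ large))) ⟩
      2 * N + N + 4 * (e * y)                     ≡⟨ cong (_+ 4 * (e * y)) (lemma₃ N) ⟩
      3 * N + 4 * (e * y)                         ∎)
      where
      lemma₁ : ∀ N z → 3 * N + (4 * z + N) ≡ 4 * (N + z)
      lemma₁ = solve-∀
      lemma₂ : ∀ a l b → 4 * (a + (l + b)) ≡ 2 * (2 * l) + 4 * b + 4 * a
      lemma₂ = solve-∀
      lemma₃ : ∀ N → 2 * N + N ≡ 3 * N
      lemma₃ = solve-∀
    step₃ : 16 * (e * e) * (1 + 2 * (1 + 2 * c) * l) < 2 * sq N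
    step₃ = begin-strict
      16 * (e * e) * (1 + 2 * (1 + 2 * c) * l)      ≡⟨ cong (16 * (e * e) *_) (lemma₀ c l) ⟩
      16 * (e * e) * (1 + (1 + 2 * c) * (2 * l))    ≤⟨ *-monoʳ-≤ (16 * (e * e)) (+-mono-≤ {1} {N} (≤-trans (s≤s z≤n) large) (*-monoʳ-≤ (1 + 2 * c) 2l≤N)) ⟩
      16 * (e * e) * (N + (1 + 2 * c) * N)          ≡⟨ lemma e c N ⟩
      32 * (e * e) * (1 + c) * N                    <⟨ *-monoˡ-< N {{>-nonZero (≤-trans (s≤s z≤n) large)}} (≤-<-trans (m≤n+m _ (4 * (e * (1 + t)))) large) ⟩
      N * N                                         ≤⟨ m≤m+n _ _ ⟩
      2 * sq N                                      ∎
      where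
      lemma₀ : ∀ c l → 1 + 2 * (1 + 2 * c) * l ≡ 1 + (1 + 2 * c) * (2 * l)
      lemma₀ = solve-∀
      lemma : ∀ e c N → 16 * (e * e) * (N + (1 + 2 * c) * N) ≡ 32 * (e * e) * (1 + c) * N
      lemma = solve-∀
    main : 16 * (2 * sq z) + 2 * sq N < 16 * sq (e * N) + 2 * sq N
    main = begin-strict
      16 * (2 * sq z) + 2 * sq N                    ≤⟨ m≤m+n _ (16 * (z * N)) ⟩
      16 * (2 * sq z) + 2 * sq N + 16 * (z * N)     ≡⟨ lemma₁ z N ⟩
      2 * sq (4 * z + N)                            ≤⟨ *-monoʳ-≤ 2 (*-mono-≤ step₂ step₂) ⟩
      2 * sq (4 * (e * y))                          ≡⟨ lemma₂ e y ⟩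
      16 * (e * e) * (2 * sq y)                     ≤⟨ *-monoʳ-≤ (16 * (e * e)) H₂ ⟩
      16 * (e * e) * (sq N + (1 + 2 * (1 + 2 * c) * l)) ≡⟨ *-distribˡ-+ (16 * (e * e)) (sq N) _ ⟩
      16 * (e * e) * sq N + 16 * (e * e) * (1 + 2 * (1 + 2 * c) * l) <⟨ +-monoʳ-< _ step₃ ⟩
      16 * (e * e) * sq N + 2 * sq N                ≡⟨ cong (_+ 2 * sq N) (lemma₃ e N) ⟩
      16 * sq (e * N) + 2 * sq N                    ∎
      where
      lemma₁ : ∀ z N → 16 * (2 * (z * z)) + 2 * (N * N) + 16 * (z * N) ≡ 2 * ((4 * z + N) * (4 * z + N))
      lemma₁ = solve-∀
      lemma₂ : ∀ e y → 2 * ((4 * (e * y)) * (4 * (e * y))) ≡ 16 * (e * e) * (2 * (y * y))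
      lemma₂ = solve-∀
      lemma₃ : ∀ e N → 16 * (e * e) * (N * N) ≡ 16 * ((e * N) * (e * N))
      lemma₃ = solve-∀

  halves : ∀ N → ∃ λ l → ∃ λ h → h + l ≡ N × l ≤ h × h ≤ suc l
  halves zero = 0 , 0 , refl , z≤n , z≤n
  halves (suc N) with halves N
  ... | l , h , eq , l≤h , h≤1+l with m≤n⇒m<n∨m≡n l≤h
  ... | inj₁ l<h = suc l , h , trans (+-suc h l) (cong suc eq) , l<h , ≤-trans h≤1+l (n≤1+n _)
  ... | inj₂ refl = l , suc h , cong suc eq , n≤1+n h , ≤-refl

  -- Removing peaks and small terms from a window.

  module Window {w L : ℕ → ℕ} (arith : Arithmetic w L) where
    open Arithmetic arith
    open Factorial L
    open Size growth
    open Growth growth using (g; C)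

    common-sym : ∀ a → n₀ ≤ a → ∀ p → Prime p → ∀ n m j → a ≤ n → a ≤ m → n ≢ m →
      p ^ j ∣ w n → p ^ j ∣ w m → p ^ j ∣ κ * L (∣ n - m ∣)
    common-sym a n₀≤a p pr n m j a≤n a≤m n≢m x y with <-cmp n m
    ... | tri≈ _ n≡m _ = ⊥-elim (n≢m n≡m)
    ... | tri< n<m _ _ with m≤n⇒∃[o]m+o≡n (<⇒≤ n<m)
    ... | zero , eq = ⊥-elim (n≢m (trans (sym (+-identityʳ n)) eq))
    ... | suc k , refl = subst (λ z → p ^ j ∣ κ * L z) (sym (∣m-m+n∣≡n n (suc k)))
            (common p pr n (suc k) j (≤-trans n₀≤a a≤n) (s≤s z≤n) x y)
    common-sym a n₀≤a p pr n m j a≤n a≤m n≢m x y | tri> _ _ m<n with m≤n⇒∃[o]m+o≡n (<⇒≤ m<n)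
    ... | zero , eq = ⊥-elim (n≢m (trans (sym eq) (+-identityʳ m)))
    ... | suc k , refl = subst (λ z → p ^ j ∣ κ * L z) (sym (trans (∣-∣-comm (m + suc k) m) (∣m-m+n∣≡n m (suc k))))
            (common p pr m (suc k) j (≤-trans n₀≤a a≤m) (s≤s z≤n) y x)

    fact≢0 : ∀ l → NonZero (fact l)
    fact≢0 zero = _
    fact≢0 (suc l) = m*n≢0 _ _ {{L≢0 l}} {{fact≢0 l}}

    module Removal (B a l : ℕ) (ps : List ℕ)
      (covers : ∀ n p → InRange a (suc l) n → Prime p → p ∣ w n → NonZero (w n) → p ∈ ps) where

      peak : ℕ → ℕ
      peak p with prime? p
      ... | yes pr = proj₁ (maximal-index pr w a l)
      -- The list `ps` may contain numbers that are not prime; each of them is charged an arbitrary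
      -- index.
      ... | no _ = a

      peak-maximal : ∀ p → Prime p → InRange a (suc l) (peak p) × (∀ n → InRange a (suc l) n → w n ≼[ p ] w (peak p))
      peak-maximal p pr with prime? p
      ... | yes pr′ = proj₂ (maximal-index pr′ w a l)
      ... | no ¬pr = ⊥-elim (¬pr pr)

      peaks : List ℕ
      peaks = map peak ps

      big : ℕ → Bool
      big n = does (big? B n)

      isPeak : ℕ → Bool
      isPeak n = does (n ∈? peaks)

      keep : ℕ → Bool
      keep n = big n ∧ not (isPeak n)

      big⇒Big : ∀ n → big n ≡ true → Big B n
      big⇒Big n eq = ≤ᵇ⇒≤ _ _ (subst T (sym eq) _)

      keep⇒big : ∀ n → keep n ≡ true → big n ≡ true
      keep⇒big n eq with big n
      ... | true = refl

      keep⇒Big : ∀ n → keep n ≡ true → Big B n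
      keep⇒Big n eq = big⇒Big n (keep⇒big n eq)

      peak-removed : ∀ {p} → p ∈ ps → keep (peak p) ≡ false
      peak-removed {p} p∈ rewrite dec-true (peak p ∈? peaks) (∈-map⁺ peak p∈) with big (peak p)
      ... | true = refl
      ... | false = refl

      open Kept keep

      product-bound : n₀ ≤ a → ∏ a (suc l) kept ≤ κ ^ suc l * fact (suc l)
      product-bound n₀≤a = ∣⇒≤ {{m*n≢0 _ _ {{m^n≢0 κ (suc l) {{κ≢0}}}} {{fact≢0 (suc l)}}}}
        (kept-product-∣ (fact-*-∣ L-additive) w keep κ a (suc l)
          (λ n eq → Big⇒nonZero B n (keep⇒Big n eq))
          (λ p pr n m j n∈ m∈ → common-sym a n₀≤a p pr n m j (proj₁ n∈) (proj₁ m∈))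
          removed)
        where
        removed : ∀ p → Prime p → (∀ n → InRange a (suc l) n → keep n ≡ true → ¬ p ∣ w n) ⊎
          (∃ λ c → InRange a (suc l) c × keep c ≡ false × (∀ n → InRange a (suc l) n → keep n ≡ true → w n ≼[ p ] w c))
        removed p pr with p ∈? ps
        ... | yes p∈ = inj₂ (peak p , proj₁ (peak-maximal p pr) , peak-removed p∈ , λ n n∈ _ → proj₂ (peak-maximal p pr) n n∈)
        ... | no p∉ = inj₁ λ n n∈ eq p∣wn → p∉ (covers n p n∈ pr p∣wn (Big⇒nonZero B n (keep⇒Big n eq)))

    -- An index is lost if its term is not of full order, which happens about once in `K` indices,
    -- or if it is one of at most `length ps` peaks. The second bound compares the least possible
    -- sum of `m` indices with `keptSum-upper`. The constant `c` is fixed before the window and the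
    -- primes.
    kept-count : ∀ K → ∃ λ c → ∀ a l ps → n₀ ≤ a →
      (∀ n p → InRange a (suc l) n → Prime p → p ∣ w n → NonZero (w n) → p ∈ ps) →
      ∃ λ m → K * suc l ≤ K * m + ((suc l + K) + K * length ps) ×
              m * (2 * a) + m * m ≤ m + (suc l * suc (suc l) + 2 * (c * suc l))
    kept-count K with spread K
    ... | A , spreadK with big-dichotomy K A spreadK
    ... | B , dichotomy = g * (2 * suc B * sq κ * C) , λ a l ps n₀≤a covers →
      let open Removal B a l ps covers
          open Kept keep
          open ≤-Reasoning
          m = count a (suc l) keep
          c = g * (2 * suc B * sq κ * C)
          sparse : ∀ n k → 1 ≤ k → k ≤ K → not (big n) ≡ true → not (big (n + k)) ≡ false
          sparse n k 1≤k k≤K eq = case-dichotomy n k eq (dichotomy n k 1≤k k≤K)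
      in m ,
        (begin
          K * suc l ≤⟨ *-monoʳ-≤ K (count-split big isPeak a (suc l)) ⟩
          K * (m + (count a (suc l) (λ n → not (big n)) + count a (suc l) isPeak))
            ≡⟨ distrib K m _ _ ⟩
          K * m + (K * count a (suc l) (λ n → not (big n)) + K * count a (suc l) isPeak)
            ≤⟨ +-monoʳ-≤ (K * m) (+-mono-≤ (count-sparse K _ sparse a (suc l))
                 (*-monoʳ-≤ K (≤-trans (count-∈ peaks a (suc l)) (≤-reflexive (length-map peak ps))))) ⟩
          K * m + ((suc l + K) + K * length ps) ∎) ,
        (begin
          m * (2 * a) + m * m ≤⟨ sum-kept-≥ keep a (suc l) ⟩
          m + 2 * keptSum a (suc l)
            ≤⟨ +-monoʳ-≤ m (*-monoʳ-≤ 2 (<⇒≤ (keptSum-upper B κ a (suc l) (s≤s z≤n) keep⇒Big (product-bound n₀≤a)))) ⟩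
          m + 2 * (tri (suc l) + c * suc l) ≡⟨ cong (m +_) (trans (*-distribˡ-+ 2 (tri (suc l)) (c * suc l)) (cong (_+ 2 * (c * suc l)) (2*tri (suc l)))) ⟩
          m + (suc l * suc (suc l) + 2 * (c * suc l)) ∎)
      where
      distrib : ∀ k x y z → k * (x + (y + z)) ≡ k * x + (k * y + k * z)
      distrib = solve-∀
      case-dichotomy : ∀ n k → not (does (big? B n)) ≡ true → Big B n ⊎ Big B (n + k) → not (does (big? B (n + k))) ≡ false
      case-dichotomy n k eq (inj₁ h) rewrite dec-true (big? B n) h with () ← eq
      case-dichotomy n k eq (inj₂ h) rewrite dec-true (big? B (n + k)) h = refl

    -- The window starts at `h + 1`, beyond N/2 and hence beyond `n₀`. The `h` indices before it are
    -- not examined: they are added to the `m` kept ones, so that `y = m + h`.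
    by-halves : ∀ e c t N ω ps → 1 ≤ e → 2 * n₀ + threshold e c t < N → length ps ≡ ω + t →
      (∀ a l → n₀ ≤ a →
        (∀ n p → InRange a (suc l) n → Prime p → p ∣ w n → NonZero (w n) → p ∈ ps) →
        ∃ λ m → e * suc l ≤ e * m + ((suc l + e) + e * length ps) ×
                m * (2 * a) + m * m ≤ m + (suc l * suc (suc l) + 2 * (c * suc l))) →
      (∀ n p → 1 ≤ n → n ≤ N → Prime p → p ∣ w n → NonZero (w n) → p ∈ ps) →
      ∀ l h → h + suc l ≡ N → suc l ≤ h → h ≤ suc (suc l) →
      2 * sq (e * N ∸ (N + e * ω)) < sq (e * N)
    by-halves e c t N ω ps 1≤e C<N len H covers l h refl l≤h h≤1+l =
      final-inequality e c t N (m + h) ω (suc l) 1≤e (≤-<-trans (m≤n+m _ (2 * n₀)) C<N) 2l≤N first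
        (half-window c m h (suc l) l≤h h≤1+l (proj₂ (proj₂ kept)))
      where
      open ≤-Reasoning
      n₀≤ : n₀ ≤ suc h
      n₀≤ = m≤n⇒m≤1+n (*-cancelˡ-≤ 2 (begin
        2 * n₀                        ≤⟨ m≤m+n _ _ ⟩
        2 * n₀ + threshold e c t      ≤⟨ <⇒≤ C<N ⟩
        h + suc l                     ≤⟨ +-monoʳ-≤ h l≤h ⟩
        h + h                         ≡⟨ cong (h +_) (sym (+-identityʳ h)) ⟩
        2 * h                         ∎))
      kept : ∃ λ m → e * suc l ≤ e * m + ((suc l + e) + e * length ps) ×
                     m * (2 * suc h) + m * m ≤ m + (suc l * suc (suc l) + 2 * (c * suc l))
      kept = H (suc h) l n₀≤ (λ n p n∈ → covers n p (≤-trans (s≤s z≤n) (proj₁ n∈)) (≤-pred (proj₂ n∈)))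
      m : ℕ
      m = proj₁ kept
      2l≤N : 2 * suc l ≤ h + suc l
      2l≤N = ≤-trans (≤-reflexive (cong (suc l +_) (+-identityʳ (suc l)))) (+-monoˡ-≤ (suc l) l≤h)
      first : e * (h + suc l) ≤ e * (m + h) + ((suc l + e) + e * (ω + t))
      first = begin
        e * (h + suc l)         ≡⟨ *-distribˡ-+ e h (suc l) ⟩
        e * h + e * suc l       ≤⟨ +-monoʳ-≤ (e * h) (proj₁ (proj₂ kept)) ⟩
        e * h + (e * m + ((suc l + e) + e * length ps))
          ≡⟨ cong (λ z → e * h + (e * m + ((suc l + e) + e * z))) len ⟩
        e * h + (e * m + ((suc l + e) + e * (ω + t)))
          ≡⟨ lemma e h m ((suc l + e) + e * (ω + t)) ⟩
        e * (m + h) + ((suc l + e) + e * (ω + t)) ∎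
        where
        lemma : ∀ e h m t → e * h + (e * m + t) ≡ e * (m + h) + t
        lemma = solve-∀

    bound : ∀ e t → 1 ≤ e → ∃ λ C → 0 < C × (∀ N ω ps → C < N → length ps ≡ ω + t →
      (∀ n p → 1 ≤ n → n ≤ N → Prime p → p ∣ w n → NonZero (w n) → p ∈ ps) →
      2 * sq (e * N ∸ (N + e * ω)) < sq (e * N))
    bound e t 1≤e = suc C₀ , s≤s z≤n , λ N ω ps C<N len covers → split N ω ps C<N len covers (halves N)
      where
      c = proj₁ (kept-count e)
      C₀ = 2 * n₀ + threshold e c t
      split : ∀ N ω ps → suc C₀ < N → length ps ≡ ω + t →
        (∀ n p → 1 ≤ n → n ≤ N → Prime p → p ∣ w n → NonZero (w n) → p ∈ ps) →
        (∃ λ l → ∃ λ h → h + l ≡ N × l ≤ h × h ≤ suc l) → 2 * sq (e * N ∸ (N + e * ω)) < sq (e * N)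
      -- An empty window forces `N ≤ 1`, which is why the constant is `suc C₀` and not `C₀`.
      split N ω ps C<N len covers (zero , h , eq , _ , h≤1) =
        ⊥-elim (<⇒≱ C<N (≤-trans (≤-reflexive (trans (sym eq) (+-identityʳ h))) (≤-trans h≤1 (s≤s z≤n))))
      split N ω ps C<N len covers (suc l , h , eq , l≤h , h≤1+l) =
        by-halves e c t N ω ps 1≤e (<-trans (n<1+n C₀) C<N) len (λ a l → proj₂ (kept-count e) a l ps) covers l h eq l≤h h≤1+l

-- Passage from natural numbers to the rational form of the bound.

module Rationals where

  open import Data.Nat as ℕ using (ℕ; zero; suc)
  import Data.Nat.Properties as ℕ
  open import Data.Integer as ℤ using (ℤ; +_; -[1+_])
  import Data.Integer.Properties as ℤ
  import Data.Integer.Tactic.RingSolver as ℤ-Solver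
  open import Data.Rational
  open import Data.Rational.Properties
  open import Data.Rational.Solver using (module +-*-Solver)
  open import Data.Rational.Unnormalised as ℚᵘ using (mkℚᵘ; *≡*; *<*)
  import Data.Rational.Unnormalised.Properties as ℚᵘ
  open import Data.Sum using (inj₁; inj₂)
  open import Relation.Binary.PropositionalEquality
  open Naturals using (sq)

  ι : ℤ → ℚ
  ι i = i / 1

  toℚᵘ-ι : ∀ i → toℚᵘ (ι i) ℚᵘ.≃ mkℚᵘ i 0
  toℚᵘ-ι i = toℚᵘ-fromℚᵘ (mkℚᵘ i 0)

  ι-+ : ∀ i j → ι (i ℤ.+ j) ≡ ι i + ι j
  ι-+ i j = toℚᵘ-injective (ℚᵘ.≃-trans (toℚᵘ-ι (i ℤ.+ j)) (ℚᵘ.≃-trans (*≡* (lemma i j))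
      (ℚᵘ.≃-sym (ℚᵘ.≃-trans (toℚᵘ-homo-+ (ι i) (ι j)) (ℚᵘ.+-cong (toℚᵘ-ι i) (toℚᵘ-ι j))))))
    where lemma : ∀ i j → (i ℤ.+ j) ℤ.* + 1 ≡ (i ℤ.* + 1 ℤ.+ j ℤ.* + 1) ℤ.* + 1
          lemma = ℤ-Solver.solve-∀

  ι-* : ∀ i j → ι (i ℤ.* j) ≡ ι i * ι j
  ι-* i j = toℚᵘ-injective (ℚᵘ.≃-trans (toℚᵘ-ι (i ℤ.* j))
      (ℚᵘ.≃-sym (ℚᵘ.≃-trans (toℚᵘ-homo-* (ι i) (ι j)) (ℚᵘ.*-cong (toℚᵘ-ι i) (toℚᵘ-ι j)))))

  ι-neg : ∀ i → ι (ℤ.- i) ≡ - ι i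
  ι-neg i = toℚᵘ-injective (ℚᵘ.≃-trans (toℚᵘ-ι (ℤ.- i))
      (ℚᵘ.≃-sym (ℚᵘ.≃-trans (toℚᵘ-homo‿- (ι i)) (ℚᵘ.-‿cong (toℚᵘ-ι i)))))

  ι-- : ∀ i j → ι (i ℤ.- j) ≡ ι i - ι j
  ι-- i j = trans (ι-+ i (ℤ.- j)) (cong (λ z → ι i + z) (ι-neg j))

  ι-mono-< : ∀ {i j} → i ℤ.< j → ι i < ι j
  ι-mono-< {i} {j} i<j = toℚᵘ-cancel-< (ℚᵘ.<-respˡ-≃ (ℚᵘ.≃-sym (toℚᵘ-ι i)) (ℚᵘ.<-respʳ-≃ (ℚᵘ.≃-sym (toℚᵘ-ι j))
    (*<* (subst₂ ℤ._<_ (sym (ℤ.*-identityʳ i)) (sym (ℤ.*-identityʳ j)) i<j))))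

  ε*denominator : ∀ ε → ε * ι (↧ ε) ≡ ι (↥ ε)
  ε*denominator ε@(mkℚ n d-1 _) = toℚᵘ-injective (ℚᵘ.≃-trans (toℚᵘ-homo-* ε (ι (+ suc d-1)))
    (ℚᵘ.≃-trans (ℚᵘ.*-cong (ℚᵘ.≃-refl {toℚᵘ ε}) (toℚᵘ-ι (+ suc d-1)))
    (ℚᵘ.≃-trans (*≡* (trans (ℤ.*-identityʳ _) (cong (λ k → n ℤ.* + k) (sym (ℕ.*-identityʳ (suc d-1)))))) (ℚᵘ.≃-sym (toℚᵘ-ι n)))))

  -- Multiplying `x` by the denominator `e` of ε gives the integer `num`. If it is negative, the
  -- first alternative holds. Otherwise it is a natural number `a`, at most the truncated difference
  -- because the numerator of ε is at least 1, and the factor e² is cancelled from the squared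
  -- inequality.
  exceedsBound : ∀ ε → 0ℚ < ε → ∀ N w →
    2 ℕ.* sq (↧ₙ ε ℕ.* N ℕ.∸ (N ℕ.+ ↧ₙ ε ℕ.* w)) ℕ.< sq (↧ₙ ε ℕ.* N) → ExceedsBound ε N w
  exceedsBound ε@(mkℚ (+ suc n) d-1 _) 0<ε N w h = cases num refl
    where
    e = suc d-1
    e′ = ι (+ e)
    x = (1ℚ - ε) * ι (+ N) - ι (+ w)
    num = (+ e ℤ.- + suc n) ℤ.* + N ℤ.- + e ℤ.* + w
    instance
      _ : Positive e′
      _ = positive (ι-mono-< {+ 0} {+ e} (ℤ.+<+ (ℕ.s≤s ℕ.z≤n)))
      _ : NonNegative e′
      _ = pos⇒nonNeg e′
    e′*x : e′ * x ≡ ι num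
    e′*x = begin
      e′ * x                                                   ≡⟨ expand e′ ε (ι (+ N)) (ι (+ w)) ⟩
      (e′ - ε * e′) * ι (+ N) - e′ * ι (+ w)                   ≡⟨ cong (λ z → (e′ - z) * ι (+ N) - e′ * ι (+ w)) (ε*denominator ε) ⟩
      (e′ - ι (+ suc n)) * ι (+ N) - e′ * ι (+ w)              ≡⟨ cong (λ z → z * ι (+ N) - e′ * ι (+ w)) (sym (ι-- (+ e) (+ suc n))) ⟩
      ι (+ e ℤ.- + suc n) * ι (+ N) - e′ * ι (+ w)             ≡⟨ cong₂ _-_ (sym (ι-* (+ e ℤ.- + suc n) (+ N))) (sym (ι-* (+ e) (+ w))) ⟩
      ι ((+ e ℤ.- + suc n) ℤ.* + N) - ι (+ e ℤ.* + w)          ≡⟨ sym (ι-- ((+ e ℤ.- + suc n) ℤ.* + N) (+ e ℤ.* + w)) ⟩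
      ι num                                                    ∎
      where
      open ≡-Reasoning
      open +-*-Solver
      expand : ∀ e ε N w → e * ((1ℚ - ε) * N - w) ≡ (e - ε * e) * N - e * w
      expand = solve 4 (λ e ε N w → e :* ((con 1ℚ :- ε) :* N :- w) := (e :- ε :* e) :* N :- e :* w) refl
    cases : ∀ i → num ≡ i → ExceedsBound ε N w
    cases -[1+ k ] eq = inj₁ (*-cancelˡ-<-nonNeg e′ (subst₂ _<_ (sym (trans e′*x (cong ι eq))) (sym (*-zeroʳ e′)) (ι-mono-< { -[1+ k ]} {+ 0} ℤ.-<+)))
    cases (+ a) eq = inj₂ (*-cancelˡ-<-nonNeg e′ (*-cancelˡ-<-nonNeg e′ (subst₂ _<_ lhs rhs (ι-mono-< (ℤ.+<+ bound)))))
      where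
      open +-*-Solver
      total : a ℕ.+ suc n ℕ.* N ℕ.+ e ℕ.* w ≡ e ℕ.* N
      total = ℤ.+-injective (begin
        + (a ℕ.+ suc n ℕ.* N ℕ.+ e ℕ.* w)             ≡⟨ ℤ.pos-+ (a ℕ.+ suc n ℕ.* N) (e ℕ.* w) ⟩
        + (a ℕ.+ suc n ℕ.* N) ℤ.+ + (e ℕ.* w)         ≡⟨ cong₂ ℤ._+_ (trans (ℤ.pos-+ a (suc n ℕ.* N)) (cong₂ ℤ._+_ (sym eq) (ℤ.pos-* (suc n) N))) (ℤ.pos-* e w) ⟩
        num ℤ.+ + suc n ℤ.* + N ℤ.+ + e ℤ.* + w       ≡⟨ lemma (+ e) (+ suc n) (+ N) (+ w) ⟩
        + e ℤ.* + N                                   ≡⟨ sym (ℤ.pos-* e N) ⟩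
        + (e ℕ.* N)                                   ∎)
        where
        open ≡-Reasoning
        lemma : ∀ e n N w → (e ℤ.- n) ℤ.* N ℤ.- e ℤ.* w ℤ.+ n ℤ.* N ℤ.+ e ℤ.* w ≡ e ℤ.* N
        lemma = ℤ-Solver.solve-∀
      a≤ : a ℕ.≤ e ℕ.* N ℕ.∸ (N ℕ.+ e ℕ.* w)
      a≤ = ℕ.m+n≤o⇒m≤o∸n a (ℕ.≤-trans (ℕ.≤-reflexive (sym (ℕ.+-assoc a N (e ℕ.* w))))
        (ℕ.≤-trans (ℕ.+-monoˡ-≤ (e ℕ.* w) (ℕ.+-monoʳ-≤ a (ℕ.m≤m+n N (n ℕ.* N)))) (ℕ.≤-reflexive total)))
      bound : 2 ℕ.* a ℕ.* a ℕ.< sq (e ℕ.* N)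
      bound = ℕ.≤-<-trans (ℕ.≤-trans (ℕ.≤-reflexive (ℕ.*-assoc 2 a a)) (ℕ.*-monoʳ-≤ 2 (ℕ.*-mono-≤ a≤ a≤))) h
      ιa : ι (+ a) ≡ e′ * x
      ιa = sym (trans e′*x (cong ι eq))
      lhs : ι (+ (2 ℕ.* a ℕ.* a)) ≡ e′ * (e′ * (ι (+ 2) * x * x))
      lhs = trans (cong ι (trans (ℤ.pos-* (2 ℕ.* a) a) (cong (ℤ._* + a) (ℤ.pos-* 2 a))))
        (trans (trans (ι-* (+ 2 ℤ.* + a) (+ a)) (cong (_* ι (+ a)) (ι-* (+ 2) (+ a))))
        (trans (cong (λ z → ι (+ 2) * z * z) ιa)
          (solve 3 (λ t e x → t :* (e :* x) :* (e :* x) := e :* (e :* (t :* x :* x))) refl (ι (+ 2)) e′ x)))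
      rhs : ι (+ sq (e ℕ.* N)) ≡ e′ * (e′ * (ι (+ N) * ι (+ N)))
      rhs = trans (cong ι (trans (ℤ.pos-* (e ℕ.* N) (e ℕ.* N)) (cong (λ z → z ℤ.* z) (ℤ.pos-* e N))))
        (trans (trans (ι-* (+ e ℤ.* + N) (+ e ℤ.* + N)) (cong (λ z → z * z) (ι-* (+ e) (+ N))))
          (solve 2 (λ e n → (e :* n) :* (e :* n) := e :* (e :* (n :* n))) refl e′ (ι (+ N))))
  exceedsBound (mkℚ (+ zero) _ _) (*<* (ℤ.+<+ ()))
  exceedsBound (mkℚ -[1+ _ ] _ _) (*<* ())

module Integers where

  open import Data.Nat as ℕ using (ℕ; zero; suc)
  import Data.Nat.Properties as ℕ
  import Data.Nat.Divisibility as ℕ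
  open import Data.Nat.Coprimality using (Coprime)
  open import Data.Nat.GCD using (gcd; gcd[m,n]∣m; gcd[m,n]∣n; gcd-greatest; gcd[m,n]≡0⇒n≡0)
  open import Data.Nat.Primality using (Prime; euclidsLemma; prime?; prime⇒nonTrivial)
  import Data.Nat.Tactic.RingSolver as ℕ-Solver
  open import Data.Integer hiding (suc) renaming (∣_∣ to abs)
  open import Data.Integer.Properties using (*-identityˡ; *-identityʳ; *-zeroʳ; *-comm; *-assoc; +-injective; pos-+; pos-*; abs-*; ∣-i∣≡∣i∣; ∣i∣≡0⇒i≡0; ∣i+j∣≤∣i∣+∣j∣; ∣i-j∣≤∣i∣+∣j∣; i*j≡0⇒i≡0∨j≡0)
  open import Data.Integer.Divisibility.Signed using (_∣_; divides; ∣ᵤ⇒∣; ∣⇒∣ᵤ; ∣m∣n⇒∣m+n; ∣m∣n⇒∣m-n; ∣n⇒∣m*n; ∣m⇒∣m*n; ∣m+n∣m⇒∣n; ∣-trans; *-monoʳ-∣)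
  open import Data.Integer.Tactic.RingSolver using (solve-∀)
  open import Data.Rational using (0ℚ; mkℚ) renaming (_<_ to _<ℚ_)
  open import Data.Empty using (⊥-elim)
  open import Data.List using (List; length; filter; upTo; _++_)
  open import Data.List.Properties using (length-++; length-upTo)
  open import Data.List.Membership.Propositional using (_∈_)
  open import Data.List.Membership.Propositional.Properties using (∈-filter⁺; ∈-upTo⁺; ∈-++⁺ˡ; ∈-++⁺ʳ)
  open import Data.Product using (Σ; ∃; _×_; _,_; proj₁; proj₂)
  open import Data.Sum using (_⊎_; inj₁; inj₂; [_,_]′)
  open import Relation.Binary.PropositionalEquality
  open import Relation.Nullary using (¬_; yes; no)
  open import Relation.Nullary.Decidable using (_×-dec_)
  open Naturals
  open Rationals using (exceedsBound)

  -- Sequences with alternating coefficients and their identities.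

  module Recurrence (S : ℤ) where

    opaque
      -- Swapping the coefficients at each step makes every tail of a solution a solution of the
      -- same kind, so inductions move the starting values.
      W : ℤ → ℤ → ℤ → ℤ → ℕ → ℤ
      W c c′ x y zero = x
      W c c′ x y (suc n) = W c′ c y (c * y + S * x) n

    -- The coefficient in force at step `n`: `W (n + 2)` is `γ n * W (n + 1) + S * W n`.
    γ : ℤ → ℤ → ℕ → ℤ
    γ c c′ zero = c
    γ c c′ (suc n) = γ c′ c n

    L G : ℤ → ℤ → ℕ → ℤ
    L c c′ = W c c′ 0ℤ 1ℤ
    G c c′ = W c c′ 1ℤ 0ℤ

    opaque
      unfolding W

      W-zero : ∀ c c′ x y → W c c′ x y 0 ≡ x
      W-zero c c′ x y = refl

      W-one : ∀ c c′ x y → W c c′ x y 1 ≡ y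
      W-one c c′ x y = refl

      W-suc : ∀ c c′ x y n → W c c′ x y (suc n) ≡ W c′ c y (c * y + S * x) n
      W-suc c c′ x y n = refl

      W-two+ : ∀ c c′ x y n → W c c′ x y (suc (suc n)) ≡ W c c′ (c * y + S * x) (c′ * (c * y + S * x) + S * y) n
      W-two+ c c′ x y n = refl

      W-compose : ∀ c c′ x y n k →
        W c c′ x y (n ℕ.+ k) ≡ W (γ c c′ n) (γ c′ c n) (W c c′ x y n) (W c c′ x y (suc n)) k
      W-compose c c′ x y zero k = refl
      W-compose c c′ x y (suc n) k = W-compose c′ c y (c * y + S * x) n k

      W-linear : ∀ c c′ x y n → W c c′ x y n ≡ x * G c c′ n + y * L c c′ n
      W-linear c c′ x y zero = lemma x y
        where lemma : ∀ x y → x ≡ x * 1ℤ + y * 0ℤ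
              lemma = solve-∀
      W-linear c c′ x y (suc n) = begin
        W c′ c y (c * y + S * x) n                    ≡⟨ W-linear c′ c y (c * y + S * x) n ⟩
        y * g + (c * y + S * x) * l                   ≡⟨ lemma c S x y g l ⟩
        x * (0ℤ * g + (c * 0ℤ + S * 1ℤ) * l) + y * (1ℤ * g + (c * 1ℤ + S * 0ℤ) * l)
          ≡⟨ sym (cong₂ (λ u v → x * u + y * v) (W-linear c′ c 0ℤ (c * 0ℤ + S * 1ℤ) n) (W-linear c′ c 1ℤ (c * 1ℤ + S * 0ℤ) n)) ⟩
        x * G c c′ (suc n) + y * L c c′ (suc n)       ∎
        where
        open ≡-Reasoning
        g l : ℤ
        g = G c′ c n
        l = L c′ c n
        lemma : ∀ c S x y g l → y * g + (c * y + S * x) * l ≡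
          x * (0ℤ * g + (c * 0ℤ + S * 1ℤ) * l) + y * (1ℤ * g + (c * 1ℤ + S * 0ℤ) * l)
        lemma = solve-∀

      G-suc : ∀ c c′ n → G c c′ (suc n) ≡ S * L c′ c n
      G-suc c c′ n = trans (W-linear c′ c 0ℤ (c * 0ℤ + S * 1ℤ) n) (lemma c S (G c′ c n) (L c′ c n))
        where lemma : ∀ c S g l → 0ℤ * g + (c * 0ℤ + S * 1ℤ) * l ≡ S * l
              lemma = solve-∀

      L-suc : ∀ c c′ n → L c c′ (suc n) ≡ G c′ c n + c * L c′ c n
      L-suc c c′ n = trans (W-linear c′ c 1ℤ (c * 1ℤ + S * 0ℤ) n) (lemma c S (G c′ c n) (L c′ c n))
        where lemma : ∀ c S g l → 1ℤ * g + (c * 1ℤ + S * 0ℤ) * l ≡ g + c * l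
              lemma = solve-∀

    -- The norm form of the recurrence: for `c = c′` it is c (y² - c x y - S x²). The weights `c`
    -- and `c′` are chosen so that one step, including the swap, multiplies it by `- S`.
    q : ℤ → ℤ → ℤ → ℤ → ℤ
    q c c′ x y = c * y * y - c * c′ * x * y - c′ * S * x * x

    opaque
      unfolding W

      q-W : ∀ c c′ x y n → q (γ c c′ n) (γ c′ c n) (W c c′ x y n) (W c c′ x y (suc n)) ≡ (- S) ^ n * q c c′ x y
      q-W c c′ x y zero = sym (*-identityˡ _)
      q-W c c′ x y (suc n) = trans (q-W c′ c y (c * y + S * x) n) (lemma c c′ S x y ((- S) ^ n))
        where lemma : ∀ c c′ S x y z → z * (c′ * (c * y + S * x) * (c * y + S * x) - c′ * c * y * (c * y + S * x) - c * S * y * y)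
                ≡ (- S) * z * (c * y * y - c * c′ * x * y - c′ * S * x * x)
              lemma = solve-∀

    -- This is `q c c′` at the pair `(L n , - G n)`, the starting values of a solution that vanishes
    -- at index `n`.
    Θ : ℤ → ℤ → ℕ → ℤ
    Θ c c′ n = c * G c c′ n * G c c′ n + c * c′ * L c c′ n * G c c′ n - c′ * S * L c c′ n * L c c′ n

    Θ-suc : ∀ c c′ n → Θ c c′ (suc n) ≡ - S * Θ c′ c n
    Θ-suc c c′ n rewrite G-suc c c′ n | L-suc c c′ n = lemma c c′ S (G c′ c n) (L c′ c n)
      where lemma : ∀ c c′ S g l → c * (S * l) * (S * l) + c * c′ * (g + c * l) * (S * l) - c′ * S * (g + c * l) * (g + c * l)
              ≡ - S * (c′ * g * g + c′ * c * l * g - c * S * l * l)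
            lemma = solve-∀

    Θ-power : ∀ c c′ n → ∃ λ e → Θ c c′ n ≡ S ^ n * e
    Θ-power c c′ zero = Θ c c′ zero , sym (*-identityˡ _)
    Θ-power c c′ (suc n) with Θ-power c′ c n
    ... | e , eq = - e , trans (Θ-suc c c′ n) (trans (cong (- S *_) eq) (lemma S (S ^ n) e))
      where lemma : ∀ S z e → - S * (z * e) ≡ S * z * (- e)
            lemma = solve-∀

    -- Modulo `W n` the pair (L x , L y) agrees with x (L , - G), and `q` is quadratic. Since `Θ` is
    -- divisible by `S ^ n`, this controls the primes that divide both `S` and `W n`.
    L²q : ∀ c c′ x y n → ∃ λ v → L c c′ n * L c c′ n * q c c′ x y ≡ v * W c c′ x y n + x * x * Θ c c′ n
    L²q c c′ x y n = v , trans (lemma c c′ S x y l g)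
                       (cong (λ z → v * z + x * x * Θ c c′ n) (sym (W-linear c c′ x y n)))
      where
      l = L c c′ n
      g = G c c′ n
      v = c * (y * l - x * g) - c * c′ * x * l
      lemma : ∀ c c′ S x y l g → l * l * (c * y * y - c * c′ * x * y - c′ * S * x * x) ≡
        (c * (y * l - x * g) - c * c′ * x * l) * (x * g + y * l) + x * x * (c * g * g + c * c′ * l * g - c′ * S * l * l)
      lemma = solve-∀

    opaque
      unfolding W

      -- Raising the index by one acts linearly on `G` and `L`; the factor `γ n` absorbs the phase,
      -- so that the coefficients do not depend on `n`.
      γ-transfer : ∀ c c′ n →
        (γ c c′ n * G c c′ (suc n) ≡ c′ * S * L c c′ n) ×
        (γ c c′ n * L c c′ (suc n) ≡ c * G c c′ n + c * c′ * L c c′ n)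
      γ-transfer c c′ zero = lemma₁ c c′ S , lemma₂ c c′
        where lemma₁ : ∀ c c′ S → c * 0ℤ ≡ c′ * S * 0ℤ
              lemma₁ = solve-∀
              lemma₂ : ∀ c c′ → c * 1ℤ ≡ c * 1ℤ + c * c′ * 0ℤ
              lemma₂ = solve-∀
      γ-transfer c c′ (suc n) with γ-transfer c′ c n
      ... | ihG , ihL
        rewrite G-suc c c′ (suc n) | L-suc c c′ (suc n) | G-suc c c′ n | L-suc c c′ n =
          trans (lemma₁ t S (L c′ c (suc n))) (trans (cong (S *_) ihL) (lemma₂ c c′ S (G c′ c n) (L c′ c n))) ,
          trans (lemma₃ t c (G c′ c (suc n)) (L c′ c (suc n)))
            (trans (cong₂ (λ u v → u + c * v) ihG ihL) (lemma₄ c c′ S (G c′ c n) (L c′ c n)))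
        where
        t : ℤ
        t = γ c′ c n
        lemma₁ : ∀ t S l → t * (S * l) ≡ S * (t * l)
        lemma₁ = solve-∀
        lemma₂ : ∀ c c′ S g l → S * (c′ * g + c′ * c * l) ≡ c′ * S * (g + c * l)
        lemma₂ = solve-∀
        lemma₃ : ∀ t c g l → t * (g + c * l) ≡ t * g + c * (t * l)
        lemma₃ = solve-∀
        lemma₄ : ∀ c c′ S g l → c * S * l + c * (c′ * g + c′ * c * l) ≡ c * (S * l) + c * c′ * (g + c * l)
        lemma₄ = solve-∀

    -- Cramer's rule: `W n` and `γ n * W (n + 1)` are combinations of `G n` and `L n` with
    -- determinant -q, and eliminating `G n` leaves `L n`.
    q*L : ∀ c c′ x y n → q c c′ x y * L c c′ n ≡ c * y * W c c′ x y n - x * (γ c c′ n * W c c′ x y (suc n))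
    q*L c c′ x y n = begin
      q c c′ x y * l                                    ≡⟨ lemma₁ c c′ S x y l g ⟩
      c * y * (x * g + y * l) - x * (x * (c′ * S * l) + y * (c * g + c * c′ * l))
        ≡⟨ cong₂ (λ u v → c * y * (x * g + y * l) - x * (x * u + y * v)) (sym (proj₁ (γ-transfer c c′ n))) (sym (proj₂ (γ-transfer c c′ n))) ⟩
      c * y * (x * g + y * l) - x * (x * (t * g⁺) + y * (t * l⁺)) ≡⟨ lemma₂ c x y g l t g⁺ l⁺ ⟩
      c * y * (x * g + y * l) - x * (t * (x * g⁺ + y * l⁺))
        ≡⟨ sym (cong₂ (λ u v → c * y * u - x * (t * v)) (W-linear c c′ x y n) (W-linear c c′ x y (suc n))) ⟩
      c * y * W c c′ x y n - x * (t * W c c′ x y (suc n)) ∎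
      where
      open ≡-Reasoning
      l = L c c′ n
      g = G c c′ n
      l⁺ = L c c′ (suc n)
      g⁺ = G c c′ (suc n)
      t = γ c c′ n
      lemma₁ : ∀ c c′ S x y l g → (c * y * y - c * c′ * x * y - c′ * S * x * x) * l ≡
        c * y * (x * g + y * l) - x * (x * (c′ * S * l) + y * (c * g + c * c′ * l))
      lemma₁ = solve-∀
      lemma₂ : ∀ c x y g l t g⁺ l⁺ → c * y * (x * g + y * l) - x * (x * (t * g⁺) + y * (t * l⁺)) ≡
        c * y * (x * g + y * l) - x * (t * (x * g⁺ + y * l⁺))
      lemma₂ = solve-∀

    module _ (R : ℤ) where

      opaque
        unfolding W

        -- Multiplying every other term by `R` exchanges the coefficients 1 and `R`, so the two
        -- phases of a sequence differ at most by a factor `R`.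
        W-phase₁ : ∀ x y n → W R 1ℤ (R * x) y n ≡ W 1ℤ R x y n ⊎ W R 1ℤ (R * x) y n ≡ R * W 1ℤ R x y n
        W-phase₂ : ∀ x y n → W 1ℤ R x (R * y) n ≡ W R 1ℤ x y n ⊎ W 1ℤ R x (R * y) n ≡ R * W R 1ℤ x y n
        W-phase₁ x y zero = inj₂ refl
        W-phase₁ x y (suc n) = subst (λ v → W 1ℤ R y v n ≡ z ⊎ W 1ℤ R y v n ≡ R * z) (lemma R S x y) (W-phase₂ y (1ℤ * y + S * x) n)
          where
          z : ℤ
          z = W 1ℤ R x y (suc n)
          lemma : ∀ R S x y → R * (1ℤ * y + S * x) ≡ R * y + S * (R * x)
          lemma = solve-∀
        W-phase₂ x y zero = inj₁ refl
        W-phase₂ x y (suc n) = subst (λ v → W R 1ℤ (R * y) v n ≡ z ⊎ W R 1ℤ (R * y) v n ≡ R * z) (lemma R S x y) (W-phase₁ y (R * y + S * x) n)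
          where
          z : ℤ
          z = W R 1ℤ x y (suc n)
          lemma : ∀ R S x y → R * y + S * x ≡ 1ℤ * (R * y) + S * x
          lemma = solve-∀

      L-phase : ∀ n → L R 1ℤ n ≡ L 1ℤ R n ⊎ L R 1ℤ n ≡ R * L 1ℤ R n
      L-phase n = subst (λ z → W R 1ℤ z 1ℤ n ≡ L 1ℤ R n ⊎ W R 1ℤ z 1ℤ n ≡ R * L 1ℤ R n) (*-zeroʳ R) (W-phase₁ 0ℤ 1ℤ n)

      γ-phase : ∀ n → (γ 1ℤ R n ≡ 1ℤ × γ R 1ℤ n ≡ R) ⊎ (γ 1ℤ R n ≡ R × γ R 1ℤ n ≡ 1ℤ)
      γ-phase zero = inj₁ (refl , refl)
      γ-phase (suc n) with γ-phase n
      ... | inj₁ (a , b) = inj₂ (b , a)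
      ... | inj₂ (a , b) = inj₁ (b , a)

  abs-^ : ∀ i n → abs (i ^ n) ≡ abs i ℕ.^ n
  abs-^ i zero = refl
  abs-^ i (suc n) = trans (abs-* i (i ^ n)) (cong (abs i ℕ.*_) (abs-^ i n))

  ≢0⇒abs≥1 : ∀ i → i ≢ 0ℤ → 1 ℕ.≤ abs i
  ≢0⇒abs≥1 (+ zero) i≢0 = ⊥-elim (i≢0 refl)
  ≢0⇒abs≥1 (+ suc n) _ = ℕ.s≤s ℕ.z≤n
  ≢0⇒abs≥1 -[1+ n ] _ = ℕ.s≤s ℕ.z≤n

  -- Common divisors of two terms.

  module Lehmer (R S x₀ y₀ : ℤ) (R⊥S : Coprime (abs R) (abs S)) (R≢0 : R ≢ 0ℤ)
    (Δ : ℤ) (q≡Δ : Recurrence.q S 1ℤ R x₀ y₀ ≡ Δ) (Δ≢0 : Δ ≢ 0ℤ)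
    (L≢0 : ∀ k → Recurrence.L S 1ℤ R (suc k) ≢ 0ℤ) where

    open Recurrence S

    v : ℕ → ℤ
    v = W 1ℤ R x₀ y₀

    w ℓ : ℕ → ℕ
    w n = abs (v n)
    ℓ k = abs (L 1ℤ R k)

    γₙ γ′ₙ : ℕ → ℤ
    γₙ = γ 1ℤ R
    γ′ₙ = γ R 1ℤ

    v-shift : ∀ n k → v (n ℕ.+ k) ≡ v n * G (γₙ n) (γ′ₙ n) k + v (suc n) * L (γₙ n) (γ′ₙ n) k
    v-shift n k = trans (W-compose 1ℤ R x₀ y₀ n k) (W-linear (γₙ n) (γ′ₙ n) (v n) (v (suc n)) k)

    L-cases : ∀ n k → L (γₙ n) (γ′ₙ n) k ≡ L 1ℤ R k ⊎ L (γₙ n) (γ′ₙ n) k ≡ R * L 1ℤ R k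
    L-cases n k with γₙ n | γ′ₙ n | γ-phase R n
    ... | _ | _ | inj₁ (refl , refl) = inj₁ refl
    ... | _ | _ | inj₂ (refl , refl) = L-phase R k

    L∣phase : ∀ n k → L 1ℤ R k ∣ L (γₙ n) (γ′ₙ n) k
    L∣phase n k with L-cases n k
    ... | inj₁ eq = divides 1ℤ (trans eq (sym (*-identityˡ _)))
    ... | inj₂ eq = divides R eq

    phase∣RL : ∀ n k → L (γₙ n) (γ′ₙ n) k ∣ R * L 1ℤ R k
    phase∣RL n k with L-cases n k
    ... | inj₁ eq = divides R (cong (R *_) (sym eq))
    ... | inj₂ eq = divides 1ℤ (trans (sym eq) (sym (*-identityˡ _)))

    phase≢0 : ∀ n k → 1 ℕ.≤ k → L (γₙ n) (γ′ₙ n) k ≢ 0ℤ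
    phase≢0 n (suc k) _ eq with phase∣RL n (suc k)
    ... | divides t eq′ = RL≢0 (trans eq′ (trans (cong (t *_) eq) (*-zeroʳ t)))
      where
      RL≢0 : R * L 1ℤ R (suc k) ≢ 0ℤ
      RL≢0 h with i*j≡0⇒i≡0∨j≡0 R h
      ... | inj₁ z = R≢0 z
      ... | inj₂ z = L≢0 k z

    -- The shift formula writes `L (i + j)` as a multiple of `L i` plus a multiple of the `j`-th
    -- Lehmer number in the phase of `i`, which `L j` divides.
    ℓ-additive : ∀ e i j z → e ℕ.∣ ℓ i ℕ.* z → e ℕ.∣ ℓ j ℕ.* z → e ℕ.∣ ℓ (i ℕ.+ j) ℕ.* z
    ℓ-additive e i j z hi hj = to (subst (+ e ∣_) (sym expand)
        (∣m∣n⇒∣m+n {+ e} (∣n⇒∣m*n {+ e} (G c c′ j) {L 1ℤ R i * + z} (from i hi)) (∣n⇒∣m*n {+ e} (L 1ℤ R (suc i) * t) {L 1ℤ R j * + z} (from j hj))))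
      where
      c = γₙ i
      c′ = γ′ₙ i
      t = _∣_.quotient (L∣phase i j)
      from : ∀ k → e ℕ.∣ ℓ k ℕ.* z → + e ∣ L 1ℤ R k * + z
      from k h = ∣ᵤ⇒∣ {+ e} {L 1ℤ R k * + z} (subst (e ℕ.∣_) (sym (abs-* (L 1ℤ R k) (+ z))) h)
      to : + e ∣ L 1ℤ R (i ℕ.+ j) * + z → e ℕ.∣ ℓ (i ℕ.+ j) ℕ.* z
      to h = subst (e ℕ.∣_) (abs-* (L 1ℤ R (i ℕ.+ j)) (+ z)) (∣⇒∣ᵤ {+ e} {L 1ℤ R (i ℕ.+ j) * + z} h)
      expand : L 1ℤ R (i ℕ.+ j) * + z ≡ G c c′ j * (L 1ℤ R i * + z) + L 1ℤ R (suc i) * t * (L 1ℤ R j * + z)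
      expand = trans (cong (_* + z) (trans (trans (W-compose 1ℤ R 0ℤ 1ℤ i j) (W-linear c c′ (L 1ℤ R i) (L 1ℤ R (suc i)) j))
                       (cong (λ u → L 1ℤ R i * G c c′ j + L 1ℤ R (suc i) * u) (_∣_.equality (L∣phase i j)))))
                     (lemma (L 1ℤ R i) (G c c′ j) (L 1ℤ R (suc i)) t (L 1ℤ R j) (+ z))
        where lemma : ∀ a g b t l z → (a * g + b * (t * l)) * z ≡ g * (a * z) + b * t * (l * z)
              lemma = solve-∀

    Gbound : ℕ → ℕ
    Gbound zero = 0
    Gbound (suc K) = Gbound K ℕ.+ (abs (G 1ℤ R (suc K)) ℕ.+ abs (G R 1ℤ (suc K)))

    G≤Gbound : ∀ K n k → 1 ℕ.≤ k → k ℕ.≤ K → abs (G (γₙ n) (γ′ₙ n) k) ℕ.≤ Gbound K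
    G≤Gbound zero n k 1≤k k≤0 = ⊥-elim (ℕ.<⇒≱ 1≤k k≤0)
    G≤Gbound (suc K) n k 1≤k k≤ with ℕ.m≤n⇒m<n∨m≡n k≤
    ... | inj₁ k< = ℕ.≤-trans (G≤Gbound K n k 1≤k (ℕ.≤-pred k<)) (ℕ.m≤m+n _ _)
    ... | inj₂ refl = ℕ.≤-trans phases (ℕ.m≤n+m _ (Gbound K))
      where
      phases : abs (G (γₙ n) (γ′ₙ n) (suc K)) ℕ.≤ abs (G 1ℤ R (suc K)) ℕ.+ abs (G R 1ℤ (suc K))
      phases with γₙ n | γ′ₙ n | γ-phase R n
      ... | _ | _ | inj₁ (refl , refl) = ℕ.m≤m+n _ _
      ... | _ | _ | inj₂ (refl , refl) = ℕ.m≤n+m _ _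

    -- In v (n + k) = v n G + v (n + 1) L the factor `L` is a nonzero integer, and for `k ≤ K` the
    -- factor `G` takes finitely many values because there are only two phases.
    spread : ∀ K → ∃ λ A → ∀ n k → 1 ℕ.≤ k → k ℕ.≤ K → w (suc n) ℕ.≤ w (n ℕ.+ k) ℕ.+ A ℕ.* w n
    spread K = Gbound K , λ n k 1≤k k≤K → let
        l = L (γₙ n) (γ′ₙ n) k
        g = G (γₙ n) (γ′ₙ n) k
        open ℕ.≤-Reasoning
      in begin
        w (suc n)                       ≤⟨ ℕ.m≤m*n (w (suc n)) (abs l) {{ℕ.>-nonZero (≢0⇒abs≥1 l (phase≢0 n k 1≤k))}} ⟩
        w (suc n) ℕ.* abs l             ≡⟨ sym (abs-* (v (suc n)) l) ⟩
        abs (v (suc n) * l)               ≡⟨ cong abs (trans (lemma (v n * g) (v (suc n) * l)) (cong (_- v n * g) (sym (v-shift n k)))) ⟩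
        abs (v (n ℕ.+ k) - v n * g)       ≤⟨ ∣i-j∣≤∣i∣+∣j∣ (v (n ℕ.+ k)) (v n * g) ⟩
        w (n ℕ.+ k) ℕ.+ abs (v n * g)     ≡⟨ cong (w (n ℕ.+ k) ℕ.+_) (trans (abs-* (v n) g) (ℕ.*-comm (w n) (abs g))) ⟩
        w (n ℕ.+ k) ℕ.+ abs g ℕ.* w n   ≤⟨ ℕ.+-monoʳ-≤ (w (n ℕ.+ k)) (ℕ.*-monoˡ-≤ (w n) (G≤Gbound K n k 1≤k k≤K)) ⟩
        w (n ℕ.+ k) ℕ.+ Gbound K ℕ.* w n ∎
      where
      lemma : ∀ a b → b ≡ a + b - a
      lemma = solve-∀

    -- Modulo a prime divisor of `S` the `G` part of `L-suc` vanishes, so `L` is congruent to a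
    -- product of coefficients.
    L-coprime : ∀ {p} → Prime p → p ℕ.∣ abs S → ∀ {c c′} → ¬ p ℕ.∣ abs c → ¬ p ℕ.∣ abs c′ → ∀ n → ¬ p ℕ.∣ abs (L c c′ (suc n))
    L-coprime pr p∣S p∤c p∤c′ zero h = prime∤1 pr (subst (λ z → _ ℕ.∣ abs z) (W-one _ _ 0ℤ 1ℤ) h)
    L-coprime {p} pr p∣S {c} {c′} p∤c p∤c′ (suc n) h =
      [ p∤c , L-coprime pr p∣S {c′} {c} p∤c′ p∤c n ]′ (euclidsLemma (abs c) (abs (L c′ c (suc n))) pr p∣cL)
      where
      p∣L : + p ∣ L c c′ (suc (suc n))
      p∣L = ∣ᵤ⇒∣ {+ p} {L c c′ (suc (suc n))} h
      p∣G : + p ∣ G c′ c (suc n)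
      p∣G = subst (+ p ∣_) (sym (G-suc c′ c n)) (∣m⇒∣m*n (L c c′ n) (∣ᵤ⇒∣ {+ p} {S} p∣S))
      p∣cL : p ℕ.∣ abs c ℕ.* abs (L c′ c (suc n))
      p∣cL = subst (p ℕ.∣_) (abs-* c (L c′ c (suc n))) (∣⇒∣ᵤ {+ p} {c * L c′ c (suc n)}
        (∣m+n∣m⇒∣n {+ p} {G c′ c (suc n)} {c * L c′ c (suc n)} (subst (+ p ∣_) (L-suc c c′ (suc n)) p∣L) p∣G))

    -- For `j` up to the index, `p ^ j` divides both terms on the right of `L²q`, hence `L * L * Δ`,
    -- and `p` does not divide `L`.
    ramified-≤ : ∀ {p} → Prime p → p ℕ.∣ abs S → ∀ n j → j ℕ.≤ suc n → p ℕ.^ j ℕ.∣ w (suc n) → p ℕ.^ j ℕ.∣ abs Δ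
    ramified-≤ {p} pr p∣S n j j≤n h = power-cancel-∤ pr j p∤L (power-cancel-∤ pr j p∤L
        (subst (P ℕ.∣_) (trans (abs-* (l * l) Δ) (trans (cong (ℕ._* abs Δ) (abs-* l l)) (ℕ.*-assoc (abs l) (abs l) (abs Δ))))
          (∣⇒∣ᵤ {+ P} {l * l * Δ} P∣LLΔ)))
      where
      P = p ℕ.^ j
      l = L 1ℤ R (suc n)
      t = proj₁ (L²q 1ℤ R x₀ y₀ (suc n))
      e = proj₁ (Θ-power 1ℤ R (suc n))
      p∤R : ¬ p ℕ.∣ abs R
      p∤R p∣R = prime∤1 pr (ℕ.∣-reflexive (R⊥S (p∣R , p∣S)))
      p∤L : ¬ p ℕ.∣ abs l
      p∤L = L-coprime pr p∣S {1ℤ} {R} (prime∤1 pr) p∤R n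
      P∣Sⁿ : P ℕ.∣ abs (S ^ suc n)
      P∣Sⁿ with ℕ.m≤n⇒∃[o]m+o≡n j≤n
      ... | o , eq = subst (P ℕ.∣_) (trans (sym (ℕ.^-distribˡ-+-* (abs S) j o)) (trans (cong (abs S ℕ.^_) eq) (sym (abs-^ S (suc n)))))
                     (ℕ.∣m⇒∣m*n _ (pow-mono j))
        where
        pow-mono : ∀ j → p ℕ.^ j ℕ.∣ abs S ℕ.^ j
        pow-mono zero = ℕ.∣-refl
        pow-mono (suc j) = ℕ.*-pres-∣ p∣S (pow-mono j)
      P∣LLΔ : + P ∣ l * l * Δ
      P∣LLΔ = subst (+ P ∣_) (sym (trans (cong (l * l *_) (sym q≡Δ)) (proj₂ (L²q 1ℤ R x₀ y₀ (suc n)))))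
        (∣m∣n⇒∣m+n (∣n⇒∣m*n {+ P} t {v (suc n)} (∣ᵤ⇒∣ {+ P} {v (suc n)} h))
          (∣n⇒∣m*n {+ P} (x₀ * x₀) {Θ 1ℤ R (suc n)} (subst (+ P ∣_) (sym (proj₂ (Θ-power 1ℤ R (suc n)))) (∣m⇒∣m*n {+ P} {S ^ suc n} e (∣ᵤ⇒∣ {+ P} {S ^ suc n} P∣Sⁿ)))))

    -- If p ∣ S then v_p(v n) is bounded: otherwise p ^ n would divide Δ, which is too small.
    ramified : ∀ {p} → Prime p → p ℕ.∣ abs S → ∀ n j → abs Δ ℕ.≤ n → p ℕ.^ j ℕ.∣ w n → p ℕ.^ j ℕ.∣ abs Δ
    ramified pr p∣S zero j Δ≤0 h = ⊥-elim (ℕ.<⇒≱ (≢0⇒abs≥1 Δ Δ≢0) Δ≤0)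
    ramified {p} pr p∣S (suc n) j Δ≤n h with j ℕ.≤? suc n
    ... | yes j≤n = ramified-≤ pr p∣S n j j≤n h
    ... | no j≰n = ⊥-elim (ℕ.<⇒≱ (ℕ.<-≤-trans (n<2^n (suc n)) (ℕ.^-monoˡ-≤ (suc n) 2≤p))
                     (ℕ.≤-trans (ℕ.∣⇒≤ {{ℕ.>-nonZero (≢0⇒abs≥1 Δ Δ≢0)}} pⁿ∣Δ) Δ≤n))
      where
      2≤p : 2 ℕ.≤ p
      2≤p = ℕ.nonTrivial⇒n>1 p {{prime⇒nonTrivial pr}}
      pⁿ∣Δ : p ℕ.^ suc n ℕ.∣ abs Δ
      pⁿ∣Δ with ℕ.m≤n⇒∃[o]m+o≡n (ℕ.<⇒≤ (ℕ.≰⇒> j≰n))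
      ... | o , eq = ramified-≤ pr p∣S n (suc n) ℕ.≤-refl
            (ℕ.∣-trans (subst (p ℕ.^ suc n ℕ.∣_) (trans (sym (ℕ.^-distribˡ-+-* p (suc n) o)) (cong (p ℕ.^_) eq)) (ℕ.m∣m*n _)) h)

    -- For `p` not dividing `S`, the shift formula shows that `p ^ j` divides v (n + 1) L. Every
    -- term of `q (v n) (v (n + 1))` times `L` is then divisible by `p ^ j`, and that value is (-S)
    -- ^ n Δ by `q-W`. The factor `R` of κ converts the phase of `L`.
    common : ∀ p → Prime p → ∀ n k j → abs Δ ℕ.≤ n → 1 ℕ.≤ k → p ℕ.^ j ℕ.∣ w n → p ℕ.^ j ℕ.∣ w (n ℕ.+ k) →
      p ℕ.^ j ℕ.∣ abs (Δ * R) ℕ.* ℓ k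
    common p pr n k j Δ≤n 1≤k hₙ hₙₖ with p ℕ.∣? abs S
    ... | yes p∣S = ℕ.∣-trans (ramified pr p∣S n j Δ≤n hₙ)
            (ℕ.∣m⇒∣m*n (ℓ k) (subst (abs Δ ℕ.∣_) (sym (abs-* Δ R)) (ℕ.m∣m*n (abs R))))
    ... | no p∤S = subst (P ℕ.∣_) (trans (cong abs (sym (lemma Δ R (L 1ℤ R k)))) (abs-* (Δ * R) (L 1ℤ R k)))
          (∣⇒∣ᵤ {+ P} {Δ * (R * L 1ℤ R k)} (∣-trans P∣ΔL (*-monoʳ-∣ Δ (phase∣RL n k))))
      where
      P = p ℕ.^ j
      c = γₙ n
      c′ = γ′ₙ n
      l = L c c′ k
      lemma : ∀ a b c → a * b * c ≡ a * (b * c)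
      lemma = solve-∀
      P∣x : + P ∣ v n
      P∣x = ∣ᵤ⇒∣ {+ P} {v n} hₙ
      P∣yl : + P ∣ v (suc n) * l
      P∣yl = ∣m+n∣m⇒∣n {+ P} {v n * G c c′ k} {v (suc n) * l} (subst (+ P ∣_) (v-shift n k) (∣ᵤ⇒∣ {+ P} {v (n ℕ.+ k)} hₙₖ)) (∣m⇒∣m*n {+ P} {v n} (G c c′ k) P∣x)
      P∣ql : + P ∣ (- S) ^ n * (Δ * l)
      P∣ql = subst (+ P ∣_) (trans (expand c c′ S (v n) (v (suc n)) l)
               (trans (cong (_* l) (trans (q-W 1ℤ R x₀ y₀ n) (cong ((- S) ^ n *_) q≡Δ))) (lemma ((- S) ^ n) Δ l)))
               (∣m∣n⇒∣m-n (∣n⇒∣m*n {+ P} (c * v (suc n)) {v (suc n) * l} P∣yl)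
                          (∣m⇒∣m*n {+ P} {v n} ((c * c′ * v (suc n) + c′ * S * v n) * l) P∣x))
        where
        expand : ∀ c c′ S x y l → c * y * (y * l) - x * ((c * c′ * y + c′ * S * x) * l) ≡
          (c * y * y - c * c′ * x * y - c′ * S * x * x) * l
        expand = solve-∀
      P∣ΔL : + P ∣ Δ * l
      P∣ΔL = ∣ᵤ⇒∣ {+ P} {Δ * l} (power-cancel-∤ pr j (prime∤power pr p∤S n)
        (subst (P ℕ.∣_) (trans (abs-* ((- S) ^ n) (Δ * l)) (cong (ℕ._* abs (Δ * l)) (trans (abs-^ (- S) n) (cong (ℕ._^ n) (∣-i∣≡∣i∣ S)))))
          (∣⇒∣ᵤ {+ P} {(- S) ^ n * (Δ * l)} P∣ql)))

  sq-abs : ∀ i → i * i ≡ + sq (abs i)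
  sq-abs (+ n) = sym (pos-* n n)
  sq-abs -[1+ n ] = refl

  *≤sq+sq : ∀ a b → a ℕ.* b ℕ.≤ sq a ℕ.+ sq b
  *≤sq+sq a b = [ (λ h → ℕ.≤-trans (ℕ.*-monoˡ-≤ b h) (ℕ.m≤n+m (sq b) (sq a)))
                , (λ h → ℕ.≤-trans (ℕ.*-monoʳ-≤ a h) (ℕ.m≤m+n (sq a) (sq b))) ]′ (ℕ.≤-total a b)

  sq-cancel-≤ : ∀ a b → sq a ℕ.≤ sq b → a ℕ.≤ b
  sq-cancel-≤ a b h with a ℕ.≤? b
  ... | yes a≤b = a≤b
  ... | no a≰b = ⊥-elim (ℕ.<⇒≱ (ℕ.*-mono-< (ℕ.≰⇒> a≰b) (ℕ.≰⇒> a≰b)) h)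

  sq-combination-≤ : ∀ M a b {t} → t ℕ.≤ M ℕ.* (a ℕ.+ b) → sq t ℕ.≤ 2 ℕ.* sq M ℕ.* (sq a ℕ.+ sq b)
  sq-combination-≤ M a b {t} h = begin
    sq t                                 ≤⟨ ℕ.*-mono-≤ h h ⟩
    sq (M ℕ.* (a ℕ.+ b))                 ≡⟨ lemma₁ M (a ℕ.+ b) ⟩
    sq M ℕ.* sq (a ℕ.+ b)                ≤⟨ ℕ.*-monoʳ-≤ (sq M) (sq-+-≤ a b) ⟩
    sq M ℕ.* (2 ℕ.* (sq a ℕ.+ sq b))     ≡⟨ lemma₂ (sq M) (sq a ℕ.+ sq b) ⟩
    2 ℕ.* sq M ℕ.* (sq a ℕ.+ sq b)       ∎
    where
    open ℕ.≤-Reasoning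
    lemma₁ : ∀ M s → (M ℕ.* s) ℕ.* (M ℕ.* s) ≡ M ℕ.* M ℕ.* (s ℕ.* s)
    lemma₁ = ℕ-Solver.solve-∀
    lemma₂ : ∀ M s → M ℕ.* (2 ℕ.* s) ≡ 2 ℕ.* M ℕ.* s
    lemma₂ = ℕ-Solver.solve-∀

  -- Estimates common to real and complex roots.

  module Bounds (R S : ℤ) (R≢0 : R ≢ 0ℤ) where

    open Recurrence S

    ρ σ : ℕ
    ρ = abs R
    σ = abs S

    1≤ρ : 1 ℕ.≤ ρ
    1≤ρ = ≢0⇒abs≥1 R R≢0

    abs-γ-≤ : ∀ n → abs (γ 1ℤ R n) ℕ.≤ ρ × abs (γ R 1ℤ n) ℕ.≤ ρ
    abs-γ-≤ n with γ 1ℤ R n | γ R 1ℤ n | γ-phase R n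
    ... | _ | _ | inj₁ (refl , refl) = 1≤ρ , ℕ.≤-refl
    ... | _ | _ | inj₂ (refl , refl) = ℕ.≤-refl , 1≤ρ

    γ*γ′ : ∀ n → γ 1ℤ R n * γ R 1ℤ n ≡ R
    γ*γ′ n with γ 1ℤ R n | γ R 1ℤ n | γ-phase R n
    ... | _ | _ | inj₁ (refl , refl) = *-identityˡ R
    ... | _ | _ | inj₂ (refl , refl) = *-identityʳ R

    1≤abs-γ′ : ∀ n → 1 ℕ.≤ abs (γ R 1ℤ n)
    1≤abs-γ′ n with γ 1ℤ R n | γ R 1ℤ n | γ-phase R n
    ... | _ | _ | inj₁ (refl , refl) = 1≤ρ
    ... | _ | _ | inj₂ (refl , refl) = ℕ.≤-refl

    form-≤ : ∀ a b c x y → abs (a * y * y - b * x * y - c * x * x) ℕ.≤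
      (abs a ℕ.+ abs b ℕ.+ abs c) ℕ.* (sq (abs x) ℕ.+ sq (abs y))
    form-≤ a b c x y = begin
      abs (a * y * y - b * x * y - c * x * x)
        ≤⟨ ∣i-j∣≤∣i∣+∣j∣ (a * y * y - b * x * y) (c * x * x) ⟩
      abs (a * y * y - b * x * y) ℕ.+ abs (c * x * x)
        ≤⟨ ℕ.+-monoˡ-≤ (abs (c * x * x)) (∣i-j∣≤∣i∣+∣j∣ (a * y * y) (b * x * y)) ⟩
      abs (a * y * y) ℕ.+ abs (b * x * y) ℕ.+ abs (c * x * x)
        ≡⟨ cong₂ ℕ._+_ (cong₂ ℕ._+_ (abs-** a y y) (abs-** b x y)) (abs-** c x x) ⟩
      abs a ℕ.* (abs y ℕ.* abs y) ℕ.+ abs b ℕ.* (abs x ℕ.* abs y) ℕ.+ abs c ℕ.* (abs x ℕ.* abs x)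
        ≤⟨ ℕ.+-mono-≤ (ℕ.+-mono-≤ (ℕ.*-monoʳ-≤ (abs a) (ℕ.m≤n+m _ (sq (abs x)))) (ℕ.*-monoʳ-≤ (abs b) (*≤sq+sq (abs x) (abs y))))
                      (ℕ.*-monoʳ-≤ (abs c) (ℕ.m≤m+n _ _)) ⟩
      abs a ℕ.* s ℕ.+ abs b ℕ.* s ℕ.+ abs c ℕ.* s
        ≡⟨ lemma (abs a) (abs b) (abs c) s ⟩
      (abs a ℕ.+ abs b ℕ.+ abs c) ℕ.* s ∎
      where
      open ℕ.≤-Reasoning
      s = sq (abs x) ℕ.+ sq (abs y)
      abs-** : ∀ i j k → abs (i * j * k) ≡ abs i ℕ.* (abs j ℕ.* abs k)
      abs-** i j k = trans (abs-* (i * j) k) (trans (cong (ℕ._* abs k) (abs-* i j)) (ℕ.*-assoc (abs i) (abs j) (abs k)))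
      lemma : ∀ a b c s → a ℕ.* s ℕ.+ b ℕ.* s ℕ.+ c ℕ.* s ≡ (a ℕ.+ b ℕ.+ c) ℕ.* s
      lemma = ℕ-Solver.solve-∀

    qBound : ℕ
    qBound = ρ ℕ.+ ρ ℕ.+ ρ ℕ.* σ

    -- The form `q` at consecutive terms has absolute value |S| ^ n |Δ| with |Δ| ≥ 1, so the two
    -- terms cannot both be small.
    power-lower : ∀ x y → q 1ℤ R x y ≢ 0ℤ → ∀ n →
      σ ℕ.^ n ℕ.≤ qBound ℕ.* (sq (abs (W 1ℤ R x y n)) ℕ.+ sq (abs (W 1ℤ R x y (suc n))))
    power-lower x y Δ≢0 n = begin
      σ ℕ.^ n                                ≤⟨ ℕ.m≤m*n (σ ℕ.^ n) (abs Δ) {{ℕ.>-nonZero (≢0⇒abs≥1 Δ Δ≢0)}} ⟩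
      σ ℕ.^ n ℕ.* abs Δ                      ≡⟨ cong (ℕ._* abs Δ) (sym (trans (abs-^ (- S) n) (cong (ℕ._^ n) (∣-i∣≡∣i∣ S)))) ⟩
      abs ((- S) ^ n) ℕ.* abs Δ              ≡⟨ sym (abs-* ((- S) ^ n) Δ) ⟩
      abs ((- S) ^ n * Δ)                    ≡⟨ cong abs (sym (q-W 1ℤ R x y n)) ⟩
      abs (q c c′ (W 1ℤ R x y n) (W 1ℤ R x y (suc n))) ≤⟨ form-≤ c (c * c′) (c′ * S) (W 1ℤ R x y n) (W 1ℤ R x y (suc n)) ⟩
      (abs c ℕ.+ abs (c * c′) ℕ.+ abs (c′ * S)) ℕ.* s
        ≤⟨ ℕ.*-monoˡ-≤ s (ℕ.+-mono-≤ (ℕ.+-mono-≤ (proj₁ (abs-γ-≤ n)) (ℕ.≤-reflexive (cong abs (γ*γ′ n))))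
             (ℕ.≤-trans (ℕ.≤-reflexive (abs-* c′ S)) (ℕ.*-monoˡ-≤ σ (proj₂ (abs-γ-≤ n))))) ⟩
      qBound ℕ.* s                           ∎
      where
      open ℕ.≤-Reasoning
      Δ = q 1ℤ R x y
      c = γ 1ℤ R n
      c′ = γ R 1ℤ n
      s = sq (abs (W 1ℤ R x y n)) ℕ.+ sq (abs (W 1ℤ R x y (suc n)))

    W-next : ∀ x y n → W 1ℤ R x y (suc (suc n)) ≡ γ 1ℤ R n * W 1ℤ R x y (suc n) + S * W 1ℤ R x y n
    W-next x y n = trans (cong (W 1ℤ R x y) (ℕ.+-comm 2 n)) (trans (W-compose 1ℤ R x y n 2)
      (trans (W-two+ (γ 1ℤ R n) (γ R 1ℤ n) (W 1ℤ R x y n) (W 1ℤ R x y (suc n)) 0) (W-zero _ _ _ _)))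

    next-≤ : ∀ x y n → abs (W 1ℤ R x y (suc (suc n))) ℕ.≤ (ρ ℕ.+ σ) ℕ.* (abs (W 1ℤ R x y n) ℕ.+ abs (W 1ℤ R x y (suc n)))
    next-≤ x y n = begin
      abs (W 1ℤ R x y (suc (suc n)))      ≡⟨ cong abs (W-next x y n) ⟩
      abs (c * b + S * a)                 ≤⟨ ∣i+j∣≤∣i∣+∣j∣ (c * b) (S * a) ⟩
      abs (c * b) ℕ.+ abs (S * a)         ≡⟨ cong₂ ℕ._+_ (abs-* c b) (abs-* S a) ⟩
      abs c ℕ.* abs b ℕ.+ σ ℕ.* abs a     ≤⟨ ℕ.+-monoˡ-≤ (σ ℕ.* abs a) (ℕ.*-monoˡ-≤ (abs b) (proj₁ (abs-γ-≤ n))) ⟩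
      ρ ℕ.* abs b ℕ.+ σ ℕ.* abs a         ≤⟨ ℕ.m≤m+n _ (ρ ℕ.* abs a ℕ.+ σ ℕ.* abs b) ⟩
      ρ ℕ.* abs b ℕ.+ σ ℕ.* abs a ℕ.+ (ρ ℕ.* abs a ℕ.+ σ ℕ.* abs b) ≡⟨ lemma ρ σ (abs a) (abs b) ⟩
      (ρ ℕ.+ σ) ℕ.* (abs a ℕ.+ abs b)     ∎
      where
      open ℕ.≤-Reasoning
      c = γ 1ℤ R n
      a = W 1ℤ R x y n
      b = W 1ℤ R x y (suc n)
      lemma : ∀ r s a b → r ℕ.* b ℕ.+ s ℕ.* a ℕ.+ (r ℕ.* a ℕ.+ s ℕ.* b) ≡ (r ℕ.+ s) ℕ.* (a ℕ.+ b)
      lemma = ℕ-Solver.solve-∀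

    -- q * L expresses the fundamental solution L through any solution that is not geometric.
    L-≤ : ∀ x y → q 1ℤ R x y ≢ 0ℤ → ∀ n →
      abs (L 1ℤ R n) ℕ.≤ (abs y ℕ.+ abs x ℕ.* ρ) ℕ.* (abs (W 1ℤ R x y n) ℕ.+ abs (W 1ℤ R x y (suc n)))
    L-≤ x y Δ≢0 n = begin
      abs (L 1ℤ R n)                      ≤⟨ ℕ.m≤n*m (abs (L 1ℤ R n)) (abs Δ) {{ℕ.>-nonZero (≢0⇒abs≥1 Δ Δ≢0)}} ⟩
      abs Δ ℕ.* abs (L 1ℤ R n)            ≡⟨ sym (abs-* Δ (L 1ℤ R n)) ⟩
      abs (Δ * L 1ℤ R n)                  ≡⟨ cong abs (q*L 1ℤ R x y n) ⟩
      abs (1ℤ * y * a - x * (c * b))      ≤⟨ ∣i-j∣≤∣i∣+∣j∣ (1ℤ * y * a) (x * (c * b)) ⟩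
      abs (1ℤ * y * a) ℕ.+ abs (x * (c * b)) ≡⟨ cong₂ ℕ._+_ (trans (abs-* (1ℤ * y) a) (cong (λ z → abs z ℕ.* abs a) (*-identityˡ y)))
                                               (trans (abs-* x (c * b)) (cong (abs x ℕ.*_) (abs-* c b))) ⟩
      abs y ℕ.* abs a ℕ.+ abs x ℕ.* (abs c ℕ.* abs b) ≤⟨ ℕ.+-monoʳ-≤ (abs y ℕ.* abs a) (ℕ.*-monoʳ-≤ (abs x) (ℕ.*-monoˡ-≤ (abs b) (proj₁ (abs-γ-≤ n)))) ⟩
      abs y ℕ.* abs a ℕ.+ abs x ℕ.* (ρ ℕ.* abs b) ≤⟨ ℕ.m≤m+n _ (abs y ℕ.* abs b ℕ.+ abs x ℕ.* ρ ℕ.* abs a) ⟩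
      abs y ℕ.* abs a ℕ.+ abs x ℕ.* (ρ ℕ.* abs b) ℕ.+ (abs y ℕ.* abs b ℕ.+ abs x ℕ.* ρ ℕ.* abs a) ≡⟨ lemma (abs x) (abs y) ρ (abs a) (abs b) ⟩
      (abs y ℕ.+ abs x ℕ.* ρ) ℕ.* (abs a ℕ.+ abs b) ∎
      where
      open ℕ.≤-Reasoning
      Δ = q 1ℤ R x y
      c = γ 1ℤ R n
      a = W 1ℤ R x y n
      b = W 1ℤ R x y (suc n)
      lemma : ∀ x y r a b → y ℕ.* a ℕ.+ x ℕ.* (r ℕ.* b) ℕ.+ (y ℕ.* b ℕ.+ x ℕ.* r ℕ.* a) ≡ (y ℕ.+ x ℕ.* r) ℕ.* (a ℕ.+ b)
      lemma = ℕ-Solver.solve-∀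

  -- Growth for complex roots.

  module Complex (R S : ℤ) (R≢0 : R ≢ 0ℤ) (m : ℕ) (disc : - (R * (R + + 4 * S)) ≡ + suc m) (2≤σ : 2 ℕ.≤ abs S) where

    open Recurrence S
    open Bounds R S R≢0

    -- Completing the square in 4 γ q. As R (R + 4S) is negative, both summands are nonnegative, and
    -- so the second is of order |S| ^ k at most.
    completed-square : ∀ k → ∃ λ A → A * A + + suc m * (L 1ℤ R k * L 1ℤ R k) ≡ + 4 * γ 1ℤ R k * (- S) ^ k
    completed-square k = A , (begin
      A * A + + suc m * (x * x)                          ≡⟨ cong (λ z → A * A + z * (x * x)) (sym disc) ⟩
      A * A + - (R * (R + + 4 * S)) * (x * x)            ≡⟨ cong (λ z → A * A + - (z * (z + + 4 * S)) * (x * x)) (sym (γ*γ′ k)) ⟩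
      A * A + - (c * c′ * (c * c′ + + 4 * S)) * (x * x)  ≡⟨ lemma c c′ S x y ⟩
      + 4 * c * q c c′ x y                               ≡⟨ cong (+ 4 * c *_) (trans (q-W 1ℤ R 0ℤ 1ℤ k) (lemma′ R S ((- S) ^ k))) ⟩
      + 4 * c * (- S) ^ k                                ∎)
      where
      open ≡-Reasoning
      c = γ 1ℤ R k
      c′ = γ R 1ℤ k
      x = L 1ℤ R k
      y = L 1ℤ R (suc k)
      A = + 2 * c * y - c * c′ * x
      lemma : ∀ c c′ S x y → (+ 2 * c * y - c * c′ * x) * (+ 2 * c * y - c * c′ * x) + - (c * c′ * (c * c′ + + 4 * S)) * (x * x)
        ≡ + 4 * c * (c * y * y - c * c′ * x * y - c′ * S * x * x)
      lemma = solve-∀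
      lemma′ : ∀ R S z → z * (1ℤ * 1ℤ * 1ℤ - 1ℤ * R * 0ℤ * 1ℤ - R * S * 0ℤ * 0ℤ) ≡ z
      lemma′ = solve-∀

    L-upper : ∀ k → sq (abs (L 1ℤ R k)) ℕ.≤ 4 ℕ.* ρ ℕ.* σ ℕ.^ k
    L-upper k = begin
      sq (abs x)                                ≤⟨ ℕ.m≤m+n _ (m ℕ.* sq (abs x)) ⟩
      suc m ℕ.* sq (abs x)                      ≤⟨ ℕ.m≤n+m _ (sq (abs A)) ⟩
      sq (abs A) ℕ.+ suc m ℕ.* sq (abs x)       ≡⟨ cong abs (trans (cong₂ _+_ (sym (sq-abs A)) (trans (pos-* (suc m) (sq (abs x))) (cong (+ suc m *_) (sym (sq-abs x))))) (proj₂ (completed-square k))) ⟩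
      abs (+ 4 * γ 1ℤ R k * (- S) ^ k)          ≡⟨ trans (abs-* (+ 4 * γ 1ℤ R k) ((- S) ^ k)) (cong₂ ℕ._*_ (abs-* (+ 4) (γ 1ℤ R k)) (trans (abs-^ (- S) k) (cong (ℕ._^ k) (∣-i∣≡∣i∣ S)))) ⟩
      4 ℕ.* abs (γ 1ℤ R k) ℕ.* σ ℕ.^ k          ≤⟨ ℕ.*-monoˡ-≤ (σ ℕ.^ k) (ℕ.*-monoʳ-≤ 4 (proj₁ (abs-γ-≤ k))) ⟩
      4 ℕ.* ρ ℕ.* σ ℕ.^ k                       ∎
      where
      open ℕ.≤-Reasoning
      x = L 1ℤ R k
      A = proj₁ (completed-square k)

    growth : ∀ x y → q 1ℤ R x y ≢ 0ℤ → Growth (λ n → abs (W 1ℤ R x y n)) (λ k → abs (L 1ℤ R k))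
    growth x y Δ≢0 = record
      -- For conjugate roots |α|² = |S|; with `g = 1`, the field `E-grow` asks exactly for |S| ≥ 2.
      { E = σ ℕ.^_
      ; g = 1
      ; C = C
      ; g≢0 = _
      ; E-zero = refl
      ; E-super = λ m n → ℕ.≤-reflexive (sym (ℕ.^-distribˡ-+-* σ m n))
      ; E-sub = λ m n → ℕ.≤-trans (ℕ.≤-reflexive (ℕ.^-distribˡ-+-* σ m n)) (ℕ.m≤m+n _ _)
      ; E-grow = λ n → ℕ.*-monoˡ-≤ (σ ℕ.^ n) 2≤σ
      ; lower = λ n → ℕ.≤-trans (power-lower x y Δ≢0 n) (ℕ.*-mono-≤ (ℕ.m≤m+n qBound (4 ℕ.* ρ)) (ℕ.≤-reflexive (sym (1^-* n _))))
      ; upper = λ k → ℕ.≤-trans (ℕ.≤-reflexive (1^-* k _)) (ℕ.≤-trans (L-upper k) (ℕ.*-monoˡ-≤ (σ ℕ.^ k) (ℕ.m≤n+m (4 ℕ.* ρ) qBound)))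
      }
      where
      C = qBound ℕ.+ 4 ℕ.* ρ
      1^-* : ∀ n z → 1 ℕ.^ n ℕ.* z ≡ z
      1^-* n z = trans (cong (ℕ._* z) (ℕ.^-zeroˡ n)) (ℕ.*-identityˡ z)

  -- (π + √η)^n = X n + Y n √η
  module Pell (π η : ℕ) where

    X Y : ℕ → ℕ
    X zero = 1
    X (suc n) = π ℕ.* X n ℕ.+ η ℕ.* Y n
    Y zero = 0
    Y (suc n) = X n ℕ.+ π ℕ.* Y n

    XY-+ : ∀ m n → (X (m ℕ.+ n) ≡ X m ℕ.* X n ℕ.+ η ℕ.* (Y m ℕ.* Y n)) × (Y (m ℕ.+ n) ≡ X m ℕ.* Y n ℕ.+ Y m ℕ.* X n)
    XY-+ zero n = lemma₁ (X n) η , lemma₂ (Y n)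
      where lemma₁ : ∀ x e → x ≡ 1 ℕ.* x ℕ.+ e ℕ.* 0
            lemma₁ = ℕ-Solver.solve-∀
            lemma₂ : ∀ y → y ≡ 1 ℕ.* y ℕ.+ 0
            lemma₂ = ℕ-Solver.solve-∀
    XY-+ (suc m) n =
      trans (cong₂ (λ u v → π ℕ.* u ℕ.+ η ℕ.* v) (proj₁ (XY-+ m n)) (proj₂ (XY-+ m n))) (lemma₁ π η (X m) (X n) (Y m) (Y n)) ,
      trans (cong₂ (λ u v → u ℕ.+ π ℕ.* v) (proj₁ (XY-+ m n)) (proj₂ (XY-+ m n))) (lemma₂ π η (X m) (X n) (Y m) (Y n))
      where
      lemma₁ : ∀ p e a b c d → p ℕ.* (a ℕ.* b ℕ.+ e ℕ.* (c ℕ.* d)) ℕ.+ e ℕ.* (a ℕ.* d ℕ.+ c ℕ.* b) ≡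
        (p ℕ.* a ℕ.+ e ℕ.* c) ℕ.* b ℕ.+ e ℕ.* ((a ℕ.+ p ℕ.* c) ℕ.* d)
      lemma₁ = ℕ-Solver.solve-∀
      lemma₂ : ∀ p e a b c d → (a ℕ.* b ℕ.+ e ℕ.* (c ℕ.* d)) ℕ.+ p ℕ.* (a ℕ.* d ℕ.+ c ℕ.* b) ≡
        (p ℕ.* a ℕ.+ e ℕ.* c) ℕ.* d ℕ.+ (a ℕ.+ p ℕ.* c) ℕ.* b
      lemma₂ = ℕ-Solver.solve-∀

    -- Multiplicativity of the norm X² - η Y², which is `k` at π + √η.
    norm : ∀ k → sq π ≡ η ℕ.+ k → ∀ n → sq (X n) ≡ η ℕ.* sq (Y n) ℕ.+ k ℕ.^ n
    norm k eq zero = lemma η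
      where lemma : ∀ e → 1 ≡ e ℕ.* 0 ℕ.+ 1
            lemma = ℕ-Solver.solve-∀
    norm k eq (suc n) = begin
      sq (π ℕ.* x ℕ.+ η ℕ.* y)                                              ≡⟨ lemma₁ π η x y ⟩
      sq π ℕ.* sq x ℕ.+ 2 ℕ.* π ℕ.* η ℕ.* x ℕ.* y ℕ.+ η ℕ.* η ℕ.* sq y       ≡⟨ cong (λ z → z ℕ.* sq x ℕ.+ 2 ℕ.* π ℕ.* η ℕ.* x ℕ.* y ℕ.+ η ℕ.* η ℕ.* sq y) eq ⟩
      (η ℕ.+ k) ℕ.* sq x ℕ.+ 2 ℕ.* π ℕ.* η ℕ.* x ℕ.* y ℕ.+ η ℕ.* η ℕ.* sq y  ≡⟨ lemma₂ π η k x y ⟩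
      η ℕ.* sq x ℕ.+ 2 ℕ.* π ℕ.* η ℕ.* x ℕ.* y ℕ.+ η ℕ.* η ℕ.* sq y ℕ.+ k ℕ.* sq x
        ≡⟨ cong (λ z → η ℕ.* sq x ℕ.+ 2 ℕ.* π ℕ.* η ℕ.* x ℕ.* y ℕ.+ η ℕ.* η ℕ.* sq y ℕ.+ k ℕ.* z) (norm k eq n) ⟩
      η ℕ.* sq x ℕ.+ 2 ℕ.* π ℕ.* η ℕ.* x ℕ.* y ℕ.+ η ℕ.* η ℕ.* sq y ℕ.+ k ℕ.* (η ℕ.* sq y ℕ.+ k ℕ.^ n)
        ≡⟨ lemma₃ π η k x y (k ℕ.^ n) ⟩
      η ℕ.* (sq x ℕ.+ 2 ℕ.* π ℕ.* x ℕ.* y ℕ.+ (η ℕ.+ k) ℕ.* sq y) ℕ.+ k ℕ.* k ℕ.^ n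
        ≡⟨ cong (λ z → η ℕ.* (sq x ℕ.+ 2 ℕ.* π ℕ.* x ℕ.* y ℕ.+ z ℕ.* sq y) ℕ.+ k ℕ.* k ℕ.^ n) (sym eq) ⟩
      η ℕ.* (sq x ℕ.+ 2 ℕ.* π ℕ.* x ℕ.* y ℕ.+ sq π ℕ.* sq y) ℕ.+ k ℕ.* k ℕ.^ n
        ≡⟨ cong (λ z → η ℕ.* z ℕ.+ k ℕ.* k ℕ.^ n) (lemma₄ π x y) ⟩
      η ℕ.* sq (x ℕ.+ π ℕ.* y) ℕ.+ k ℕ.* k ℕ.^ n ∎
      where
      open ≡-Reasoning
      x = X n
      y = Y n
      lemma₁ : ∀ p e x y → (p ℕ.* x ℕ.+ e ℕ.* y) ℕ.* (p ℕ.* x ℕ.+ e ℕ.* y) ≡ p ℕ.* p ℕ.* (x ℕ.* x) ℕ.+ 2 ℕ.* p ℕ.* e ℕ.* x ℕ.* y ℕ.+ e ℕ.* e ℕ.* (y ℕ.* y)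
      lemma₁ = ℕ-Solver.solve-∀
      lemma₂ : ∀ p e k x y → (e ℕ.+ k) ℕ.* (x ℕ.* x) ℕ.+ 2 ℕ.* p ℕ.* e ℕ.* x ℕ.* y ℕ.+ e ℕ.* e ℕ.* (y ℕ.* y) ≡
        e ℕ.* (x ℕ.* x) ℕ.+ 2 ℕ.* p ℕ.* e ℕ.* x ℕ.* y ℕ.+ e ℕ.* e ℕ.* (y ℕ.* y) ℕ.+ k ℕ.* (x ℕ.* x)
      lemma₂ = ℕ-Solver.solve-∀
      lemma₃ : ∀ p e k x y t → e ℕ.* (x ℕ.* x) ℕ.+ 2 ℕ.* p ℕ.* e ℕ.* x ℕ.* y ℕ.+ e ℕ.* e ℕ.* (y ℕ.* y) ℕ.+ k ℕ.* (e ℕ.* (y ℕ.* y) ℕ.+ t) ≡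
        e ℕ.* (x ℕ.* x ℕ.+ 2 ℕ.* p ℕ.* x ℕ.* y ℕ.+ (e ℕ.+ k) ℕ.* (y ℕ.* y)) ℕ.+ k ℕ.* t
      lemma₃ = ℕ-Solver.solve-∀
      lemma₄ : ∀ p x y → x ℕ.* x ℕ.+ 2 ℕ.* p ℕ.* x ℕ.* y ℕ.+ p ℕ.* p ℕ.* (y ℕ.* y) ≡ (x ℕ.+ p ℕ.* y) ℕ.* (x ℕ.+ p ℕ.* y)
      lemma₄ = ℕ-Solver.solve-∀

    -- By `norm`, √η Y ≤ X; hence the second summand of `X (m + n)` is at most the first, which
    -- explains the factor 2 in `E-sub`.
    ηYY≤XX : ∀ k → sq π ≡ η ℕ.+ k → ∀ m n → η ℕ.* (Y m ℕ.* Y n) ℕ.≤ X m ℕ.* X n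
    ηYY≤XX k eq m n = sq-cancel-≤ _ _ (begin
      sq (η ℕ.* (Y m ℕ.* Y n))               ≡⟨ lemma₁ η (Y m) (Y n) ⟩
      (η ℕ.* sq (Y m)) ℕ.* (η ℕ.* sq (Y n))  ≤⟨ ℕ.*-mono-≤ (le m) (le n) ⟩
      sq (X m) ℕ.* sq (X n)                  ≡⟨ lemma₂ (X m) (X n) ⟩
      sq (X m ℕ.* X n)                       ∎)
      where
      open ℕ.≤-Reasoning
      le : ∀ n → η ℕ.* sq (Y n) ℕ.≤ sq (X n)
      le n = ℕ.≤-trans (ℕ.m≤m+n _ _) (ℕ.≤-reflexive (sym (norm k eq n)))
      lemma₁ : ∀ e a b → (e ℕ.* (a ℕ.* b)) ℕ.* (e ℕ.* (a ℕ.* b)) ≡ (e ℕ.* (a ℕ.* a)) ℕ.* (e ℕ.* (b ℕ.* b))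
      lemma₁ = ℕ-Solver.solve-∀
      lemma₂ : ∀ a b → a ℕ.* a ℕ.* (b ℕ.* b) ≡ (a ℕ.* b) ℕ.* (a ℕ.* b)
      lemma₂ = ℕ-Solver.solve-∀

    power≤X : ∀ t → sq π ≡ η ℕ.+ sq t → ∀ n → t ℕ.^ n ℕ.≤ X n
    power≤X t eq n = sq-cancel-≤ _ _ (begin
      sq (t ℕ.^ n)                      ≡⟨ sym (^-distribʳ-* t t n) ⟩
      sq t ℕ.^ n                        ≤⟨ ℕ.m≤n+m _ _ ⟩
      η ℕ.* sq (Y n) ℕ.+ sq t ℕ.^ n     ≡⟨ sym (norm (sq t) eq n) ⟩
      sq (X n)                          ∎)
      where open ℕ.≤-Reasoning

  -- Growth for real roots.

  module Real (R S : ℤ) (R≢0 : R ≢ 0ℤ) (S≢0 : S ≢ 0ℤ) (δ π : ℕ) (D≡δ : R + + 4 * S ≡ + suc δ) (R≡ρ : R ≡ + abs R)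
    (P≡π : R + + 2 * S ≡ + π) where

    open Recurrence S
    open Bounds R S R≢0

    -- For the roots of x² - √R x - S, with α the larger in absolute value, 2α² = π + √η and 2β² = π
    -- - √η; their product is (2S)².
    η : ℕ
    η = ρ ℕ.* suc δ

    open Pell π η

    η≡ : + η ≡ R * (R + + 4 * S)
    η≡ = trans (pos-* ρ (suc δ)) (cong₂ _*_ (sym R≡ρ) (sym D≡δ))

    π²≡ : sq π ≡ η ℕ.+ sq (2 ℕ.* σ)
    π²≡ = +-injective (begin
      + sq π                                      ≡⟨ pos-* π π ⟩
      + π * + π                                   ≡⟨ cong₂ _*_ (sym P≡π) (sym P≡π) ⟩
      (R + + 2 * S) * (R + + 2 * S)               ≡⟨ lemma R S ⟩
      R * (R + + 4 * S) + (+ 2 * S) * (+ 2 * S)   ≡⟨ cong₂ _+_ (sym η≡) (trans (sq-abs (+ 2 * S)) (cong (λ z → + sq z) (abs-* (+ 2) S))) ⟩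
      + η + + sq (2 ℕ.* σ)                        ≡⟨ sym (pos-+ η (sq (2 ℕ.* σ))) ⟩
      + (η ℕ.+ sq (2 ℕ.* σ))                      ∎)
      where
      open ≡-Reasoning
      lemma : ∀ R S → (R + + 2 * S) * (R + + 2 * S) ≡ R * (R + + 4 * S) + (+ 2 * S) * (+ 2 * S)
      lemma = solve-∀

    3≤π : 3 ℕ.≤ π
    3≤π with 3 ℕ.≤? π
    ... | yes h = h
    ... | no h = ⊥-elim (ℕ.<⇒≱ (ℕ.≤-trans 5≤ (ℕ.≤-reflexive (sym π²≡))) (ℕ.*-mono-≤ π≤2 π≤2))
      where
      π≤2 : π ℕ.≤ 2
      π≤2 = ℕ.≤-pred (ℕ.≰⇒> h)
      2≤2σ : 2 ℕ.≤ 2 ℕ.* σ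
      2≤2σ = ℕ.*-monoʳ-≤ 2 (≢0⇒abs≥1 S S≢0)
      5≤ : 5 ℕ.≤ η ℕ.+ sq (2 ℕ.* σ)
      5≤ = ℕ.+-mono-≤ (ℕ.*-mono-≤ 1≤ρ (ℕ.s≤s (ℕ.z≤n {δ}))) (ℕ.*-mono-≤ 2≤2σ 2≤2σ)

    -- Along the fundamental solution this is α^(2n) + β^(2n), written as (α^n - β^n)² + 2(αβ)^n.
    -- The factor `c′` fits both phases: (α - β)² = R + 4S for odd `n`, and (α² - β²)² = R (R + 4S)
    -- for even `n`.
    Z : ℤ → ℤ → ℤ → ℤ → ℤ
    Z c c′ x y = (c * c′ + + 4 * S) * c′ * x * x + + 2 * q c c′ x y

    -- The numbers α² and β² have sum R + 2S and product S², which is the recurrence `second`.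
    -- Scaling by 2 ^ n turns them into π ± √η, and the first two values fix the coordinates with
    -- respect to `X` and `Y`.
    Z-W : ∀ c c′ x y n → + π ≡ c * c′ + + 2 * S → + η ≡ c * c′ * (c * c′ + + 4 * S) →
      (+ 2) ^ n * Z (γ c c′ n) (γ c′ c n) (W c c′ x y n) (W c c′ x y (suc n)) ≡
      Z c c′ x y * + X n + (+ 2 * Z c′ c y (c * y + S * x) - + π * Z c c′ x y) * + Y n
    Z-W c c′ x y zero eqπ eqη = trans (cong₂ (λ u v → 1ℤ * Z c c′ u v) (W-zero c c′ x y) (W-one c c′ x y))
        (lemma (Z c c′ x y) (+ 2 * Z c′ c y (c * y + S * x) - + π * Z c c′ x y))
      where lemma : ∀ z t → 1ℤ * z ≡ z * 1ℤ + t * 0ℤ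
            lemma = solve-∀
    Z-W c c′ x y (suc n) eqπ eqη = begin
      (+ 2) ^ suc n * Z (γ c′ c n) (γ c c′ n) (W c c′ x y (suc n)) (W c c′ x y (suc (suc n)))
        ≡⟨ cong₂ (λ u v → (+ 2) ^ suc n * Z (γ c′ c n) (γ c c′ n) u v) (W-suc c c′ x y n) (W-suc c c′ x y (suc n)) ⟩
      + 2 * (+ 2) ^ n * Z (γ c′ c n) (γ c c′ n) (W c′ c y y′ n) (W c′ c y y′ (suc n))
        ≡⟨ *-assoc (+ 2) ((+ 2) ^ n) _ ⟩
      + 2 * ((+ 2) ^ n * Z (γ c′ c n) (γ c c′ n) (W c′ c y y′ n) (W c′ c y y′ (suc n)))
        ≡⟨ cong (+ 2 *_) (Z-W c′ c y y′ n (trans eqπ (cong (_+ + 2 * S) (*-comm c c′))) (trans eqη (cong (λ z → z * (z + + 4 * S)) (*-comm c c′)))) ⟩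
      + 2 * (Z⁺ * a + (+ 2 * Z c c′ y′ (c′ * y′ + S * y) - + π * Z⁺) * b)
        ≡⟨ cong (λ z → + 2 * (Z⁺ * a + (+ 2 * z - + π * Z⁺) * b)) (second c c′ S x y) ⟩
      + 2 * (Z⁺ * a + (+ 2 * ((c * c′ + + 2 * S) * Z⁺ - S * S * Z₀) - + π * Z⁺) * b)
        ≡⟨ cong (λ z → + 2 * (Z⁺ * a + (+ 2 * ((c * c′ + + 2 * S) * Z⁺ - S * S * Z₀) - z * Z⁺) * b)) eqπ ⟩
      + 2 * (Z⁺ * a + (+ 2 * ((c * c′ + + 2 * S) * Z⁺ - S * S * Z₀) - (c * c′ + + 2 * S) * Z⁺) * b)
        ≡⟨ combine (c * c′) S Z₀ Z⁺ a b ⟩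
      Z₀ * ((c * c′ + + 2 * S) * a + c * c′ * (c * c′ + + 4 * S) * b) + (+ 2 * Z⁺ - (c * c′ + + 2 * S) * Z₀) * (a + (c * c′ + + 2 * S) * b)
        ≡⟨ cong₂ (λ u v → Z₀ * (u * a + v * b) + (+ 2 * Z⁺ - u * Z₀) * (a + u * b)) (sym eqπ) (sym eqη) ⟩
      Z₀ * (+ π * a + + η * b) + (+ 2 * Z⁺ - + π * Z₀) * (a + + π * b)
        ≡⟨ sym (cong₂ (λ u v → Z₀ * u + (+ 2 * Z⁺ - + π * Z₀) * v) castX castY) ⟩
      Z₀ * + X (suc n) + (+ 2 * Z⁺ - + π * Z₀) * + Y (suc n) ∎
      where
      open ≡-Reasoning
      y′ = c * y + S * x
      Z₀ = Z c c′ x y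
      Z⁺ = Z c′ c y y′
      a = + X n
      b = + Y n
      castX : + X (suc n) ≡ + π * a + + η * b
      castX = trans (pos-+ (π ℕ.* X n) (η ℕ.* Y n)) (cong₂ _+_ (pos-* π (X n)) (pos-* η (Y n)))
      castY : + Y (suc n) ≡ a + + π * b
      castY = trans (pos-+ (X n) (π ℕ.* Y n)) (cong (λ z → a + z) (pos-* π (Y n)))
      second : ∀ c c′ S x y → let
          z = λ c c′ x y → (c * c′ + + 4 * S) * c′ * x * x + + 2 * (c * y * y - c * c′ * x * y - c′ * S * x * x)
        in z c c′ (c * y + S * x) (c′ * (c * y + S * x) + S * y) ≡ (c * c′ + + 2 * S) * z c′ c y (c * y + S * x) - S * S * z c c′ x y
      second = solve-∀
      combine : ∀ R S z t a b → + 2 * (t * a + (+ 2 * ((R + + 2 * S) * t - S * S * z) - (R + + 2 * S) * t) * b) ≡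
        z * ((R + + 2 * S) * a + R * (R + + 4 * S) * b) + (+ 2 * t - (R + + 2 * S) * z) * (a + (R + + 2 * S) * b)
      combine = solve-∀

    -- Both sides are (2α²)^k + (2β²)^k: here `Z` starts with 2 and R + 2S, so the coordinate at `Y`
    -- vanishes.
    L-identity : ∀ k → (+ 2) ^ k * (+ suc δ * γ R 1ℤ k * L 1ℤ R k * L 1ℤ R k) + + 2 * ((+ 2) ^ k * (- S) ^ k) ≡ + 2 * + X k
    L-identity k = begin
      (+ 2) ^ k * (+ suc δ * c′ * x * x) + + 2 * ((+ 2) ^ k * (- S) ^ k)
        ≡⟨ cong (λ z → (+ 2) ^ k * (z * c′ * x * x) + + 2 * ((+ 2) ^ k * (- S) ^ k)) (sym (trans (cong (_+ + 4 * S) (γ*γ′ k)) D≡δ)) ⟩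
      (+ 2) ^ k * ((c * c′ + + 4 * S) * c′ * x * x) + + 2 * ((+ 2) ^ k * (- S) ^ k)
        ≡⟨ collect ((+ 2) ^ k) ((c * c′ + + 4 * S) * c′ * x * x) ((- S) ^ k) R S ⟩
      (+ 2) ^ k * ((c * c′ + + 4 * S) * c′ * x * x + + 2 * ((- S) ^ k * q 1ℤ R 0ℤ 1ℤ))
        ≡⟨ cong (λ z → (+ 2) ^ k * ((c * c′ + + 4 * S) * c′ * x * x + + 2 * z)) (sym (q-W 1ℤ R 0ℤ 1ℤ k)) ⟩
      (+ 2) ^ k * Z c c′ x (L 1ℤ R (suc k))
        ≡⟨ Z-W 1ℤ R 0ℤ 1ℤ k eqπ eqη ⟩
      Z 1ℤ R 0ℤ 1ℤ * + X k + (+ 2 * Z R 1ℤ 1ℤ (1ℤ * 1ℤ + S * 0ℤ) - + π * Z 1ℤ R 0ℤ 1ℤ) * + Y k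
        ≡⟨ cong (λ z → Z 1ℤ R 0ℤ 1ℤ * + X k + (+ 2 * Z R 1ℤ 1ℤ (1ℤ * 1ℤ + S * 0ℤ) - z * Z 1ℤ R 0ℤ 1ℤ) * + Y k) (sym P≡π) ⟩
      Z 1ℤ R 0ℤ 1ℤ * + X k + (+ 2 * Z R 1ℤ 1ℤ (1ℤ * 1ℤ + S * 0ℤ) - (R + + 2 * S) * Z 1ℤ R 0ℤ 1ℤ) * + Y k
        ≡⟨ evaluate R S (+ X k) (+ Y k) ⟩
      + 2 * + X k ∎
      where
      open ≡-Reasoning
      c = γ 1ℤ R k
      c′ = γ R 1ℤ k
      x = L 1ℤ R k
      eqπ : + π ≡ 1ℤ * R + + 2 * S
      eqπ = trans (sym P≡π) (cong (_+ + 2 * S) (sym (*-identityˡ R)))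
      eqη : + η ≡ 1ℤ * R * (1ℤ * R + + 4 * S)
      eqη = trans η≡ (cong (λ z → z * (z + + 4 * S)) (sym (*-identityˡ R)))
      collect : ∀ t a s R S → t * a + + 2 * (t * s) ≡ t * (a + + 2 * (s * (1ℤ * 1ℤ * 1ℤ - 1ℤ * R * 0ℤ * 1ℤ - R * S * 0ℤ * 0ℤ)))
      collect = solve-∀
      evaluate : ∀ R S a b → let
          z = λ c c′ x y → (c * c′ + + 4 * S) * c′ * x * x + + 2 * (c * y * y - c * c′ * x * y - c′ * S * x * x)
        in z 1ℤ R 0ℤ 1ℤ * a + (+ 2 * z R 1ℤ 1ℤ (1ℤ * 1ℤ + S * 0ℤ) - (R + + 2 * S) * z 1ℤ R 0ℤ 1ℤ) * b ≡ + 2 * a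
      evaluate = solve-∀

    abs-main : ∀ k → abs ((+ 2) ^ k * (+ suc δ * γ R 1ℤ k * L 1ℤ R k * L 1ℤ R k)) ≡ 2 ℕ.^ k ℕ.* (suc δ ℕ.* abs (γ R 1ℤ k) ℕ.* sq (abs (L 1ℤ R k)))
    abs-main k = trans (abs-* ((+ 2) ^ k) (d * c′ * x * x)) (cong₂ ℕ._*_ (abs-^ (+ 2) k)
        (trans (abs-* (d * c′ * x) x) (trans (cong (ℕ._* abs x) (trans (abs-* (d * c′) x) (cong (ℕ._* abs x) (abs-* d c′))))
          (ℕ.*-assoc (suc δ ℕ.* abs c′) (abs x) (abs x)))))
      where
      d = + suc δ
      c′ = γ R 1ℤ k
      x = L 1ℤ R k

    abs-error : ∀ k → abs (+ 2 * ((+ 2) ^ k * (- S) ^ k)) ≡ 2 ℕ.* (2 ℕ.^ k ℕ.* σ ℕ.^ k)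
    abs-error k = trans (abs-* (+ 2) ((+ 2) ^ k * (- S) ^ k)) (cong (2 ℕ.*_) (trans (abs-* ((+ 2) ^ k) ((- S) ^ k))
      (cong₂ ℕ._*_ (abs-^ (+ 2) k) (trans (abs-^ (- S) k) (cong (ℕ._^ k) (∣-i∣≡∣i∣ S))))))

    L-upper : ∀ k → 2 ℕ.^ k ℕ.* sq (abs (L 1ℤ R k)) ℕ.≤ 4 ℕ.* X k
    L-upper k = begin
      2 ℕ.^ k ℕ.* sq (abs x)                             ≤⟨ ℕ.*-monoʳ-≤ (2 ℕ.^ k) (ℕ.m≤n*m (sq (abs x)) (suc δ ℕ.* abs (γ R 1ℤ k)) {{nz}}) ⟩
      2 ℕ.^ k ℕ.* (suc δ ℕ.* abs (γ R 1ℤ k) ℕ.* sq (abs x)) ≡⟨ sym (abs-main k) ⟩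
      abs main                                           ≡⟨ cong abs (trans (shift main error) (cong (_- error) (L-identity k))) ⟩
      abs (+ 2 * + X k - error)                          ≤⟨ ∣i-j∣≤∣i∣+∣j∣ (+ 2 * + X k) error ⟩
      abs (+ 2 * + X k) ℕ.+ abs error                    ≡⟨ cong₂ ℕ._+_ (abs-* (+ 2) (+ X k)) (trans (abs-error k) (cong (2 ℕ.*_) (sym (^-distribʳ-* 2 σ k)))) ⟩
      2 ℕ.* X k ℕ.+ 2 ℕ.* (2 ℕ.* σ) ℕ.^ k                ≤⟨ ℕ.+-monoʳ-≤ (2 ℕ.* X k) (ℕ.*-monoʳ-≤ 2 (power≤X (2 ℕ.* σ) π²≡ k)) ⟩
      2 ℕ.* X k ℕ.+ 2 ℕ.* X k                            ≡⟨ double (X k) ⟩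
      4 ℕ.* X k                                          ∎
      where
      open ℕ.≤-Reasoning
      x = L 1ℤ R k
      main = (+ 2) ^ k * (+ suc δ * γ R 1ℤ k * x * x)
      error = + 2 * ((+ 2) ^ k * (- S) ^ k)
      nz = ℕ.m*n≢0 (suc δ) (abs (γ R 1ℤ k)) {{_}} {{ℕ.>-nonZero (1≤abs-γ′ k)}}
      shift : ∀ a b → a ≡ a + b - b
      shift = solve-∀
      double : ∀ x → 2 ℕ.* x ℕ.+ 2 ℕ.* x ≡ 4 ℕ.* x
      double = ℕ-Solver.solve-∀

    X-≤ : ∀ k → X k ℕ.≤ 2 ℕ.^ k ℕ.* (suc δ ℕ.* ρ ℕ.* sq (abs (L 1ℤ R k)) ℕ.+ 2 ℕ.* σ ℕ.^ k)
    X-≤ k = begin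
      X k                                ≤⟨ ℕ.m≤n*m (X k) 2 ⟩
      2 ℕ.* X k                          ≡⟨ sym (abs-* (+ 2) (+ X k)) ⟩
      abs (+ 2 * + X k)                  ≡⟨ cong abs (sym (L-identity k)) ⟩
      abs (main + error)                 ≤⟨ ∣i+j∣≤∣i∣+∣j∣ main error ⟩
      abs main ℕ.+ abs error             ≡⟨ cong₂ ℕ._+_ (abs-main k) (abs-error k) ⟩
      t ℕ.* (suc δ ℕ.* abs (γ R 1ℤ k) ℕ.* sq (abs x)) ℕ.+ 2 ℕ.* (t ℕ.* σ ℕ.^ k)
        ≤⟨ ℕ.+-monoˡ-≤ _ (ℕ.*-monoʳ-≤ t (ℕ.*-monoˡ-≤ (sq (abs x)) (ℕ.*-monoʳ-≤ (suc δ) (proj₂ (abs-γ-≤ k))))) ⟩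
      t ℕ.* (suc δ ℕ.* ρ ℕ.* sq (abs x)) ℕ.+ 2 ℕ.* (t ℕ.* σ ℕ.^ k)
        ≡⟨ factor t (suc δ ℕ.* ρ ℕ.* sq (abs x)) (σ ℕ.^ k) ⟩
      t ℕ.* (suc δ ℕ.* ρ ℕ.* sq (abs x) ℕ.+ 2 ℕ.* σ ℕ.^ k) ∎
      where
      open ℕ.≤-Reasoning
      x = L 1ℤ R k
      t = 2 ℕ.^ k
      main = (+ 2) ^ k * (+ suc δ * γ R 1ℤ k * x * x)
      error = + 2 * ((+ 2) ^ k * (- S) ^ k)
      factor : ∀ t a b → t ℕ.* a ℕ.+ 2 ℕ.* (t ℕ.* b) ≡ t ℕ.* (a ℕ.+ 2 ℕ.* b)
      factor = ℕ-Solver.solve-∀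

    module _ (x y : ℤ) (Δ≢0 : q 1ℤ R x y ≢ 0ℤ) where

      s : ℕ → ℕ
      s n = sq (abs (W 1ℤ R x y n)) ℕ.+ sq (abs (W 1ℤ R x y (suc n)))

      M M′ C₀ C : ℕ
      M = 2 ℕ.* sq (abs y ℕ.+ abs x ℕ.* ρ)
      M′ = 2 ℕ.* sq (ρ ℕ.+ σ)
      C₀ = suc δ ℕ.* ρ ℕ.* M ℕ.+ 2 ℕ.* (qBound ℕ.* (M ℕ.+ M ℕ.* (1 ℕ.+ M′)))
      C = C₀ ℕ.+ 4

      L²≤ : ∀ n → sq (abs (L 1ℤ R n)) ℕ.≤ M ℕ.* s n
      L²≤ n = sq-combination-≤ (abs y ℕ.+ abs x ℕ.* ρ) (abs (W 1ℤ R x y n)) (abs (W 1ℤ R x y (suc n))) (L-≤ x y Δ≢0 n)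

      s-suc-≤ : ∀ n → s (suc n) ℕ.≤ (1 ℕ.+ M′) ℕ.* s n
      s-suc-≤ n = ℕ.+-mono-≤ (ℕ.m≤n+m _ _)
        (sq-combination-≤ (ρ ℕ.+ σ) (abs (W 1ℤ R x y n)) (abs (W 1ℤ R x y (suc n))) (next-≤ x y n))

      -- After `X-≤` the terms L² and |S| ^ n remain. The power is bounded by two squares of `L`
      -- through `power-lower`, and `L²≤` passes from `L` to the given solution; `s-suc-≤` brings
      -- the index `n + 1` back to `n`.
      X-lower : ∀ n → X n ℕ.≤ C ℕ.* (2 ℕ.^ n ℕ.* s n)
      X-lower n = begin
        X n                                           ≤⟨ X-≤ n ⟩
        t ℕ.* (d ℕ.* l ℕ.+ 2 ℕ.* σ ℕ.^ n)             ≤⟨ ℕ.*-monoʳ-≤ t (ℕ.+-mono-≤ (ℕ.*-monoʳ-≤ d (L²≤ n)) (ℕ.*-monoʳ-≤ 2 (ℕ.≤-trans (power-lower 0ℤ 1ℤ Δ₁≢0 n)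
                                                           (ℕ.*-monoʳ-≤ qBound (ℕ.+-mono-≤ (L²≤ n) (ℕ.≤-trans (L²≤ (suc n)) (ℕ.*-monoʳ-≤ M (s-suc-≤ n)))))))) ⟩
        t ℕ.* (d ℕ.* (M ℕ.* s n) ℕ.+ 2 ℕ.* (qBound ℕ.* (M ℕ.* s n ℕ.+ M ℕ.* ((1 ℕ.+ M′) ℕ.* s n))))
                                                      ≤⟨ ℕ.m≤m+n _ (4 ℕ.* (t ℕ.* s n)) ⟩
        t ℕ.* (d ℕ.* (M ℕ.* s n) ℕ.+ 2 ℕ.* (qBound ℕ.* (M ℕ.* s n ℕ.+ M ℕ.* ((1 ℕ.+ M′) ℕ.* s n)))) ℕ.+ 4 ℕ.* (t ℕ.* s n)
                                                      ≡⟨ factor t d M qBound M′ (s n) ⟩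
        C ℕ.* (t ℕ.* s n)                             ∎
        where
        open ℕ.≤-Reasoning
        t = 2 ℕ.^ n
        d = suc δ ℕ.* ρ
        l = sq (abs (L 1ℤ R n))
        one : ∀ R S → 1ℤ * 1ℤ * 1ℤ - 1ℤ * R * 0ℤ * 1ℤ - R * S * 0ℤ * 0ℤ ≡ 1ℤ
        one = solve-∀
        Δ₁≢0 : q 1ℤ R 0ℤ 1ℤ ≢ 0ℤ
        Δ₁≢0 eq with () ← trans (sym (one R S)) eq
        factor : ∀ t d M Q N s → t ℕ.* (d ℕ.* (M ℕ.* s) ℕ.+ 2 ℕ.* (Q ℕ.* (M ℕ.* s ℕ.+ M ℕ.* ((1 ℕ.+ N) ℕ.* s)))) ℕ.+ 4 ℕ.* (t ℕ.* s) ≡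
          (d ℕ.* M ℕ.+ 2 ℕ.* (Q ℕ.* (M ℕ.+ M ℕ.* (1 ℕ.+ N))) ℕ.+ 4) ℕ.* (t ℕ.* s)
        factor = ℕ-Solver.solve-∀

      growth : Growth (λ n → abs (W 1ℤ R x y n)) (λ k → abs (L 1ℤ R k))
      growth = record
        -- Since 2 X n = (2α²)^n + (2β²)^n, the integer `X n` agrees with (2α²)^n up to a factor 2;
        -- this is the reason for `g = 2`.
        { E = X
        ; g = 2
        ; C = C
        ; g≢0 = _
        ; E-zero = refl
        ; E-super = λ m n → ℕ.≤-trans (ℕ.m≤m+n _ _) (ℕ.≤-reflexive (sym (proj₁ (XY-+ m n))))
        ; E-sub = λ m n → ℕ.≤-trans (ℕ.≤-reflexive (proj₁ (XY-+ m n)))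
            (ℕ.+-monoʳ-≤ (X m ℕ.* X n) (ℕ.≤-trans (ηYY≤XX (sq (2 ℕ.* σ)) π²≡ m n) (ℕ.m≤m+n _ 0)))
        ; E-grow = λ n → ℕ.≤-trans (ℕ.*-monoˡ-≤ (X n) 3≤π) (ℕ.m≤m+n _ _)
        ; lower = X-lower
        ; upper = λ k → ℕ.≤-trans (L-upper k) (ℕ.*-monoˡ-≤ (X k) (ℕ.m≤n+m 4 C₀))
        }

  -- Rescaling `useq` to a Lehmer-type sequence.

  record Normalised (r s : ℤ) : Set where
    field
      -- In `normalise`, `suc d` is gcd (r², s), positive because `s` is nonzero.
      d : ℕ
      R S : ℤ
      r²≡ : r * r ≡ R * + suc d
      s≡ : s ≡ S * + suc d
      R⊥S : Coprime (abs R) (abs S)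

  normalise : ∀ r s → s ≢ 0ℤ → Normalised r s
  normalise r s s≢0 = go (gcd m n) refl
    where
    m = abs (r * r)
    n = abs s
    go : ∀ g → gcd m n ≡ g → Normalised r s
    go zero eq = ⊥-elim (s≢0 (∣i∣≡0⇒i≡0 (gcd[m,n]≡0⇒n≡0 m eq)))
    go (suc d) eq with ∣ᵤ⇒∣ {+ suc d} {r * r} (subst (ℕ._∣ m) eq (gcd[m,n]∣m m n)) | ∣ᵤ⇒∣ {+ suc d} {s} (subst (ℕ._∣ n) eq (gcd[m,n]∣n m n))
    ... | divides R r²≡ | divides S s≡ = record { d = d ; R = R ; S = S ; r²≡ = r²≡ ; s≡ = s≡ ; R⊥S = coprime }
      where
      coprime : Coprime (abs R) (abs S)
      coprime {i} (i∣R , i∣S) = ℕ.∣1⇒≡1 (ℕ.*-cancelʳ-∣ (suc d) (subst (i ℕ.* suc d ℕ.∣_) (trans eq (sym (ℕ.*-identityˡ (suc d))))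
        (gcd-greatest (subst (i ℕ.* suc d ℕ.∣_) (sym (trans (cong abs r²≡) (abs-* R (+ suc d)))) (ℕ.*-monoˡ-∣ (suc d) i∣R))
                      (subst (i ℕ.* suc d ℕ.∣_) (sym (trans (cong abs s≡) (abs-* S (+ suc d)))) (ℕ.*-monoˡ-∣ (suc d) i∣S)))))

  useq-shift : ∀ r s x y n → useq r s x y (suc n) ≡ useq r s y (r * y + s * x) n
  useq-shift r s x y zero = refl
  useq-shift r s x y (suc zero) = refl
  useq-shift r s x y (suc (suc n)) = cong₂ (λ a b → r * a + s * b) (useq-shift r s x y (suc n)) (useq-shift r s x y n)

  *-≢0 : ∀ {i j} → i ≢ 0ℤ → j ≢ 0ℤ → i * j ≢ 0ℤ
  *-≢0 {i} i≢0 j≢0 h = [ i≢0 , j≢0 ]′ (i*j≡0⇒i≡0∨j≡0 i h)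

  module Link {r s : ℤ} (norm : Normalised r s) where
    open Normalised norm
    open Recurrence S

    δ : ℤ
    δ = + suc d

    -- Two steps return to the same phase and multiply the scale `m` by `δ`, so the induction goes
    -- by twos and moves the starting pair; `k` is `δ` at even and `r` at odd indices.
    scaled : ∀ n x y X Y m → m ≢ 0ℤ → X * m ≡ δ * x → Y * m ≡ r * y →
      ∃ λ m′ → ∃ λ k → m′ ≢ 0ℤ × (k ≡ δ ⊎ k ≡ r) × W 1ℤ R X Y n * m′ ≡ k * useq r s x y n
    scaled zero x y X Y m m≢0 eqX eqY = m , δ , m≢0 , inj₁ refl , trans (cong (_* m) (W-zero 1ℤ R X Y)) eqX
    scaled (suc zero) x y X Y m m≢0 eqX eqY = m , r , m≢0 , inj₂ refl , trans (cong (_* m) (W-one 1ℤ R X Y)) eqY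
    scaled (suc (suc n)) x y X Y m m≢0 eqX eqY
      with scaled n z (r * z + s * y) Z (R * Z + S * Y) (m * δ) (*-≢0 m≢0 (λ ())) eqZ eqT
      where
      z = r * y + s * x
      Z = 1ℤ * Y + S * X
      open ≡-Reasoning
      eqZ : Z * (m * δ) ≡ δ * z
      eqZ = begin
        Z * (m * δ)                     ≡⟨ lemma₁ Y S X m δ ⟩
        δ * (Y * m) + S * δ * (X * m)   ≡⟨ cong₂ (λ a b → δ * a + S * δ * b) eqY eqX ⟩
        δ * (r * y) + S * δ * (δ * x)   ≡⟨ cong (λ t → δ * (r * y) + t * (δ * x)) (sym s≡) ⟩
        δ * (r * y) + s * (δ * x)       ≡⟨ lemma₂ δ r y s x ⟩
        δ * z                           ∎
        where
        lemma₁ : ∀ Y S X m δ → (1ℤ * Y + S * X) * (m * δ) ≡ δ * (Y * m) + S * δ * (X * m)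
        lemma₁ = solve-∀
        lemma₂ : ∀ δ r y s x → δ * (r * y) + s * (δ * x) ≡ δ * (r * y + s * x)
        lemma₂ = solve-∀
      eqT : (R * Z + S * Y) * (m * δ) ≡ r * (r * z + s * y)
      eqT = begin
        (R * Z + S * Y) * (m * δ)                                   ≡⟨ lemma₁ R S X Y m δ ⟩
        R * δ * (Y * m) + R * S * δ * (X * m) + S * δ * (Y * m)     ≡⟨ cong₂ (λ a b → R * δ * a + R * S * δ * b + S * δ * a) eqY eqX ⟩
        R * δ * (r * y) + R * S * δ * (δ * x) + S * δ * (r * y)     ≡⟨ lemma₂ R S δ r x y ⟩
        R * δ * (r * y) + R * δ * (S * δ) * x + S * δ * (r * y)     ≡⟨ cong₂ (λ a b → a * (r * y) + a * b * x + b * (r * y)) (sym r²≡) (sym s≡) ⟩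
        r * r * (r * y) + r * r * s * x + s * (r * y)               ≡⟨ lemma₃ r s x y ⟩
        r * (r * z + s * y)                                         ∎
        where
        lemma₁ : ∀ R S X Y m δ → (R * (1ℤ * Y + S * X) + S * Y) * (m * δ) ≡ R * δ * (Y * m) + R * S * δ * (X * m) + S * δ * (Y * m)
        lemma₁ = solve-∀
        lemma₂ : ∀ R S δ r x y → R * δ * (r * y) + R * S * δ * (δ * x) + S * δ * (r * y) ≡ R * δ * (r * y) + R * δ * (S * δ) * x + S * δ * (r * y)
        lemma₂ = solve-∀
        lemma₃ : ∀ r s x y → r * r * (r * y) + r * r * s * x + s * (r * y) ≡ r * (r * (r * y + s * x) + s * y)
        lemma₃ = solve-∀
    ... | m′ , k , m′≢0 , k-case , eq = m′ , k , m′≢0 , k-case ,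
        trans (cong (_* m′) (W-two+ 1ℤ R X Y n)) (trans eq (cong (k *_)
          (sym (trans (useq-shift r s x y (suc n)) (useq-shift r s y (r * y + s * x) n)))))

    W≈useq : ∀ x y n → ∃ λ m → ∃ λ k → m ≢ 0ℤ × (k ≡ δ ⊎ k ≡ r) × W 1ℤ R (δ * x) (r * y) n * m ≡ k * useq r s x y n
    W≈useq x y n = scaled n x y (δ * x) (r * y) 1ℤ (λ ()) (*-identityʳ (δ * x)) (*-identityʳ (r * y))

    -- For the starting values 0 and 1 the rescaled sequence is `r` times `L`, so a zero of `L`
    -- would be a zero of the Lucas sequence.
    L≢0 : r ≢ 0ℤ → (∀ k → 1 ℕ.≤ k → lucasU r s k ≢ 0ℤ) → ∀ k → L 1ℤ R (suc k) ≢ 0ℤ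
    L≢0 r≢0 U≢0 k L≡0 with W≈useq 0ℤ 1ℤ (suc k)
    ... | m , t , m≢0 , t-case , eq = *-≢0 (t≢0 t-case) (U≢0 (suc k) (ℕ.s≤s ℕ.z≤n)) (trans (sym eq) (cong (_* m) W≡0))
      where
      t≢0 : t ≡ δ ⊎ t ≡ r → t ≢ 0ℤ
      t≢0 (inj₁ refl) ()
      t≢0 (inj₂ refl) = r≢0
      W≡0 : W 1ℤ R (δ * 0ℤ) (r * 1ℤ) (suc k) ≡ 0ℤ
      W≡0 = trans (W-linear 1ℤ R (δ * 0ℤ) (r * 1ℤ) (suc k)) (trans (cong (λ l → δ * 0ℤ * G 1ℤ R (suc k) + r * 1ℤ * l) L≡0) (lemma δ r (G 1ℤ R (suc k))))
        where lemma : ∀ δ r g → δ * 0ℤ * g + r * 1ℤ * 0ℤ ≡ 0ℤ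
              lemma = solve-∀

    -- At `x = u₀`, `y = u₁` the last factor is (u₁ - α u₀)(u₁ - β u₀) = -ab (β - α)², with α and β
    -- the roots of x² - r x - s; this is where ab ≠ 0 enters.
    Δ≡ : ∀ x y → q 1ℤ R (δ * x) (r * y) ≡ r * r * (y * y - r * x * y - s * x * x)
    Δ≡ x y = begin
      q 1ℤ R (δ * x) (r * y)                                                ≡⟨ lemma₁ R S δ r x y ⟩
      r * r * (y * y) - R * δ * (r * x * y) - R * δ * (S * δ) * (x * x)     ≡⟨ cong₂ (λ a b → r * r * (y * y) - a * (r * x * y) - a * b * (x * x)) (sym r²≡) (sym s≡) ⟩
      r * r * (y * y) - r * r * (r * x * y) - r * r * s * (x * x)           ≡⟨ lemma₂ r s x y ⟩
      r * r * (y * y - r * x * y - s * x * x)                               ∎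
      where
      open ≡-Reasoning
      lemma₁ : ∀ R S δ r x y → 1ℤ * (r * y) * (r * y) - 1ℤ * R * (δ * x) * (r * y) - R * S * (δ * x) * (δ * x) ≡
        r * r * (y * y) - R * δ * (r * x * y) - R * δ * (S * δ) * (x * x)
      lemma₁ = solve-∀
      lemma₂ : ∀ r s x y → r * r * (y * y) - r * r * (r * x * y) - r * r * s * (x * x) ≡ r * r * (y * y - r * x * y - s * x * x)
      lemma₂ = solve-∀

  -- Degenerate cases and the choice between real and complex growth.

  opaque
    unfolding Recurrence.W

    -- For `S = -1` and `R` = 1, 2, 3 the quotient of the roots is a primitive root of unity of
    -- order 3, 4, 6, and `L` vanishes at that index.
    L₃≡0 : Recurrence.L -1ℤ 1ℤ 1ℤ 3 ≡ 0ℤ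
    L₃≡0 = refl

    L₄≡0 : Recurrence.L -1ℤ 1ℤ (+ 2) 4 ≡ 0ℤ
    L₄≡0 = refl

    L₆≡0 : Recurrence.L -1ℤ 1ℤ (+ 3) 6 ≡ 0ℤ
    L₆≡0 = refl

  -- By Kronecker's theorem |S| = 1 with a negative discriminant forces roots of unity; only R = 1, 2, 3 can occur.
  2≤∣S∣ : ∀ ρ S k → S ≢ 0ℤ → + suc ρ + + 4 * S ≡ -[1+ k ] → (∀ k → Recurrence.L S 1ℤ (+ suc ρ) (suc k) ≢ 0ℤ) → 2 ℕ.≤ abs S
  2≤∣S∣ ρ (+ zero) k S≢0 eq L≢0 = ⊥-elim (S≢0 refl)
  2≤∣S∣ ρ (+ suc zero) k S≢0 () L≢0
  2≤∣S∣ ρ (+ suc (suc n)) k S≢0 eq L≢0 = ℕ.s≤s (ℕ.s≤s ℕ.z≤n)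
  2≤∣S∣ 0 -[1+ zero ] k S≢0 eq L≢0 = ⊥-elim (L≢0 2 L₃≡0)
  2≤∣S∣ 1 -[1+ zero ] k S≢0 eq L≢0 = ⊥-elim (L≢0 3 L₄≡0)
  2≤∣S∣ 2 -[1+ zero ] k S≢0 eq L≢0 = ⊥-elim (L≢0 5 L₆≡0)
  2≤∣S∣ (suc (suc (suc ρ))) -[1+ zero ] k S≢0 () L≢0
  2≤∣S∣ ρ -[1+ suc n ] k S≢0 eq L≢0 = ℕ.s≤s (ℕ.s≤s ℕ.z≤n)

  growth : ∀ R ρ S → R ≡ + suc ρ → S ≢ 0ℤ → R + + 4 * S ≢ 0ℤ → (∀ k → Recurrence.L S 1ℤ R (suc k) ≢ 0ℤ) →
    ∀ x y → Recurrence.q S 1ℤ R x y ≢ 0ℤ →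
    Growth (λ n → abs (Recurrence.W S 1ℤ R x y n)) (λ k → abs (Recurrence.L S 1ℤ R k))
  growth R ρ S refl S≢0 D≢0 L≢0 x y Δ≢0 = by-discriminant (R + + 4 * S) refl
    where
    double : ∀ R S → + 2 * (R + + 2 * S) ≡ R + (R + + 4 * S)
    double = solve-∀
    real : ∀ δ → R + + 4 * S ≡ + suc δ → ∀ P → R + + 2 * S ≡ P →
      Growth (λ n → abs (Recurrence.W S 1ℤ R x y n)) (λ k → abs (Recurrence.L S 1ℤ R k))
    real δ D≡δ (+ π) P≡π = Real.growth R S (λ ()) S≢0 δ π D≡δ refl P≡π x y Δ≢0
    -- Impossible, as 2 (R + 2S) is the sum of the positive numbers `R` and `R + 4S`.
    real δ D≡δ -[1+ k ] P≡ with () ← trans (sym (cong (+ 2 *_) P≡)) (trans (double R S) (cong (λ z → R + z) D≡δ))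
    by-discriminant : ∀ D → R + + 4 * S ≡ D → Growth (λ n → abs (Recurrence.W S 1ℤ R x y n)) (λ k → abs (Recurrence.L S 1ℤ R k))
    by-discriminant (+ zero) eq = ⊥-elim (D≢0 eq)
    by-discriminant (+ suc δ) eq = real δ eq (R + + 2 * S) refl
    -- The number given for `m` comes from (ρ + 1)(k + 1) = 1 + (k + ρ (k + 1)).
    by-discriminant -[1+ k ] eq = Complex.growth R S (λ ()) (k ℕ.+ ρ ℕ.* suc k) (cong (λ z → - (R * z)) eq)
      (2≤∣S∣ ρ S k S≢0 eq L≢0) x y Δ≢0

  -- The product of the nonzero terms, and the final assembly.

  prodNZ≢0 : ∀ u N → prodNZ u N ≢ 0ℤ
  prodNZ≢0 u zero ()
  prodNZ≢0 u (suc N) with u (suc N) ≟ 0ℤ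
  ... | yes _ = prodNZ≢0 u N
  ... | no u≢0 = *-≢0 u≢0 (prodNZ≢0 u N)

  term∣prodNZ : ∀ u N n → 1 ℕ.≤ n → n ℕ.≤ N → u n ≢ 0ℤ → abs (u n) ℕ.∣ abs (prodNZ u N)
  term∣prodNZ u zero n 1≤n n≤N u≢0 = ⊥-elim (ℕ.<⇒≱ 1≤n n≤N)
  term∣prodNZ u (suc N) n 1≤n n≤N u≢0 with u (suc N) ≟ 0ℤ | ℕ.m≤n⇒m<n∨m≡n n≤N
  ... | yes z | inj₂ refl = ⊥-elim (u≢0 z)
  ... | yes z | inj₁ n<N = term∣prodNZ u N n 1≤n (ℕ.≤-pred n<N) u≢0
  ... | no _ | inj₂ refl = subst (abs (u n) ℕ.∣_) (sym (abs-* (u n) (prodNZ u N))) (ℕ.m∣m*n _)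
  ... | no _ | inj₁ n<N = subst (abs (u n) ℕ.∣_) (sym (abs-* (u (suc N)) (prodNZ u N)))
        (ℕ.∣n⇒∣m*n (abs (u (suc N))) (term∣prodNZ u N n 1≤n (ℕ.≤-pred n<N) u≢0))

  -- The Lucas number at index 2 is `r`; `r = 0` would mean α/β = -1.
  r≢0 : ∀ r s → (∀ k → 1 ℕ.≤ k → lucasU r s k ≢ 0ℤ) → r ≢ 0ℤ
  r≢0 r s U≢0 refl = U≢0 2 (ℕ.s≤s ℕ.z≤n) (cong (λ z → 0ℤ * 1ℤ + z) (*-zeroʳ s))

  module Main (r s u₀ u₁ : ℤ) (D≢0 : r * r + + 4 * s ≢ 0ℤ) (s≢0 : s ≢ 0ℤ) (r≢0 : r ≢ 0ℤ)
    (U≢0 : ∀ k → 1 ℕ.≤ k → lucasU r s k ≢ 0ℤ) (norm : Normalised r s)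
    (Δ : ℤ) (q≡Δ : Recurrence.q (Normalised.S norm) 1ℤ (Normalised.R norm) (Link.δ norm * u₀) (r * u₁) ≡ Δ) (Δ≢0 : Δ ≢ 0ℤ) where

    open Normalised norm
    open Link norm
    open Recurrence S

    R-positive : ∃ λ ρ → R ≡ + suc ρ
    R-positive = go R refl
      where
      square : ∀ R′ → R ≡ R′ → + sq (abs r) ≡ R′ * δ
      square R′ eq = trans (sym (sq-abs r)) (trans r²≡ (cong (_* δ) eq))
      go : ∀ R′ → R ≡ R′ → ∃ λ ρ → R ≡ + suc ρ
      go (+ suc ρ) eq = ρ , eq
      go (+ zero) eq = ⊥-elim (*-≢0 r≢0 r≢0 (trans (sq-abs r) (square 0ℤ eq)))
      go -[1+ k ] eq with () ← square -[1+ k ] eq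

    R≢0 : R ≢ 0ℤ
    R≢0 eq with () ← trans (sym (proj₂ R-positive)) eq

    S≢0 : S ≢ 0ℤ
    S≢0 eq = s≢0 (trans s≡ (cong (_* δ) eq))

    R+4S≢0 : R + + 4 * S ≢ 0ℤ
    R+4S≢0 eq = D≢0 (trans (cong₂ (λ a b → a + + 4 * b) r²≡ s≡) (trans (lemma R S δ) (cong (_* δ) eq)))
      where lemma : ∀ R S δ → R * δ + + 4 * (S * δ) ≡ (R + + 4 * S) * δ
            lemma = solve-∀

    x₀ y₀ : ℤ
    x₀ = δ * u₀
    y₀ = r * u₁

    open Lehmer R S x₀ y₀ R⊥S R≢0 Δ q≡Δ Δ≢0 (L≢0 r≢0 U≢0)

    arithmetic : Arithmetic w ℓ
    arithmetic = record
      { growth = growth R (proj₁ R-positive) S (proj₂ R-positive) S≢0 R+4S≢0 (L≢0 r≢0 U≢0) x₀ y₀ (λ eq → Δ≢0 (trans (sym q≡Δ) eq))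
      ; n₀ = abs Δ
      ; κ = abs (Δ * R)
      ; κ≢0 = ℕ.>-nonZero (≢0⇒abs≥1 (Δ * R) (*-≢0 Δ≢0 R≢0))
      ; L≢0 = λ k → ℕ.>-nonZero (≢0⇒abs≥1 (L 1ℤ R (suc k)) (L≢0 r≢0 U≢0 k))
      ; L-additive = ℓ-additive
      ; common = common
      ; spread = spread
      }

    u : ℕ → ℤ
    u = useq r s u₀ u₁

    -- A common multiple of `δ` and `r`: a prime that divides `w n` but not `u n` divides one of
    -- them, hence is at most `dr`.
    dr : ℕ
    dr = suc d ℕ.* abs r

    -- Appending all numbers up to `dr` costs a constant independent of `N`, which becomes the
    -- `t = dr + 1` of the counting argument.
    candidates : ℕ → List ℕ
    candidates N = filter (λ p → prime? p ×-dec (p ℕ.∣? abs (prodNZ u N))) (upTo (suc (abs (prodNZ u N)))) ++ upTo (suc dr)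

    length-candidates : ∀ N → length (candidates N) ≡ ω (prodNZ u N) ℕ.+ suc dr
    length-candidates N = trans (length-++ (filter (λ p → prime? p ×-dec (p ℕ.∣? abs (prodNZ u N))) (upTo (suc (abs (prodNZ u N))))))
      (cong (ω (prodNZ u N) ℕ.+_) (length-upTo (suc dr)))

    covers : ∀ N n p → 1 ℕ.≤ n → n ℕ.≤ N → Prime p → p ℕ.∣ w n → ℕ.NonZero (w n) → p ∈ candidates N
    covers N n p 1≤n n≤N pr p∣w w≢0 with W≈useq u₀ u₁ n
    ... | m , k , m≢0 , k-case , eq = [ divides-k , divides-u ]′ (euclidsLemma (abs k) (abs (u n)) pr p∣ku)
      where
      p∣ku : p ℕ.∣ abs k ℕ.* abs (u n)
      p∣ku = subst (p ℕ.∣_) (trans (sym (abs-* (v n) m)) (trans (cong abs eq) (abs-* k (u n)))) (ℕ.∣m⇒∣m*n (abs m) p∣w)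
      k∣dr : k ≡ δ ⊎ k ≡ r → abs k ℕ.∣ dr
      k∣dr (inj₁ refl) = ℕ.m∣m*n (abs r)
      k∣dr (inj₂ refl) = ℕ.n∣m*n (suc d)
      divides-k : p ℕ.∣ abs k → p ∈ candidates N
      divides-k h = ∈-++⁺ʳ _ (∈-upTo⁺ (ℕ.s≤s (ℕ.∣⇒≤ {{ℕ.m*n≢0 (suc d) (abs r) {{_}} {{ℕ.>-nonZero (≢0⇒abs≥1 r r≢0)}}}} (ℕ.∣-trans h (k∣dr k-case)))))
      v≢0 : v n ≢ 0ℤ
      v≢0 h = ℕ.≢-nonZero⁻¹ (w n) {{w≢0}} (cong abs h)
      u≢0 : u n ≢ 0ℤ
      u≢0 h = *-≢0 v≢0 m≢0 (trans eq (trans (cong (k *_) h) (*-zeroʳ k)))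
      divides-u : p ℕ.∣ abs (u n) → p ∈ candidates N
      divides-u h = ∈-++⁺ˡ (∈-filter⁺ (λ p → prime? p ×-dec (p ℕ.∣? abs (prodNZ u N)))
          (∈-upTo⁺ (ℕ.s≤s (ℕ.∣⇒≤ {{ℕ.>-nonZero (≢0⇒abs≥1 (prodNZ u N) (prodNZ≢0 u N))}} p∣prod))) (pr , p∣prod))
        where
        p∣prod : p ℕ.∣ abs (prodNZ u N)
        p∣prod = ℕ.∣-trans h (term∣prodNZ u N n 1≤n n≤N u≢0)

    open Window arithmetic using (bound)

    theorem : ∀ ε → 0ℚ <ℚ ε → Σ ℕ (λ C → 0 ℕ.< C × (∀ N → C ℕ.< N → ExceedsBound ε N (ω (prodNZ u N))))
    theorem ε@(mkℚ _ d-1 _) 0<ε = C , proj₁ (proj₂ B) , λ N C<N → exceedsBound ε 0<ε N (ω (prodNZ u N))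
        (proj₂ (proj₂ B) N (ω (prodNZ u N)) (candidates N) C<N (length-candidates N) (covers N))
      where
      -- The sparsity parameter is the denominator of ε.
      B = bound (suc d-1) (suc dr) (ℕ.s≤s ℕ.z≤n)
      C = proj₁ B

open import Data.Nat using (ℕ; _<_; _≤_)
open import Data.Integer using (ℤ; +_; _+_; _-_; _*_)
open import Data.Rational using (ℚ; 0ℚ) renaming (_<_ to _<ℚ_)
open import Data.Product using (Σ; _×_)
open import Relation.Binary.PropositionalEquality using (_≡_; _≢_)
open import Relation.Nullary using (¬_)

theorem2p1 : (r s u0 u1 : ℤ) →
    r * r + (+ 4) * s ≢ + 0 →
    s ≢ + 0 →
    u1 * u1 - r * u0 * u1 - s * u0 * u0 ≢ + 0 →
    ((k : ℕ) → 1 ≤ k → lucasU r s k ≢ + 0) →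
    (ε : ℚ) → 0ℚ <ℚ ε →
    Σ ℕ (λ C → 0 < C × ((N : ℕ) → C < N →
    ExceedsBound ε N (ω (prodNZ (useq r s u0 u1) N))))
theorem2p1 r s u0 u1 D≢0 s≢0 Δ≢0 U≢0 =
  Main.theorem r s u0 u1 D≢0 s≢0 r≢0′ U≢0 norm _ (Link.Δ≡ norm u0 u1) (*-≢0 (*-≢0 r≢0′ r≢0′) Δ≢0)
  where
  open Integers
  norm = normalise r s s≢0
  r≢0′ = r≢0 r s U≢0
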